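{- Let $\mathbb K$ be a commutative ring and $A$ a $\mathbb K$-algebra whose underlying $\mathbb K$-module is projective. Let $y\in\mathrm{NT}(A)$, let $l\geq1$ and let $z_1,\dots,z_l\in\mathscr F(A)$. Then $$y\cdot(z_1*z_2*\cdots*z_l)=\sum_{(y)}(y_{(1)}\cdot z_1)*(y_{(2)}\cdot z_2)*\cdots*(y_{(l)}\cdot z_l).$$
   Context: $\mathfrak S_n$ is the symmetric group on $\{1,\dots,n\}$ with unit $e_n$; $x_{\mathbf c}=\sum_{\sigma\in X_{\mathbf c}}\sigma$ where $X_{\mathbf c}$ is the set of permutations increasing on each block of the composition $\mathbf c$; $\sigma\times\sigma'$ is juxtaposition of permutations; standardization of a word replaces letters by $1,2,\dots$ smallest first, equal letters left to right. $\mathscr F(A)=\bigoplus_{n\ge0}\mathscr F_n(A)$, $\mathscr F_n(A)=A^{\otimes n}\otimes\mathbb K\mathfrak S_n$ with elements $(a_1\otimes\cdots\otimes a_n)\#\sigma$ and left action $\pi\cdot[(a_1\otimes\cdots\otimes a_n)\#\sigma]=[(a_{\pi^{ -1}(1)}\otimes\cdots\otimes a_{\pi^{ -1}(n)})\#(\pi\sigma)]$. External product: $[(a_1\otimes\cdots\otimes a_n)\#\sigma]*[(a'_1\otimes\cdots\otimes a'_{n'})\#\sigma']=x_{(n,n')}\cdot[(a_1\otimes\cdots\otimes a_n\otimes a'_1\otimes\cdots\otimes a'_{n'})\#(\sigma\times\sigma')]$. Coproduct: $\Delta((a_1\otimes\cdots\otimes a_n)\#\sigma)=\sum_{n'=0}^n[(a_1\otimes\cdots\otimes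 a_{n'})\#\pi_{n'}]\otimes[(a_{n'+1}\otimes\cdots\otimes a_n)\#\pi'_{n-n'}]$, $\pi_{n'}$ (resp. $\pi'_{n-n'}$) the inverse of the standardization of $\sigma^{ -1}(1)\cdots\sigma^{ -1}(n')$ (resp. $\sigma^{ -1}(n'+1)\cdots\sigma^{ -1}(n)$); counit the projection to $\mathscr F_0(A)=\mathbb K$. Iterated coproducts: $\Delta_1=\mathrm{id}$, $\Delta_2=\Delta$, $\Delta_l=(\Delta\otimes\mathrm{id}^{\otimes l-2})\circ\cdots\circ\Delta$, written in Sweedler notation $\Delta_l(y)=\sum_{(y)}y_{(1)}\otimes\cdots\otimes y_{(l)}$. Internal product: on $\mathscr F_n(A)$, $[(a_1\otimes\cdots\otimes a_n)\#\sigma]\cdot[(b_1\otimes\cdots\otimes b_n)\#\tau]=[(a_1b_{\sigma^{ -1}(1)}\otimes\cdots\otimes a_nb_{\sigma^{ -1}(n)})\#(\sigma\tau)]$, extended to $\mathscr F(A)$ by $(\sum_n\alpha_n)\cdot(\sum_n\alpha'_n)=\sum_n\alpha_n\cdot\alpha'_n$ ($\alpha_n,\alpha'_n\in\mathscr F_n(A)$). $\mathrm{TS}^n(A)\subseteq A^{\otimes n}$ is the module of $\mathfrak S_n$-invariant (symmetric) tensors, and the Novelli–Thibon algebra $\mathrm{NT}(A)$ is the subalgebra of $(\mathscr F(A),*)$ generated by all $t\#e_n$ with $t\in\mathrm{TS}^n(A)$, $n\ge0$. -}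

module Defs where

open import Level using (Level; _⊔_) renaming (suc to lsuc)
open import Function using (_∘_; const)
open import Function.Bundles using (_↔_)
open import Function.Construct.Composition using (_↔-∘_)
open import Function.Construct.Symmetry using (↔-sym)
open import Data.Sum.Function.Propositional using (_⊎-cong_)
open import Algebra.Bundles using (CommutativeRing)
import Algebra.Structures as AS
open import Algebra.Module.Bundles using (LeftModule)
open import Algebra.Module.Morphism.Structures using (module LeftModuleMorphisms)
open import Data.Bool using (Bool; true; false)
open import Data.Nat as ℕ using (ℕ; zero; suc; _∸_)
open import Data.Nat.Properties using (m+[n∸m]≡n)
open import Data.Fin as Fin using (Fin; toℕ; inject≤; cast)
open import Data.Fin.Properties using (toℕ≤pred[n]; +↔⊎; all?)
open import Data.Fin.Permutation as Perm
  using (Permutation′; _⟨$⟩ʳ_; _⟨$⟩ˡ_; _∘ₚ_; lift₀; transpose)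
open import Data.List as List using (List; []; _∷_; [_]; concatMap; filter; allFin)
open import Data.Vec as Vec using (Vec)
open import Data.Vec.Functional using (updateAt) renaming (_++_ to _++ʷ_)
open import Data.Product using (Σ; ∃; _×_; _,_)
open import Relation.Nullary.Decidable using (_→-dec_; _×-dec_; yes; no)
open import Relation.Binary.PropositionalEquality using (_≡_; refl)

record KAlgebra {c ℓ} (K : CommutativeRing c ℓ) (a ℓa : Level)
       : Set (c ⊔ ℓ ⊔ lsuc (a ⊔ ℓa)) where
  field
    leftModule : LeftModule (CommutativeRing.ring K) a ℓa
  open LeftModule leftModule public
  field
    _·ᴬ_ : Carrierᴹ → Carrierᴹ → Carrierᴹ
    1ᴬ   : Carrierᴹ
    isRing : AS.IsRing _≈ᴹ_ _+ᴹ_ _·ᴬ_ -ᴹ_ 0ᴹ 1ᴬ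
    *ₗ-·ᴬ-assocˡ : ∀ r x y → ((r *ₗ x) ·ᴬ y) ≈ᴹ (r *ₗ (x ·ᴬ y))
    *ₗ-·ᴬ-assocʳ : ∀ r x y → (x ·ᴬ (r *ₗ y)) ≈ᴹ (r *ₗ (x ·ᴬ y))

module _ {c ℓ} (K : CommutativeRing c ℓ) where
  private R = CommutativeRing.ring K

  IsLinear : ∀ {m ℓm n ℓn} (M : LeftModule R m ℓm) (N : LeftModule R n ℓn) →
             (LeftModule.Carrierᴹ M → LeftModule.Carrierᴹ N) → Set _
  IsLinear M N f = LeftModuleMorphisms.IsLeftModuleHomomorphism
                     (LeftModule.rawLeftModule M) (LeftModule.rawLeftModule N) f

  IsProjective : ∀ {a ℓa} (P : LeftModule R a ℓa) (m ℓm : Level) →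
                 Set (c ⊔ ℓ ⊔ a ⊔ ℓa ⊔ lsuc (m ⊔ ℓm))
  IsProjective P m ℓm =
    (M N : LeftModule R m ℓm) →
    (f : LeftModule.Carrierᴹ M → LeftModule.Carrierᴹ N) → IsLinear M N f →
    (∀ y → ∃ λ x → LeftModule._≈ᴹ_ N (f x) y) →
    (g : LeftModule.Carrierᴹ P → LeftModule.Carrierᴹ N) → IsLinear P N g →
    ∃ λ (h : LeftModule.Carrierᴹ P → LeftModule.Carrierᴹ M) →
      IsLinear P M h × (∀ x → LeftModule._≈ᴹ_ N (f (h x)) (g x))

-- Permutation combinatorics (permutations of Fin n; composition πσ means
-- "first σ, then π", i.e. σ ∘ₚ π in stdlib's diagrammatic notation).

allPerms : ∀ n → List (Permutation′ n)
allPerms zero    = [ Perm.id ]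
allPerms (suc n) =
  concatMap (λ i → List.map (λ p → lift₀ p ∘ₚ transpose Fin.zero i) (allPerms n))
            (allFin (suc n))

_×ₚ_ : ∀ {n n'} → Permutation′ n → Permutation′ n' → Permutation′ (n ℕ.+ n')
σ ×ₚ σ' = ↔-sym +↔⊎ ↔-∘ ((σ ⊎-cong σ') ↔-∘ +↔⊎)

inFirstBlock : ∀ n {n'} → Fin (n ℕ.+ n') → Bool
inFirstBlock n i = toℕ i ℕ.<ᵇ n

X₂ : ∀ n n' → List (Permutation′ (n ℕ.+ n'))
X₂ n n' = filter incr? (allPerms (n ℕ.+ n'))
  where
  incr? : ∀ σ → _
  incr? σ = all? λ i → all? λ j →
    ((inFirstBlock n i Data.Bool.≟ inFirstBlock n j) ×-dec (i Fin.<? j))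
      →-dec ((σ ⟨$⟩ʳ i) Fin.<? (σ ⟨$⟩ʳ j))

-- standardization of a word w of length k (with distinct letters), as a
-- permutation τ of Fin k in one-line notation τ(1)…τ(k): the (unique)
-- permutation order-isomorphic to w.  (The fallback Perm.id is never used
-- for words with distinct letters, which is the only case needed.)
std : ∀ {k n} → (Fin k → Fin n) → Permutation′ k
std {k} w with filter ordIso? (allPerms k)
  where
  ordIso? : ∀ τ → _
  ordIso? τ = all? λ i → all? λ j →
    ((w i Fin.<? w j) →-dec ((τ ⟨$⟩ʳ i) Fin.<? (τ ⟨$⟩ʳ j))) ×-dec
    (((τ ⟨$⟩ʳ i) Fin.<? (τ ⟨$⟩ʳ j)) →-dec (w i Fin.<? w j))
... | []    = Perm.id
... | τ ∷ _ = τ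

-- The algebra F(A) = ⊕ₙ A^{⊗n} ⊗ K𝔖ₙ, presented as formal K-linear
-- combinations of symbols (a₁⊗⋯⊗aₙ)#σ modulo the relations of the free
-- K-module and multilinearity in each tensor slot.

module FA {c ℓ a ℓa} (K : CommutativeRing c ℓ) (A : KAlgebra K a ℓa) where
  open CommutativeRing K using () renaming
    (Carrier to 𝕂; _≈_ to _≈ᴷ_; _+_ to _+ᴷ_; _*_ to _*ᴷ_; 0# to 0ᴷ; 1# to 1ᴷ)
  open KAlgebra A using () renaming
    (Carrierᴹ to 𝔸; _≈ᴹ_ to _≈ᴬ_; _+ᴹ_ to _+ᴬ_; _*ₗ_ to _•ᴬ_; _·ᴬ_ to _·ᴬ_)

  _[_]≔_ : ∀ {n} → (Fin n → 𝔸) → Fin n → 𝔸 → (Fin n → 𝔸)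
  w [ i ]≔ x = updateAt w i (const x)

  Tensor : ℕ → Set (c ⊔ a)
  Tensor n = List (𝕂 × (Fin n → 𝔸))

  infix 4 _≋ᵀ_
  data _≋ᵀ_ {n} : Tensor n → Tensor n → Set (c ⊔ ℓ ⊔ a ⊔ ℓa) where
    ≋ᵀ-refl  : ∀ {x} → x ≋ᵀ x
    ≋ᵀ-sym   : ∀ {x y} → x ≋ᵀ y → y ≋ᵀ x
    ≋ᵀ-trans : ∀ {x y z} → x ≋ᵀ y → y ≋ᵀ z → x ≋ᵀ z
    ≋ᵀ-++    : ∀ {x x' y y'} → x ≋ᵀ x' → y ≋ᵀ y' → (x List.++ y) ≋ᵀ (x' List.++ y')
    ≋ᵀ-comm  : ∀ x y → (x List.++ y) ≋ᵀ (y List.++ x)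
    ≋ᵀ-term  : ∀ {r r' w w'} → r ≈ᴷ r' → (∀ i → w i ≈ᴬ w' i) →
               [ (r , w) ] ≋ᵀ [ (r' , w') ]
    ≋ᵀ-coef+ : ∀ r s w → ((r , w) ∷ (s , w) ∷ []) ≋ᵀ [ (r +ᴷ s , w) ]
    ≋ᵀ-coef0 : ∀ w → [ (0ᴷ , w) ] ≋ᵀ []
    ≋ᵀ-slot+ : ∀ r w i x y →
               [ (r , w [ i ]≔ (x +ᴬ y)) ] ≋ᵀ ((r , w [ i ]≔ x) ∷ (r , w [ i ]≔ y) ∷ [])
    ≋ᵀ-slot• : ∀ r w i s x →
               [ (r , w [ i ]≔ (s •ᴬ x)) ] ≋ᵀ [ (r *ᴷ s , w [ i ]≔ x) ]

  actᵀ : ∀ {n} → Permutation′ n → Tensor n → Tensor n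
  actᵀ π = List.map λ { (r , w) → (r , λ i → w (π ⟨$⟩ˡ i)) }

  Symmetric : ∀ {n} → Tensor n → Set (c ⊔ ℓ ⊔ a ⊔ ℓa)
  Symmetric t = ∀ π → actᵀ π t ≋ᵀ t

  record Term : Set (c ⊔ a) where
    constructor term
    field
      deg  : ℕ
      coef : 𝕂
      word : Fin deg → 𝔸
      perm : Permutation′ deg

  𝓕 : Set (c ⊔ a)
  𝓕 = List Term

  infix 4 _≋_
  data _≋_ : 𝓕 → 𝓕 → Set (c ⊔ ℓ ⊔ a ⊔ ℓa) where
    ≋-refl  : ∀ {x} → x ≋ x
    ≋-sym   : ∀ {x y} → x ≋ y → y ≋ x
    ≋-trans : ∀ {x y z} → x ≋ y → y ≋ z → x ≋ z
    ≋-++    : ∀ {x x' y y'} → x ≋ x' → y ≋ y' → (x List.++ y) ≋ (x' List.++ y')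
    ≋-comm  : ∀ x y → (x List.++ y) ≋ (y List.++ x)
    ≋-term  : ∀ {n r r' w w' σ σ'} → r ≈ᴷ r' → (∀ i → w i ≈ᴬ w' i) → σ Perm.≈ σ' →
              [ term n r w σ ] ≋ [ term n r' w' σ' ]
    ≋-coef+ : ∀ {n} r s w σ →
              (term n r w σ ∷ term n s w σ ∷ []) ≋ [ term n (r +ᴷ s) w σ ]
    ≋-coef0 : ∀ {n} w σ → [ term n 0ᴷ w σ ] ≋ []
    ≋-slot+ : ∀ {n} r w σ (i : Fin n) x y →
              [ term n r (w [ i ]≔ (x +ᴬ y)) σ ] ≋
              (term n r (w [ i ]≔ x) σ ∷ term n r (w [ i ]≔ y) σ ∷ [])
    ≋-slot• : ∀ {n} r w σ (i : Fin n) s x →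
              [ term n r (w [ i ]≔ (s •ᴬ x)) σ ] ≋ [ term n (r *ᴷ s) (w [ i ]≔ x) σ ]

  -- K-module structure: zero is [], sum is _++_, scalars:
  _•_ : 𝕂 → 𝓕 → 𝓕
  r • x = List.map (λ { (term n s w σ) → term n (r *ᴷ s) w σ }) x

  act : ∀ {n} → Permutation′ n → 𝕂 → (Fin n → 𝔸) → Permutation′ n → Term
  act {n} π r w σ = term n r (λ i → w (π ⟨$⟩ˡ i)) (σ ∘ₚ π)

  _*ₜ_ : Term → Term → 𝓕
  term n r w σ *ₜ term n' r' w' σ' =
    List.map (λ χ → act χ (r *ᴷ r') (w ++ʷ w') (σ ×ₚ σ')) (X₂ n n')

  infixl 7 _*_
  _*_ : 𝓕 → 𝓕 → 𝓕
  x * y = concatMap (λ t → concatMap (t *ₜ_) y) x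

  _·ₜ_ : Term → Term → 𝓕
  term n r w σ ·ₜ term m s v τ with n ℕ.≟ m
  ... | yes refl =
          [ term n (r *ᴷ s) (λ i → w i ·ᴬ v (σ ⟨$⟩ˡ i)) (τ ∘ₚ σ) ]
  ... | no _ = []

  infixl 8 _·_
  _·_ : 𝓕 → 𝓕 → 𝓕
  x · y = concatMap (λ t → concatMap (t ·ₜ_) y) x

  Δₜ : Term → List (Term × Term)
  Δₜ (term n r w σ) = List.map split (allFin (suc n))
    where
    split : Fin (suc n) → Term × Term
    split p = term p' r (w ∘ ι₁) (Perm.flip (std (λ i → σ ⟨$⟩ˡ ι₁ i)))
            , term q 1ᴷ (w ∘ ι₂) (Perm.flip (std (λ i → σ ⟨$⟩ˡ ι₂ i)))
      where
      p' = toℕ p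
      q  = n ∸ p'
      ι₁ : Fin p' → Fin n
      ι₁ i = inject≤ i (toℕ≤pred[n] p)
      ι₂ : Fin q → Fin n
      ι₂ i = cast (m+[n∸m]≡n (toℕ≤pred[n] p)) (p' Fin.↑ʳ i)

  Δ[_] : ∀ k → Term → List (Vec Term (suc k))
  Δ[ zero  ] t = [ Vec.[ t ] ]
  Δ[ suc k ] t = concatMap (λ { (u Vec.∷ us) → List.map (λ { (u₁ , u₂) → u₁ Vec.∷ u₂ Vec.∷ us }) (Δₜ u) })
                           (Δ[ k ] t)

  prod* : ∀ {k} → Vec 𝓕 (suc k) → 𝓕
  prod* (z Vec.∷ Vec.[]) = z
  prod* (z Vec.∷ zs@(_ Vec.∷ _)) = z * prod* zs

  sweedlerSum : ∀ {k} → 𝓕 → Vec 𝓕 (suc k) → 𝓕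
  sweedlerSum {k} y z =
    concatMap (λ t → concatMap (λ u → prod* (Vec.zipWith (λ uᵢ zᵢ → [ uᵢ ] · zᵢ) u z)) (Δ[ k ] t)) y

  _#e : ∀ {n} → Tensor n → 𝓕
  _#e {n} t = List.map (λ { (r , w) → term n r w Perm.id }) t

  data InNT : 𝓕 → Set (c ⊔ ℓ ⊔ a ⊔ ℓa) where
    gen   : ∀ n (t : Tensor n) → Symmetric t → InNT (t #e)
    zero  : InNT []
    add   : ∀ {x y} → InNT x → InNT y → InNT (x List.++ y)
    scale : ∀ r {x} → InNT x → InNT (r • x)
    mul   : ∀ {x y} → InNT x → InNT y → InNT (x * y)
    resp  : ∀ {x y} → x ≋ y → InNT x → InNT y

{-# OPTIONS --safe #-}

-- By multilinearity the factors z_i = b_i#τ_i are single terms, of degrees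
-- c = (n_1, …, n_l). Write X_c for the permutations increasing on the blocks of
-- c and S_c for the Young subgroup; every permutation is uniquely χ s with
-- χ ∈ X_c and s ∈ S_c. Then z_1 * ⋯ * z_l = Σ_{π ∈ X_c} π·(b#τ), and
-- y_(1)·z_1 * ⋯ * y_(l)·z_l for y = w#σ is Σ_{π ∈ X_c} π·((w#s)·(b#τ)), where s
-- is the element of S_c such that σ⁻¹ s ∈ X_c.
--
-- NT(A) is spanned by the sums Σ_{χ ∈ X_d} χ·(T#e) with T invariant under S_d,
-- because X_{d⊕d'} is the product of the shuffles by X_d × X_d'. For such y both
-- sides of the identity are sums of G(χ, g) = (χ·T)(g·b)#gτ: on the left over
-- (χ, g) with χ ∈ X_d and χ⁻¹g ∈ X_c; on the right over (πχ', πs) with π ∈ X_c,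
-- s ∈ S_c, χ' ∈ X_d and χ'⁻¹s ∈ X_c. As G only depends on the coset χ S_d, for
-- fixed g = πs the two index sets are matched by χ S_d = πχ' S_d.

module Submission where

open import Defs
open import Level using (Level)
open import Algebra.Bundles using (CommutativeRing)
open import Data.Nat using (ℕ; suc)
open import Data.Vec using (Vec)

open import Level using (_⊔_)
import Algebra.Structures as AS
open import Data.Bool using (Bool; true; false)
import Data.Bool.Properties as Bool
open import Data.Empty using (⊥-elim)
open import Data.Fin as Fin using (Fin; zero; suc; toℕ; _↑ˡ_; _↑ʳ_; splitAt; inject≤; cast; fromℕ<)
open import Data.Fin.Permutation as Perm
  using (Permutation′; _⟨$⟩ʳ_; _⟨$⟩ˡ_; _∘ₚ_; lift₀; transpose; inverseˡ; inverseʳ)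
import Data.Fin.Properties as Fin
open import Data.List as List
  using (List; []; _∷_; [_]; _++_; map; concatMap; filter; allFin; tabulate)
open import Data.List.Membership.Propositional using (lose)
open import Data.List.Membership.Propositional.Properties using (∈-allFin)
import Data.List.Properties as List
open import Data.List.Relation.Unary.Any as Any using (Any; here; there)
import Data.List.Relation.Unary.Any.Properties as Any
open import Data.Nat as ℕ using (zero; s≤s)
open import Data.Nat.Induction using (<-wellFounded)
import Data.Nat.Properties as ℕ
open import Data.Product using (∃; ∃₂; _×_; _,_; proj₁; proj₂)
open import Data.Sum using (_⊎_; inj₁; inj₂)
open import Data.Sum.Properties using (inj₁-injective; inj₂-injective) renaming (≡-dec to ⊎-≡-dec)
open import Data.Unit using (⊤; tt)
import Data.Unit.Properties as Unit
open import Data.Vec as Vec using ([]; _∷_)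
open import Data.Vec.Functional using () renaming (_++_ to _++ʷ_)
open import Data.Vec.Functional.Properties using (updateAt-updates; updateAt-minimal)
import Data.Vec.Properties as Vec
open import Data.Vec.Relation.Binary.Pointwise.Inductive as PW using (Pointwise; []; _∷_)
open import Function using (_∘_)
open import Function.Bundles using (mk↔ₛ′)
open import Induction.WellFounded using (Acc; acc)
open import Relation.Binary.Bundles using (Setoid)
open import Relation.Binary.Definitions using (DecidableEquality; tri<; tri≈; tri>)
open import Relation.Binary.PropositionalEquality
  using (_≡_; _≢_; refl; sym; trans; cong; cong₂; subst; subst₂)
import Relation.Binary.Reasoning.Setoid as SetoidReasoning
open import Relation.Nullary using (Dec; yes; no; ¬_)
open import Relation.Nullary.Decidable using (_→-dec_; _×-dec_)
open import Relation.Unary using (Decidable)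

-- The matching of the two index sets also has to match their conditions: if χ S_d = πχ' S_d, then
-- χ⁻¹πs and χ'⁻¹s must lie in X_c together. These two permutations agree up to S_d. Where two of
-- their values lie in different blocks of d, the order is decided because blocks are intervals;
-- inside one block it is carried through the increasing maps χ, π and χ'. This is why `Convex`
-- accompanies the invariance of T in `OrbitSum`.
--
-- On the coproduct side, Δ_l of a symbol runs over all ways of cutting it into l intervals, and the
-- internal product kills factors of unequal degree, so one cut survives. Its factors arise by
-- repeated standardization along nested intervals, which must be collapsed to a single one;
-- uniqueness of order isomorphisms does this.
--
-- Compositions are encoded as colourings because the blocks of a product are then a disjoint sum of
-- colours. Permutations are compared pointwise only, so sums over them are reindexed by inserting
-- indicators that hold exactly once, instead of rearranging lists.

module _ {n} (σ : Permutation′ n) where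

  ⟨$⟩ʳ-injective : ∀ {i j} → σ ⟨$⟩ʳ i ≡ σ ⟨$⟩ʳ j → i ≡ j
  ⟨$⟩ʳ-injective e = trans (sym (inverseˡ σ)) (trans (cong (σ ⟨$⟩ˡ_) e) (inverseˡ σ))

  ⟨$⟩ˡ-injective : ∀ {i j} → σ ⟨$⟩ˡ i ≡ σ ⟨$⟩ˡ j → i ≡ j
  ⟨$⟩ˡ-injective e = trans (sym (inverseʳ σ)) (trans (cong (σ ⟨$⟩ʳ_) e) (inverseʳ σ))

≈-flip : ∀ {n} {σ τ : Permutation′ n} → σ Perm.≈ τ → ∀ i → σ ⟨$⟩ˡ i ≡ τ ⟨$⟩ˡ i
≈-flip {σ = σ} {τ} e i =
  ⟨$⟩ʳ-injective σ (trans (inverseʳ σ) (sym (trans (e _) (inverseʳ τ))))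

abstract
  ≈-dec : ∀ {n} (σ τ : Permutation′ n) → Dec (σ Perm.≈ τ)
  ≈-dec σ τ = Fin.all? λ i → (σ ⟨$⟩ʳ i) Fin.≟ (τ ⟨$⟩ʳ i)

-- A colouring encodes a set partition by its colour classes: Pres is the Young
-- subgroup and Inc its set of left coset representatives. In stdlib's
-- diagrammatic order the product χ s is s ∘ₚ χ.
record Colouring (n : ℕ) : Set₁ where
  field
    Colour : Set
    _≟ᶜ_   : DecidableEquality Colour
    colour : Fin n → Colour

open Colouring

Inc : ∀ {n} → Colouring n → Permutation′ n → Set
Inc C σ = ∀ i j → colour C i ≡ colour C j × i Fin.< j → (σ ⟨$⟩ʳ i) Fin.< (σ ⟨$⟩ʳ j)

Pres : ∀ {n} → Colouring n → Permutation′ n → Set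
Pres C σ = ∀ i → colour C (σ ⟨$⟩ʳ i) ≡ colour C i

abstract
  inc? : ∀ {n} (C : Colouring n) → Decidable (Inc C)
  inc? C σ = Fin.all? λ i → Fin.all? λ j →
    (_≟ᶜ_ C (colour C i) (colour C j) ×-dec (i Fin.<? j)) →-dec ((σ ⟨$⟩ʳ i) Fin.<? (σ ⟨$⟩ʳ j))

  pres? : ∀ {n} (C : Colouring n) → Decidable (Pres C)
  pres? C σ = Fin.all? λ i → _≟ᶜ_ C (colour C (σ ⟨$⟩ʳ i)) (colour C i)

module _ {n} (C : Colouring n) where

  Inc-resp : ∀ {σ τ} → σ Perm.≈ τ → Inc C σ → Inc C τ
  Inc-resp e inc i j h = subst₂ Fin._<_ (e i) (e j) (inc i j h)

  Pres-resp : ∀ {σ τ} → σ Perm.≈ τ → Pres C σ → Pres C τ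
  Pres-resp e p i = trans (cong (colour C) (sym (e i))) (p i)

  Pres-flip : ∀ {σ} → Pres C σ → Pres C (Perm.flip σ)
  Pres-flip {σ} p i = trans (sym (p _)) (cong (colour C) (inverseʳ σ))

  Pres-∘ : ∀ {σ τ} → Pres C σ → Pres C τ → Pres C (σ ∘ₚ τ)
  Pres-∘ p q i = trans (q _) (p i)

  Inc-reflects : ∀ {σ} → Inc C σ → ∀ {i j} → colour C i ≡ colour C j →
                 (σ ⟨$⟩ʳ i) Fin.< (σ ⟨$⟩ʳ j) → i Fin.< j
  Inc-reflects {σ} inc {i} {j} e lt with Fin.<-cmp i j
  ... | tri< i<j _ _ = i<j
  ... | tri≈ _ refl _ = ⊥-elim (Fin.<-irrefl refl lt)
  ... | tri> _ _ j<i = ⊥-elim (ℕ.<-asym lt (inc j i (sym e , j<i)))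

  -- Strong induction on `i`, everything below it being fixed. A value below `i` is itself fixed, so
  -- injectivity gives the claim. If instead `i` moves up, its preimage lies above `i` in the same
  -- class and is sent below the image of `i`, against monotonicity.
  Pres∧Inc⇒id : ∀ {k} → Pres C k → Inc C k → k Perm.≈ Perm.id
  Pres∧Inc⇒id {k} pres inc i = go i (<-wellFounded (toℕ i))
    where
    go : ∀ i → Acc ℕ._<_ (toℕ i) → k ⟨$⟩ʳ i ≡ i
    go i (acc rec) with Fin.<-cmp (k ⟨$⟩ʳ i) i
    ... | tri≈ _ e _ = e
    ... | tri< lt _ _ = ⟨$⟩ʳ-injective k (go (k ⟨$⟩ʳ i) (rec lt))
    ... | tri> _ _ gt = ⊥-elim (back (k ⟨$⟩ˡ i) (inverseʳ k))
      where
      back : ∀ j → k ⟨$⟩ʳ j ≢ i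
      back j e with Fin.<-cmp j i
      ... | tri< lt _ _ = Fin.<-irrefl (trans (sym (go j (rec lt))) e) lt
      ... | tri≈ _ refl _ = Fin.<-irrefl (sym e) gt
      ... | tri> _ _ i<j = ℕ.<-asym gt
        (subst ((k ⟨$⟩ʳ i) Fin.<_) e (inc i j (trans (cong (colour C) (sym e)) (pres j) , i<j)))

-- Sorting, and factorisation along a Young subgroup.

argmin : ∀ {n} {P : Fin n → Set} → Decidable P → (g : Fin n → ℕ) → ∀ k → P k →
         ∃ λ m → P m × (∀ j → P j → g m ℕ.≤ g j)
argmin {n} {P} P? g k p = go k p (<-wellFounded (g k))
  where
  go : ∀ k → P k → Acc ℕ._<_ (g k) → ∃ λ m → P m × (∀ j → P j → g m ℕ.≤ g j)
  go k p (acc rec) with Fin.any? (λ j → P? j ×-dec (g j ℕ.<? g k))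
  ... | yes (j , q , lt) = go j q (rec lt)
  ... | no none = k , p , λ j q → ℕ.≮⇒≥ (λ lt → none (j , q , lt))

transpose-invariant : ∀ {n a} {A : Set a} (f : Fin n → A) {i j} → f i ≡ f j →
                      ∀ k → f (transpose i j ⟨$⟩ʳ k) ≡ f k
transpose-invariant f {i} {j} e k with k Fin.≟ i
... | yes refl = sym e
... | no _ with k Fin.≟ j
...   | yes refl = e
...   | no _ = refl

restrict-suc : ∀ {n} → Colouring (suc n) → Colouring n
restrict-suc C = record { Colour = Colour C ; _≟ᶜ_ = _≟ᶜ_ C ; colour = colour C ∘ suc }

-- Selection sort inside each colour class.
sort : ∀ {n} (C : Colouring n) (g : Fin n → ℕ) → (∀ {i j} → g i ≡ g j → i ≡ j) →
       ∃ λ h → Pres C h × (∀ i j → colour C i ≡ colour C j × i Fin.< j →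
                           g (h ⟨$⟩ʳ i) ℕ.< g (h ⟨$⟩ʳ j))
sort {zero} C g g-inj = Perm.id , (λ ()) , λ ()
sort {suc n} C g g-inj = h , h-pres , h-inc
  where
  m = argmin (λ j → _≟ᶜ_ C (colour C j) (colour C zero)) g zero refl
  k = proj₁ m
  t = transpose zero k
  t-pres : Pres C t
  t-pres = transpose-invariant (colour C) (sym (proj₁ (proj₂ m)))
  IH = sort (restrict-suc C) (λ i → g (t ⟨$⟩ʳ suc i))
            (λ e → Fin.suc-injective (⟨$⟩ʳ-injective t (g-inj e)))
  h = lift₀ (proj₁ IH) ∘ₚ t
  h-pres : Pres C h
  h-pres zero = t-pres zero
  h-pres (suc i) = trans (t-pres _) (proj₁ (proj₂ IH) i)
  h-inc : ∀ i j → colour C i ≡ colour C j × i Fin.< j → g (h ⟨$⟩ʳ i) ℕ.< g (h ⟨$⟩ʳ j)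
  h-inc zero (suc j) (e , _) = ℕ.≤∧≢⇒<
    (proj₂ (proj₂ m) (h ⟨$⟩ʳ suc j) (trans (h-pres (suc j)) (sym e)))
    (λ eq → zero≢suc (⟨$⟩ʳ-injective h {zero} {suc j} (g-inj eq)))
    where
    zero≢suc : Fin.zero ≢ suc j
    zero≢suc ()
  h-inc (suc i) (suc j) (e , s≤s lt) = proj₂ (proj₂ IH) i j (e , lt)

module _ {n} (C : Colouring n) where

  -- `sort` arranges the values of `g` increasingly within each class: if `h` is the sorting
  -- permutation, then `χ` is g h and `s` is the inverse of `h`.
  decompose : ∀ g → ∃₂ λ χ s → Inc C χ × Pres C s × g Perm.≈ (s ∘ₚ χ)
  decompose g with sort C (λ i → toℕ (g ⟨$⟩ʳ i)) (λ e → ⟨$⟩ʳ-injective g (Fin.toℕ-injective e))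
  ... | h , pres , inc = h ∘ₚ g , Perm.flip h , inc , Pres-flip C {h} pres ,
                         λ i → cong (g ⟨$⟩ʳ_) (sym (inverseʳ h))

  -- The two factorisations differ by `k`, that is s' s⁻¹, for which χ = χ' k. It preserves the
  -- classes, and it is increasing on them because `χ` is and `χ'` reflects the order; hence it is
  -- the identity.
  decompose-unique : ∀ {χ s χ' s'} → Inc C χ → Pres C s → Inc C χ' → Pres C s' →
                     (s ∘ₚ χ) Perm.≈ (s' ∘ₚ χ') → χ Perm.≈ χ' × s Perm.≈ s'
  decompose-unique {χ} {s} {χ'} {s'} inc pres inc' pres' e =
    (λ i → trans (χ≈ i) (cong (χ' ⟨$⟩ʳ_) (k≈id i))) ,
    (λ i → trans (sym (k≈id (s ⟨$⟩ʳ i))) (cong (s' ⟨$⟩ʳ_) (inverseˡ s)))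
    where
    k = Perm.flip s ∘ₚ s'
    χ≈ : ∀ i → χ ⟨$⟩ʳ i ≡ χ' ⟨$⟩ʳ (k ⟨$⟩ʳ i)
    χ≈ i = trans (cong (χ ⟨$⟩ʳ_) (sym (inverseʳ s))) (e _)
    k-pres : Pres C k
    k-pres = Pres-∘ C {Perm.flip s} {s'} (Pres-flip C {s} pres) pres'
    k≈id : k Perm.≈ Perm.id
    k≈id = Pres∧Inc⇒id C {k} k-pres λ i j (same , lt) →
      Inc-reflects C {χ'} inc' (trans (k-pres i) (trans same (sym (k-pres j))))
        (subst₂ Fin._<_ (χ≈ i) (χ≈ j) (inc i j (same , lt)))

-- Standardization and the enumeration of all permutations.

trivial : ∀ n → Colouring n
trivial n = record { Colour = ⊤ ; _≟ᶜ_ = Unit._≟_ ; colour = λ _ → tt }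

OrdIso : ∀ {k n} → (Fin k → Fin n) → Permutation′ k → Set
OrdIso w τ = ∀ i j →
  ((w i Fin.< w j) → ((τ ⟨$⟩ʳ i) Fin.< (τ ⟨$⟩ʳ j))) ×
  (((τ ⟨$⟩ʳ i) Fin.< (τ ⟨$⟩ʳ j)) → (w i Fin.< w j))

-- The permutation sorting the letters of `w` lists the positions by increasing letter; its inverse
-- gives each position its rank, which is the standardization.
ordIso-exists : ∀ {k n} (w : Fin k → Fin n) → (∀ {i j} → w i ≡ w j → i ≡ j) → ∃ (OrdIso w)
ordIso-exists {k} w w-inj with sort (trivial k) (toℕ ∘ w) (w-inj ∘ Fin.toℕ-injective)
... | h , _ , inc = Perm.flip h , λ i j → to i j , from i j
  where
  from : ∀ i j → (h ⟨$⟩ˡ i) Fin.< (h ⟨$⟩ˡ j) → w i Fin.< w j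
  from i j lt = subst₂ (λ x y → w x Fin.< w y) (inverseʳ h) (inverseʳ h) (inc _ _ (refl , lt))
  to : ∀ i j → w i Fin.< w j → (h ⟨$⟩ˡ i) Fin.< (h ⟨$⟩ˡ j)
  to i j lt with Fin.<-cmp (h ⟨$⟩ˡ i) (h ⟨$⟩ˡ j)
  ... | tri< l _ _ = l
  ... | tri≈ _ e _ = ⊥-elim (Fin.<-irrefl (cong w (⟨$⟩ˡ-injective h e)) lt)
  ... | tri> _ _ g = ⊥-elim (ℕ.<-asym lt (from j i g))

-- τ'τ⁻¹ is increasing on all of `Fin k`, so the one-class case of `Pres∧Inc⇒id` makes it trivial.
ordIso-unique : ∀ {k n} (w : Fin k → Fin n) {τ τ'} → OrdIso w τ → OrdIso w τ' → τ Perm.≈ τ'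
ordIso-unique {k} w {τ} {τ'} o o' i =
  trans (sym (Pres∧Inc⇒id (trivial k) {Perm.flip τ ∘ₚ τ'} (λ _ → refl) inc (τ ⟨$⟩ʳ i)))
        (cong (τ' ⟨$⟩ʳ_) (inverseˡ τ))
  where
  inc : Inc (trivial k) (Perm.flip τ ∘ₚ τ')
  inc a b (_ , lt) = proj₁ (o' _ _) (proj₂ (o _ _) (subst₂ Fin._<_ (sym (inverseʳ τ)) (sym (inverseʳ τ)) lt))

module _ {n} (p : Permutation′ (suc n)) where

  private t = transpose zero (p ⟨$⟩ʳ zero)

  -- `allPerms` lists permutations in the form `lift₀ q ∘ₚ transpose zero i`. There `i` must be the
  -- image of zero, and this is the corresponding `q`.
  unlift : Permutation′ n
  unlift = Perm.remove zero (p ∘ₚ Perm.flip t)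

  lift₀-unlift : (lift₀ unlift ∘ₚ t) Perm.≈ p
  lift₀-unlift i = trans
    (cong (t ⟨$⟩ʳ_) (Perm.lift₀-remove (p ∘ₚ Perm.flip t) (inverseˡ t {zero}) i)) (inverseʳ t)

  unlift-unique : ∀ {i q} → (lift₀ q ∘ₚ transpose zero i) Perm.≈ p →
                  i ≡ p ⟨$⟩ʳ zero × q Perm.≈ unlift
  unlift-unique {i} {q} e with e zero
  ... | refl = refl , λ j → Fin.suc-injective
    (⟨$⟩ʳ-injective t {suc (q ⟨$⟩ʳ j)} {suc (unlift ⟨$⟩ʳ j)} (trans (e (suc j)) (sym (lift₀-unlift (suc j)))))

lift₀∘transpose-cong : ∀ {n i j} {p q : Permutation′ n} → i ≡ j → p Perm.≈ q →
  (lift₀ p ∘ₚ transpose zero i) Perm.≈ (lift₀ q ∘ₚ transpose zero j)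
lift₀∘transpose-cong {i = i} {p = p} {q} refl e k =
  cong (transpose zero i ⟨$⟩ʳ_) (Perm.lift₀-cong p q e k)

allPerms-complete : ∀ {n} (p : Permutation′ n) → Any (Perm._≈ p) (allPerms n)
allPerms-complete {zero} p = here λ ()
allPerms-complete {suc n} p = Any.concatMap⁺ _ {xs = allFin (suc n)}
  (lose (∈-allFin (p ⟨$⟩ʳ zero))
    (Any.map⁺ (Any.map (λ {q} e k → trans (lift₀∘transpose-cong {p = q} {unlift p} refl e k) (lift₀-unlift p k))
                        (allPerms-complete (unlift p)))))

filter-head : ∀ {a p} {A : Set a} {P : A → Set p} (P? : Decidable P) xs {y ys} →
              filter P? xs ≡ y ∷ ys → P y
filter-head P? (x ∷ xs) e with P? x
filter-head P? (x ∷ xs) e | no _ = filter-head P? xs e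
filter-head P? (x ∷ xs) refl | yes p = p

filter-nonempty : ∀ {a p} {A : Set a} {P : A → Set p} (P? : Decidable P) {xs} → Any P xs → filter P? xs ≢ []
filter-nonempty P? {x ∷ _} q e with P? x
filter-nonempty P? (here p) e | no ¬p = ¬p p
filter-nonempty P? (there q) e | no ¬p = filter-nonempty P? q e
filter-nonempty P? q () | yes _

OrdIso-resp : ∀ {k n} (w : Fin k → Fin n) {τ τ'} → τ Perm.≈ τ' → OrdIso w τ → OrdIso w τ'
OrdIso-resp w e o i j = (λ lt → subst₂ Fin._<_ (e i) (e j) (proj₁ (o i j) lt)) ,
                        (λ lt → proj₂ (o i j) (subst₂ Fin._<_ (sym (e i)) (sym (e j)) lt))

-- The result type is inferred so that filter (ordIso? w) is syntactically the
-- list scrutinised by std, as with-abstraction requires.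
ordIso? : ∀ {k n} (w : Fin k → Fin n) (τ : Permutation′ k) → _
ordIso? w τ = Fin.all? λ i → Fin.all? λ j →
    ((w i Fin.<? w j) →-dec ((τ ⟨$⟩ʳ i) Fin.<? (τ ⟨$⟩ʳ j))) ×-dec
    (((τ ⟨$⟩ʳ i) Fin.<? (τ ⟨$⟩ʳ j)) →-dec (w i Fin.<? w j))

-- For distinct letters the fallback of `std` is excluded: an order isomorphism exists, and
-- `allPerms` contains it up to pointwise equality.
std-ordIso : ∀ {k n} (w : Fin k → Fin n) → (∀ {i j} → w i ≡ w j → i ≡ j) → OrdIso w (std w)
std-ordIso {k} w inj with filter (ordIso? w) (allPerms k) in eq
... | τ ∷ _ = filter-head (ordIso? w) (allPerms k) eq
... | [] = ⊥-elim (filter-nonempty (ordIso? w)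
  (Any.map (λ {q} e → OrdIso-resp w {proj₁ ex} {q} (λ i → sym (e i)) (proj₂ ex)) (allPerms-complete (proj₁ ex))) eq)
  where ex = ordIso-exists w inj

-- Juxtaposition, block sums of colourings and shuffles.

data Side m {n} : Fin (m ℕ.+ n) → Set where
  left  : ∀ i → Side m (i ↑ˡ n)
  right : ∀ j → Side m (m ↑ʳ j)

side : ∀ m {n} (i : Fin (m ℕ.+ n)) → Side m i
side m {n} i with splitAt m i in eq
... | inj₁ a = subst (Side m) (Fin.splitAt⁻¹-↑ˡ {m} eq) (left a)
... | inj₂ b = subst (Side m) (Fin.splitAt⁻¹-↑ʳ {m} {i = i} eq) (right b)

module _ {m n : ℕ} where

  ↑ˡ-mono : {i j : Fin m} → i Fin.< j → (i ↑ˡ n) Fin.< (j ↑ˡ n)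
  ↑ˡ-mono {i} {j} = subst₂ ℕ._<_ (sym (Fin.toℕ-↑ˡ i n)) (sym (Fin.toℕ-↑ˡ j n))

  ↑ˡ-cancel : {i j : Fin m} → (i ↑ˡ n) Fin.< (j ↑ˡ n) → i Fin.< j
  ↑ˡ-cancel {i} {j} = subst₂ ℕ._<_ (Fin.toℕ-↑ˡ i n) (Fin.toℕ-↑ˡ j n)

  ↑ʳ-mono : {i j : Fin n} → i Fin.< j → (m ↑ʳ i) Fin.< (m ↑ʳ j)
  ↑ʳ-mono {i} {j} lt = subst₂ ℕ._<_ (sym (Fin.toℕ-↑ʳ m i)) (sym (Fin.toℕ-↑ʳ m j)) (ℕ.+-monoʳ-< m lt)

  ↑ʳ-cancel : {i j : Fin n} → (m ↑ʳ i) Fin.< (m ↑ʳ j) → i Fin.< j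
  ↑ʳ-cancel {i} {j} lt = ℕ.+-cancelˡ-< m _ _ (subst₂ ℕ._<_ (Fin.toℕ-↑ʳ m i) (Fin.toℕ-↑ʳ m j) lt)

  ↑ˡ<↑ʳ : (i : Fin m) (j : Fin n) → (i ↑ˡ n) Fin.< (m ↑ʳ j)
  ↑ˡ<↑ʳ i j = subst₂ ℕ._<_ (sym (Fin.toℕ-↑ˡ i n)) (sym (Fin.toℕ-↑ʳ m j))
                (ℕ.<-≤-trans (Fin.toℕ<n i) (ℕ.m≤m+n m (toℕ j)))

  module _ (σ : Permutation′ m) (τ : Permutation′ n) where

    ×ₚ-ˡ : ∀ i → (σ ×ₚ τ) ⟨$⟩ʳ (i ↑ˡ n) ≡ (σ ⟨$⟩ʳ i) ↑ˡ n
    ×ₚ-ˡ i rewrite Fin.splitAt-↑ˡ m i n = refl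

    ×ₚ-ʳ : ∀ j → (σ ×ₚ τ) ⟨$⟩ʳ (m ↑ʳ j) ≡ m ↑ʳ (τ ⟨$⟩ʳ j)
    ×ₚ-ʳ j rewrite Fin.splitAt-↑ʳ m n j = refl

    ×ₚ-flip-ˡ : ∀ i → (σ ×ₚ τ) ⟨$⟩ˡ (i ↑ˡ n) ≡ (σ ⟨$⟩ˡ i) ↑ˡ n
    ×ₚ-flip-ˡ i rewrite Fin.splitAt-↑ˡ m i n = refl

    ×ₚ-flip-ʳ : ∀ j → (σ ×ₚ τ) ⟨$⟩ˡ (m ↑ʳ j) ≡ m ↑ʳ (τ ⟨$⟩ˡ j)
    ×ₚ-flip-ʳ j rewrite Fin.splitAt-↑ʳ m n j = refl

  ×ₚ-cong : ∀ {σ σ' : Permutation′ m} {τ τ' : Permutation′ n} → σ Perm.≈ σ' → τ Perm.≈ τ' →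
            (σ ×ₚ τ) Perm.≈ (σ' ×ₚ τ')
  ×ₚ-cong {σ} {σ'} {τ} {τ'} e e' i with side m i
  ... | left a = trans (×ₚ-ˡ σ τ a) (trans (cong (_↑ˡ n) (e a)) (sym (×ₚ-ˡ σ' τ' a)))
  ... | right b = trans (×ₚ-ʳ σ τ b) (trans (cong (m ↑ʳ_) (e' b)) (sym (×ₚ-ʳ σ' τ' b)))

  ×ₚ-∘ : ∀ (σ σ' : Permutation′ m) (τ τ' : Permutation′ n) →
         ((σ ×ₚ τ) ∘ₚ (σ' ×ₚ τ')) Perm.≈ ((σ ∘ₚ σ') ×ₚ (τ ∘ₚ τ'))
  ×ₚ-∘ σ σ' τ τ' i with side m i
  ... | left a = trans (cong ((σ' ×ₚ τ') ⟨$⟩ʳ_) (×ₚ-ˡ σ τ a))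
                   (trans (×ₚ-ˡ σ' τ' _) (sym (×ₚ-ˡ (σ ∘ₚ σ') (τ ∘ₚ τ') a)))
  ... | right b = trans (cong ((σ' ×ₚ τ') ⟨$⟩ʳ_) (×ₚ-ʳ σ τ b))
                   (trans (×ₚ-ʳ σ' τ' _) (sym (×ₚ-ʳ (σ ∘ₚ σ') (τ ∘ₚ τ') b)))

  ×ₚ-id : (Perm.id {m} ×ₚ Perm.id {n}) Perm.≈ Perm.id
  ×ₚ-id i with side m i
  ... | left a = ×ₚ-ˡ Perm.id Perm.id a
  ... | right b = ×ₚ-ʳ Perm.id Perm.id b

  ×ₚ-injective : ∀ {σ σ' : Permutation′ m} {τ τ' : Permutation′ n} →
                 (σ ×ₚ τ) Perm.≈ (σ' ×ₚ τ') → σ Perm.≈ σ' × τ Perm.≈ τ'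
  ×ₚ-injective {σ} {σ'} {τ} {τ'} e =
    (λ i → Fin.↑ˡ-injective n _ _ (trans (sym (×ₚ-ˡ σ τ i)) (trans (e _) (×ₚ-ˡ σ' τ' i)))) ,
    (λ j → Fin.↑ʳ-injective m _ _ (trans (sym (×ₚ-ʳ σ τ j)) (trans (e _) (×ₚ-ʳ σ' τ' j))))

-- The composition (m, n). Colouring by `inFirstBlock` makes `Inc` of it the very predicate by which
-- `X₂` filters.
halves : ∀ m n → Colouring (m ℕ.+ n)
halves m n = record { Colour = Bool ; _≟ᶜ_ = Bool._≟_ ; colour = inFirstBlock m }

_⊕_ : ∀ {m n} → Colouring m → Colouring n → Colouring (m ℕ.+ n)
_⊕_ {m} C D = record
  { Colour = Colour C ⊎ Colour D
  ; _≟ᶜ_ = ⊎-≡-dec (_≟ᶜ_ C) (_≟ᶜ_ D)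
  ; colour = λ i → Data.Sum.map (colour C) (colour D) (splitAt m i) }

module _ (m n : ℕ) where

  halves-ˡ : ∀ i → colour (halves m n) (i ↑ˡ n) ≡ true
  halves-ˡ i with toℕ (i ↑ˡ n) ℕ.<ᵇ m | ℕ.<⇒<ᵇ (subst (ℕ._< m) (sym (Fin.toℕ-↑ˡ i n)) (Fin.toℕ<n i))
  ... | true | _ = refl

  halves-ʳ : ∀ j → colour (halves m n) (m ↑ʳ j) ≡ false
  halves-ʳ j with toℕ (m ↑ʳ j) ℕ.<ᵇ m in eq
  ... | false = refl
  ... | true = ⊥-elim (ℕ.<⇒≱ (subst (ℕ._< m) (Fin.toℕ-↑ʳ m j) (ℕ.<ᵇ⇒< _ _ (subst Data.Bool.T (sym eq) tt)))
                 (ℕ.m≤m+n m (toℕ j)))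

  halves-ˡ≢ʳ : ∀ {i j} → colour (halves m n) (i ↑ˡ n) ≢ colour (halves m n) (m ↑ʳ j)
  halves-ˡ≢ʳ {i} {j} e with trans (sym (halves-ˡ i)) (trans e (halves-ʳ j))
  ... | ()

  ×ₚ-Pres-halves : (σ : Permutation′ m) (τ : Permutation′ n) → Pres (halves m n) (σ ×ₚ τ)
  ×ₚ-Pres-halves σ τ i with side m i
  ... | left a = trans (cong (colour (halves m n)) (×ₚ-ˡ σ τ a)) (trans (halves-ˡ _) (sym (halves-ˡ a)))
  ... | right b = trans (cong (colour (halves m n)) (×ₚ-ʳ σ τ b)) (trans (halves-ʳ _) (sym (halves-ʳ b)))

module _ {m n : ℕ} where

  private
    toˡ : ∀ h → Pres (halves m n) h → ∀ i → ∃ λ i' → h ⟨$⟩ʳ (i ↑ˡ n) ≡ i' ↑ˡ n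
    toˡ h p i with h ⟨$⟩ʳ (i ↑ˡ n) | p (i ↑ˡ n)
    ... | x | e with side m x
    ...   | left a = a , refl
    ...   | right b = ⊥-elim (halves-ˡ≢ʳ m n (sym e))

    toʳ : ∀ h → Pres (halves m n) h → ∀ j → ∃ λ j' → h ⟨$⟩ʳ (m ↑ʳ j) ≡ m ↑ʳ j'
    toʳ h p j with h ⟨$⟩ʳ (m ↑ʳ j) | p (m ↑ʳ j)
    ... | x | e with side m x
    ...   | left a = ⊥-elim (halves-ˡ≢ʳ m n e)
    ...   | right b = b , refl

  -- Both `h` and its inverse restrict to each half; the restrictions are mutually inverse because
  -- the inclusions of the halves are injective.
  Pres-halves⇒×ₚ : ∀ h → Pres (halves m n) h → ∃₂ λ σ τ → h Perm.≈ (σ ×ₚ τ)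
  Pres-halves⇒×ₚ h p = σ , τ , eq
    where
    h⁻ = Perm.flip h
    p⁻ = Pres-flip (halves m n) {h} p
    invˡ : ∀ k k⁻ pk pk⁻ → (∀ i → k⁻ ⟨$⟩ʳ (k ⟨$⟩ʳ i) ≡ i) → ∀ i →
           proj₁ (toˡ k⁻ pk⁻ (proj₁ (toˡ k pk i))) ≡ i
    invˡ k k⁻ pk pk⁻ inv i = Fin.↑ˡ-injective n _ _
      (trans (sym (proj₂ (toˡ k⁻ pk⁻ _)))
        (trans (cong (k⁻ ⟨$⟩ʳ_) (sym (proj₂ (toˡ k pk i)))) (inv _)))
    invʳ : ∀ k k⁻ pk pk⁻ → (∀ i → k⁻ ⟨$⟩ʳ (k ⟨$⟩ʳ i) ≡ i) → ∀ i →
           proj₁ (toʳ k⁻ pk⁻ (proj₁ (toʳ k pk i))) ≡ i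
    invʳ k k⁻ pk pk⁻ inv i = Fin.↑ʳ-injective m _ _
      (trans (sym (proj₂ (toʳ k⁻ pk⁻ _)))
        (trans (cong (k⁻ ⟨$⟩ʳ_) (sym (proj₂ (toʳ k pk i)))) (inv _)))
    σ = mk↔ₛ′ (λ i → proj₁ (toˡ h p i)) (λ i → proj₁ (toˡ h⁻ p⁻ i))
          (invˡ h⁻ h p⁻ p (λ _ → inverseʳ h)) (invˡ h h⁻ p p⁻ (λ _ → inverseˡ h))
    τ = mk↔ₛ′ (λ i → proj₁ (toʳ h p i)) (λ i → proj₁ (toʳ h⁻ p⁻ i))
          (invʳ h⁻ h p⁻ p (λ _ → inverseʳ h)) (invʳ h h⁻ p p⁻ (λ _ → inverseˡ h))
    eq : h Perm.≈ (σ ×ₚ τ)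
    eq i with side m i
    ... | left a = trans (proj₂ (toˡ h p a)) (sym (×ₚ-ˡ σ τ a))
    ... | right b = trans (proj₂ (toʳ h p b)) (sym (×ₚ-ʳ σ τ b))

  module _ (C : Colouring m) (D : Colouring n) where

    ⊕-ˡ : ∀ i → colour (C ⊕ D) (i ↑ˡ n) ≡ inj₁ (colour C i)
    ⊕-ˡ i rewrite Fin.splitAt-↑ˡ m i n = refl

    ⊕-ʳ : ∀ j → colour (C ⊕ D) (m ↑ʳ j) ≡ inj₂ (colour D j)
    ⊕-ʳ j rewrite Fin.splitAt-↑ʳ m n j = refl

    ⊕-ˡ-cancel : ∀ {i i'} → colour (C ⊕ D) (i ↑ˡ n) ≡ colour (C ⊕ D) (i' ↑ˡ n) → colour C i ≡ colour C i'
    ⊕-ˡ-cancel e = inj₁-injective (trans (sym (⊕-ˡ _)) (trans e (⊕-ˡ _)))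

    ⊕-ʳ-cancel : ∀ {i i'} → colour (C ⊕ D) (m ↑ʳ i) ≡ colour (C ⊕ D) (m ↑ʳ i') → colour D i ≡ colour D i'
    ⊕-ʳ-cancel e = inj₂-injective (trans (sym (⊕-ʳ _)) (trans e (⊕-ʳ _)))

    ⊕-ˡ≢ʳ : ∀ {i j} → colour (C ⊕ D) (i ↑ˡ n) ≢ colour (C ⊕ D) (m ↑ʳ j)
    ⊕-ˡ≢ʳ {i} {j} e with trans (sym (⊕-ˡ i)) (trans e (⊕-ʳ j))
    ... | ()

    Pres-⊕⇒halves : ∀ {h} → Pres (C ⊕ D) h → Pres (halves m n) h
    Pres-⊕⇒halves {h} p i with h ⟨$⟩ʳ i | p i
    ... | x | e with side m i | side m x
    ...   | left _ | left _ = trans (halves-ˡ m n _) (sym (halves-ˡ m n _))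
    ...   | right _ | right _ = trans (halves-ʳ m n _) (sym (halves-ʳ m n _))
    ...   | left _ | right _ = ⊥-elim (⊕-ˡ≢ʳ (sym e))
    ...   | right _ | left _ = ⊥-elim (⊕-ˡ≢ʳ e)

    Pres-×ₚ : ∀ {σ τ} → Pres C σ → Pres D τ → Pres (C ⊕ D) (σ ×ₚ τ)
    Pres-×ₚ {σ} {τ} p q i with side m i
    ... | left a = trans (cong (colour (C ⊕ D)) (×ₚ-ˡ σ τ a))
                     (trans (⊕-ˡ _) (trans (cong inj₁ (p a)) (sym (⊕-ˡ a))))
    ... | right b = trans (cong (colour (C ⊕ D)) (×ₚ-ʳ σ τ b))
                     (trans (⊕-ʳ _) (trans (cong inj₂ (q b)) (sym (⊕-ʳ b))))

    Pres-×ₚ⁻ : ∀ {σ τ} → Pres (C ⊕ D) (σ ×ₚ τ) → Pres C σ × Pres D τ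
    Pres-×ₚ⁻ {σ} {τ} p =
      (λ i → ⊕-ˡ-cancel (trans (cong (colour (C ⊕ D)) (sym (×ₚ-ˡ σ τ i))) (p (i ↑ˡ n)))) ,
      (λ j → ⊕-ʳ-cancel (trans (cong (colour (C ⊕ D)) (sym (×ₚ-ʳ σ τ j))) (p (m ↑ʳ j))))

    Inc-×ₚ : ∀ {σ τ ψ} → Inc (halves m n) ψ → Inc C σ → Inc D τ → Inc (C ⊕ D) ((σ ×ₚ τ) ∘ₚ ψ)
    Inc-×ₚ {σ} {τ} {ψ} inc incˡ incʳ i j (e , lt) with side m i | side m j
    ... | left a | left b rewrite ×ₚ-ˡ σ τ a | ×ₚ-ˡ σ τ b =
      inc _ _ (trans (halves-ˡ m n _) (sym (halves-ˡ m n _)) , ↑ˡ-mono (incˡ a b (⊕-ˡ-cancel e , ↑ˡ-cancel lt)))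
    ... | right a | right b rewrite ×ₚ-ʳ σ τ a | ×ₚ-ʳ σ τ b =
      inc _ _ (trans (halves-ʳ m n _) (sym (halves-ʳ m n _)) , ↑ʳ-mono {m} (incʳ a b (⊕-ʳ-cancel e , ↑ʳ-cancel {m} lt)))
    ... | left a | right b = ⊥-elim (⊕-ˡ≢ʳ e)
    ... | right b | left a = ⊥-elim (⊕-ˡ≢ʳ (sym e))

    -- On each half the shuffle `ψ` is increasing and therefore also reflects the order, so
    -- monotonicity of the composite can be pulled back to `σ` and `τ`.
    Inc-×ₚ⁻ : ∀ {σ τ ψ} → Inc (halves m n) ψ → Inc (C ⊕ D) ((σ ×ₚ τ) ∘ₚ ψ) → Inc C σ × Inc D τ
    Inc-×ₚ⁻ {σ} {τ} {ψ} inc inc⊕ =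
      (λ i j (e , lt) → ↑ˡ-cancel (Inc-reflects (halves m n) {ψ} inc
         (trans (halves-ˡ m n _) (sym (halves-ˡ m n _)))
         (subst₂ (λ x y → (ψ ⟨$⟩ʳ x) Fin.< (ψ ⟨$⟩ʳ y)) (×ₚ-ˡ σ τ i) (×ₚ-ˡ σ τ j)
           (inc⊕ (i ↑ˡ n) (j ↑ˡ n) (trans (⊕-ˡ i) (trans (cong inj₁ e) (sym (⊕-ˡ j))) , ↑ˡ-mono lt))))) ,
      (λ i j (e , lt) → ↑ʳ-cancel {m} (Inc-reflects (halves m n) {ψ} inc
         (trans (halves-ʳ m n _) (sym (halves-ʳ m n _)))
         (subst₂ (λ x y → (ψ ⟨$⟩ʳ x) Fin.< (ψ ⟨$⟩ʳ y)) (×ₚ-ʳ σ τ i) (×ₚ-ʳ σ τ j)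
           (inc⊕ (m ↑ʳ i) (m ↑ʳ j) (trans (⊕-ʳ i) (trans (cong inj₂ e) (sym (⊕-ʳ j))) , ↑ʳ-mono {m} lt)))))

-- Singles out colourings by intervals among all set partitions: for points of different colours,
-- the order depends on the colours alone. `transfer` appeals to this when two values fall in
-- different classes.
Convex : ∀ {n} → Colouring n → Set
Convex C = ∀ i j i' j' → i Fin.< j → colour C i ≢ colour C j →
           colour C i' ≡ colour C i → colour C j' ≡ colour C j → i' Fin.< j'

⊕-Convex : ∀ {m n} {C : Colouring m} {D : Colouring n} → Convex C → Convex D → Convex (C ⊕ D)
⊕-Convex {m} {n} {C} {D} cc cd i j i' j' lt ne e e' with side m i | side m j | side m i' | side m j'
... | left _ | _ | right _ | _ = ⊥-elim (⊕-ˡ≢ʳ C D (sym e))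
... | right _ | _ | left _ | _ = ⊥-elim (⊕-ˡ≢ʳ C D e)
... | _ | left _ | _ | right _ = ⊥-elim (⊕-ˡ≢ʳ C D (sym e'))
... | _ | right _ | _ | left _ = ⊥-elim (⊕-ˡ≢ʳ C D e')
... | left a | left b | left a' | left b' = ↑ˡ-mono (cc a b a' b' (↑ˡ-cancel lt)
  (λ x → ne (trans (⊕-ˡ C D a) (trans (cong inj₁ x) (sym (⊕-ˡ C D b))))) (⊕-ˡ-cancel C D e) (⊕-ˡ-cancel C D e'))
... | left a | right b | left a' | right b' = ↑ˡ<↑ʳ a' b'
... | right b | left a | right b' | left a' = ⊥-elim (ℕ.<-asym lt (↑ˡ<↑ʳ a b))
... | right a | right b | right a' | right b' = ↑ʳ-mono {m} (cd a b a' b' (↑ʳ-cancel {m} lt)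
  (λ x → ne (trans (⊕-ʳ C D a) (trans (cong inj₂ x) (sym (⊕-ʳ C D b))))) (⊕-ʳ-cancel C D e) (⊕-ʳ-cancel C D e'))

-- Finite sums in `𝓕`.

module _ {c ℓ a ℓa} (K : CommutativeRing c ℓ) (A : KAlgebra K a ℓa) where

  open FA K A

  ≋-setoid : Setoid (c ⊔ a) (c ⊔ ℓ ⊔ a ⊔ ℓa)
  ≋-setoid = record { Carrier = 𝓕 ; _≈_ = _≋_ ; isEquivalence = record { refl = ≋-refl ; sym = ≋-sym ; trans = ≋-trans } }

  module ≋-Reasoning = SetoidReasoning ≋-setoid
  open ≋-Reasoning

  ≋-reflexive : ∀ {x y} → x ≡ y → x ≋ y
  ≋-reflexive refl = ≋-refl

  ++-[] : ∀ {x} → x ++ [] ≋ x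
  ++-[] = ≋-reflexive (List.++-identityʳ _)

  interchange : ∀ x y z w → (x ++ y) ++ (z ++ w) ≋ (x ++ z) ++ (y ++ w)
  interchange x y z w = begin
    (x ++ y) ++ (z ++ w)  ≡⟨ List.++-assoc x y (z ++ w) ⟩
    x ++ (y ++ (z ++ w))  ≡⟨ cong (x ++_) (List.++-assoc y z w) ⟨
    x ++ ((y ++ z) ++ w)  ≈⟨ ≋-++ {x} ≋-refl (≋-++ {y ++ z} {z ++ y} {w} (≋-comm y z) ≋-refl) ⟩
    x ++ ((z ++ y) ++ w)  ≡⟨ cong (x ++_) (List.++-assoc z y w) ⟩
    x ++ (z ++ (y ++ w))  ≡⟨ List.++-assoc x z (y ++ w) ⟨
    (x ++ z) ++ (y ++ w)  ∎

  ∑ : ∀ {x} {X : Set x} → List X → (X → 𝓕) → 𝓕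
  ∑ xs f = concatMap f xs

  module _ {x} {X : Set x} where

    ∑-cong : ∀ (xs : List X) {f g : X → 𝓕} → (∀ x → f x ≋ g x) → ∑ xs f ≋ ∑ xs g
    ∑-cong [] e = ≋-refl
    ∑-cong (x ∷ xs) e = ≋-++ (e x) (∑-cong xs e)

    ∑-0 : ∀ (xs : List X) {f : X → 𝓕} → (∀ x → f x ≋ []) → ∑ xs f ≋ []
    ∑-0 [] e = ≋-refl
    ∑-0 (x ∷ xs) e = ≋-++ (e x) (∑-0 xs e)

    ∑-++ : ∀ (xs : List X) {f g : X → 𝓕} → ∑ xs (λ x → f x ++ g x) ≋ ∑ xs f ++ ∑ xs g
    ∑-++ [] = ≋-refl
    ∑-++ (x ∷ xs) {f} {g} = ≋-trans (≋-++ ≋-refl (∑-++ xs)) (interchange (f x) (g x) (∑ xs f) (∑ xs g))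

    ∑-concatMap : ∀ {y} {Y : Set y} (f : Y → 𝓕) (g : X → List Y) xs →
                  ∑ (concatMap g xs) f ≡ ∑ xs (λ x → ∑ (g x) f)
    ∑-concatMap f g [] = refl
    ∑-concatMap f g (x ∷ xs) = trans (List.concatMap-++ f (g x) _) (cong (∑ (g x) f ++_) (∑-concatMap f g xs))

  ∑-swap : ∀ {x y} {X : Set x} {Y : Set y} (xs : List X) (ys : List Y) {f : X → Y → 𝓕} →
           ∑ xs (λ x → ∑ ys (f x)) ≋ ∑ ys (λ y → ∑ xs (λ x → f x y))
  ∑-swap [] ys = ≋-sym (∑-0 ys λ _ → ≋-refl)
  ∑-swap (x ∷ xs) ys = ≋-trans (≋-++ ≋-refl (∑-swap xs ys)) (≋-sym (∑-++ ys))

  -- A sum over a subset of permutations is written as a sum over all of them with this guard, so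
  -- that conditions can be moved, swapped and replaced by equivalent ones without touching the
  -- index list.
  when : ∀ {p} {P : Set p} → Dec P → 𝓕 → 𝓕
  when (yes _) x = x
  when (no _) x = []

  module _ {p} {P : Set p} where

    when-yes : ∀ (d : Dec P) {x} → P → when d x ≡ x
    when-yes (yes _) _ = refl
    when-yes (no ¬p) p = ⊥-elim (¬p p)

    when-0 : ∀ (d : Dec P) {x} → (P → x ≋ []) → when d x ≋ []
    when-0 (yes p) e = e p
    when-0 (no _) _ = ≋-refl

    when-cong : ∀ (d : Dec P) {x y} → (P → x ≋ y) → when d x ≋ when d y
    when-cong (yes p) e = e p
    when-cong (no _) _ = ≋-refl

    when-∑ : ∀ (d : Dec P) {x} {X : Set x} (xs : List X) {f : X → 𝓕} →
             when d (∑ xs f) ≋ ∑ xs (λ x → when d (f x))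
    when-∑ (yes _) xs = ≋-refl
    when-∑ (no _) xs = ≋-sym (∑-0 xs λ _ → ≋-refl)

    when-⇔ : ∀ {q} {Q : Set q} (d : Dec P) (d' : Dec Q) {x y} → (P → Q) → (Q → P) → (P → x ≋ y) →
             when d x ≋ when d' y
    when-⇔ (yes p) (yes _) f g e = e p
    when-⇔ (yes p) (no ¬q) f g e = ⊥-elim (¬q (f p))
    when-⇔ (no ¬p) (yes q) f g e = ⊥-elim (¬p (g q))
    when-⇔ (no _) (no _) f g e = ≋-refl

    when-swap : ∀ {q} {Q : Set q} (d : Dec P) (d' : Dec Q) {x} → when d (when d' x) ≡ when d' (when d x)
    when-swap (yes _) d' = refl
    when-swap (no _) (yes _) = refl
    when-swap (no _) (no _) = refl

  ∑-filter : ∀ {x p} {X : Set x} {P : X → Set p} (P? : Decidable P) xs (f : X → 𝓕) →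
             ∑ (filter P? xs) f ≡ ∑ xs (λ x → when (P? x) (f x))
  ∑-filter P? [] f = refl
  ∑-filter P? (x ∷ xs) f with P? x
  ... | yes _ = cong (f x ++_) (∑-filter P? xs f)
  ... | no _ = ∑-filter P? xs f

  ∑-tabulate-unique : ∀ {n x} {X : Set x} (g : Fin n → X) {f : X → 𝓕} i →
                      (∀ j → j ≢ i → f (g j) ≋ []) → ∑ (tabulate g) f ≋ f (g i)
  ∑-tabulate-unique {suc n} g {f} zero v =
    ≋-trans (≋-++ ≋-refl (zeros (g ∘ suc) (λ j → v (suc j) λ ()))) ++-[]
    where
    zeros : ∀ {m} (h : Fin m → _) → (∀ j → f (h j) ≋ []) → ∑ (tabulate h) f ≋ []
    zeros {zero} h e = ≋-refl
    zeros {suc m} h e = ≋-++ (e zero) (zeros (h ∘ suc) (e ∘ suc))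
  ∑-tabulate-unique g (suc i) v =
    ≋-++ (v zero λ ()) (∑-tabulate-unique (g ∘ suc) i λ j ne → v (suc j) (ne ∘ Fin.suc-injective))

  -- Sums over all permutations and their reindexing.

  abstract
    -- Opaque, so that later arguments rest on the laws of the sum; `∑ᵖ-def` is the way back to the
    -- list `allPerms`.
    ∑ᵖ : ∀ {n} → (Permutation′ n → 𝓕) → 𝓕
    ∑ᵖ {n} f = ∑ (allPerms n) f

    ∑ᵖ-def : ∀ {n} {f : Permutation′ n → 𝓕} → ∑ᵖ f ≡ ∑ (allPerms n) f
    ∑ᵖ-def = refl

    ∑ᵖ-cong : ∀ {n} {f g : Permutation′ n → 𝓕} → (∀ p → f p ≋ g p) → ∑ᵖ f ≋ ∑ᵖ g
    ∑ᵖ-cong {n} = ∑-cong (allPerms n)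

    ∑ᵖ-0 : ∀ {n} {f : Permutation′ n → 𝓕} → (∀ p → f p ≋ []) → ∑ᵖ f ≋ []
    ∑ᵖ-0 {n} = ∑-0 (allPerms n)

    ∑ᵖ-swap : ∀ {m n} {f : Permutation′ m → Permutation′ n → 𝓕} →
              ∑ᵖ (λ p → ∑ᵖ (f p)) ≋ ∑ᵖ (λ q → ∑ᵖ (λ p → f p q))
    ∑ᵖ-swap {m} {n} = ∑-swap (allPerms m) (allPerms n)

    ∑-∑ᵖ : ∀ {x n} {X : Set x} (xs : List X) {f : X → Permutation′ n → 𝓕} →
           ∑ xs (λ x → ∑ᵖ (f x)) ≋ ∑ᵖ (λ p → ∑ xs (λ x → f x p))
    ∑-∑ᵖ {n = n} xs = ∑-swap xs (allPerms n)

    when-∑ᵖ : ∀ {p} {P : Set p} (d : Dec P) {n} {f : Permutation′ n → 𝓕} →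
              when d (∑ᵖ f) ≋ ∑ᵖ (λ x → when d (f x))
    when-∑ᵖ d {n} = when-∑ d (allPerms n)

  -- `allPerms` meets every class of pointwise equal permutations exactly once: the image of zero
  -- determines the transposition and `unlift` the rest. The value is asked of every `q` equal to
  -- `p`, because the listed representative need not be `p` itself.
  ∑ᵖ-unique : ∀ {n} p {f : Permutation′ n → 𝓕} {x} →
              (∀ q → ¬ q Perm.≈ p → f q ≋ []) → (∀ q → q Perm.≈ p → f q ≋ x) → ∑ᵖ f ≋ x
  ∑ᵖ-unique {zero} p v h = ≋-trans (≋-reflexive ∑ᵖ-def) (≋-trans ++-[] (h Perm.id λ ()))
  ∑ᵖ-unique {suc n} p {f} {x} v h = begin
    ∑ᵖ f
      ≡⟨ ∑ᵖ-def ⟩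
    ∑ (allPerms (suc n)) f
      ≡⟨ ∑-concatMap f (λ i → map (cons i) (allPerms n)) (allFin (suc n)) ⟩
    ∑ (allFin (suc n)) (λ i → ∑ (map (cons i) (allPerms n)) f)
      ≈⟨ ∑-cong (allFin (suc n)) (λ i → ≋-reflexive (trans (List.concatMap-map f (cons i) (allPerms n)) (sym ∑ᵖ-def))) ⟩
    ∑ (allFin (suc n)) (λ i → ∑ᵖ (f ∘ cons i))
      ≈⟨ ∑-tabulate-unique (λ i → i) (p ⟨$⟩ʳ zero)
           (λ i ne → ∑ᵖ-0 λ q → v (cons i q) λ e → ne (proj₁ (unlift-unique p {q = q} e))) ⟩
    ∑ᵖ (f ∘ cons (p ⟨$⟩ʳ zero))
      ≈⟨ ∑ᵖ-unique (unlift p)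
           (λ q ne → v (cons (p ⟨$⟩ʳ zero) q) λ e → ne (proj₂ (unlift-unique p {q = q} e)))
           (λ q e → h (cons (p ⟨$⟩ʳ zero) q) λ i → trans (lift₀∘transpose-cong {p = q} {unlift p} refl e i) (lift₀-unlift p i)) ⟩
    x ∎
    where
    cons : Fin (suc n) → Permutation′ n → Permutation′ (suc n)
    cons i q = lift₀ q ∘ₚ transpose zero i

  Respects : ∀ {n} → (Permutation′ n → 𝓕) → Set _
  Respects F = ∀ p q → p Perm.≈ q → F p ≋ F q

  ∑ᵖ-point : ∀ {n} {F : Permutation′ n → 𝓕} → Respects F → ∀ p → ∑ᵖ (λ q → when (≈-dec q p) (F q)) ≋ F p
  ∑ᵖ-point {F = F} F-resp p = ∑ᵖ-unique p
    (λ q ne → when-0 (≈-dec q p) λ e → ⊥-elim (ne e))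
    (λ q e → ≋-trans (≋-reflexive (when-yes (≈-dec q p) e)) (F-resp _ _ e))

  -- Both sides are equal to the double sum over the pairs related by R.
  ∑-match : ∀ {x y r} {X : Set x} {Y : Set y} {R : X → Y → Set r} (R? : ∀ x y → Dec (R x y))
            (xs : List X) (ys : List Y) {f : X → 𝓕} {g : Y → 𝓕} →
            (∀ x → ∑ ys (λ y → when (R? x y) (f x)) ≋ f x) →
            (∀ y → ∑ xs (λ x → when (R? x y) (g y)) ≋ g y) →
            (∀ x y → R x y → f x ≋ g y) → ∑ xs f ≋ ∑ ys g
  ∑-match R? xs ys {f} {g} row col e = begin
    ∑ xs f
      ≈⟨ ∑-cong xs row ⟨
    ∑ xs (λ x → ∑ ys (λ y → when (R? x y) (f x)))
      ≈⟨ ∑-cong xs (λ x → ∑-cong ys λ y → when-cong (R? x y) (e x y)) ⟩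
    ∑ xs (λ x → ∑ ys (λ y → when (R? x y) (g y)))
      ≈⟨ ∑-swap xs ys ⟩
    ∑ ys (λ y → ∑ xs (λ x → when (R? x y) (g y)))
      ≈⟨ ∑-cong ys col ⟩
    ∑ ys g ∎

  ∘ₚ-congˡ : ∀ {n} {σ σ' : Permutation′ n} (τ : Permutation′ n) → σ Perm.≈ σ' → (σ ∘ₚ τ) Perm.≈ (σ' ∘ₚ τ)
  ∘ₚ-congˡ τ e i = cong (τ ⟨$⟩ʳ_) (e i)

  -- Composition with `χ` permutes the list only up to pointwise equality; `∑-match` along the graph
  -- of this map replaces a rearrangement of the list.
  ∑ᵖ-∘ₚ : ∀ {n} {F : Permutation′ n → 𝓕} → Respects F → ∀ χ → ∑ᵖ (λ π → F (π ∘ₚ χ)) ≋ ∑ᵖ F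
  ∑ᵖ-∘ₚ {n} {F} F-resp χ = subst₂ _≋_ (sym ∑ᵖ-def) (sym ∑ᵖ-def) (∑-match (λ π g → ≈-dec g (π ∘ₚ χ)) (allPerms n) (allPerms n)
    (λ π → ≋-trans (≋-trans (≋-reflexive (sym ∑ᵖ-def)) (∑ᵖ-cong λ g → when-cong (≈-dec g (π ∘ₚ χ)) λ e → F-resp (π ∘ₚ χ) g λ i → sym (e i)))
                   (∑ᵖ-point F-resp (π ∘ₚ χ)))
    (λ g → ≋-trans (≋-reflexive (sym ∑ᵖ-def)) (∑ᵖ-unique (g ∘ₚ Perm.flip χ)
       (λ π ne → when-0 (≈-dec g (π ∘ₚ χ)) λ e → ⊥-elim (ne λ i →
          sym (trans (cong (χ ⟨$⟩ˡ_) (e i)) (inverseˡ χ))))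
       (λ π e → ≋-reflexive (when-yes (≈-dec g (π ∘ₚ χ)) λ i →
          sym (trans (cong (χ ⟨$⟩ʳ_) (e i)) (inverseʳ χ))))))
    (λ π g e → F-resp (π ∘ₚ χ) g λ i → sym (e i)))

  -- Inserts the indicator of g = πs, which by `decompose` and `decompose-unique` holds for exactly
  -- one pair, then interchanges the sums and evaluates the sum over `g`.
  ∑ᵖ-decompose : ∀ {n} (C : Colouring n) {F : Permutation′ n → 𝓕} → Respects F →
    ∑ᵖ F ≋ ∑ᵖ (λ π → when (inc? C π) (∑ᵖ λ s → when (pres? C s) (F (s ∘ₚ π))))
  ∑ᵖ-decompose C {F} F-resp = begin
    ∑ᵖ F
      ≈⟨ ∑ᵖ-cong expand ⟨
    ∑ᵖ (λ g → ∑ᵖ λ π → when (inc? C π) (∑ᵖ λ s → when (pres? C s) (when (≈-dec g (s ∘ₚ π)) (F g))))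
      ≈⟨ ∑ᵖ-swap ⟩
    ∑ᵖ (λ π → ∑ᵖ λ g → when (inc? C π) (∑ᵖ λ s → when (pres? C s) (when (≈-dec g (s ∘ₚ π)) (F g))))
      ≈⟨ ∑ᵖ-cong (λ π → when-∑ᵖ (inc? C π)) ⟨
    ∑ᵖ (λ π → when (inc? C π) (∑ᵖ λ g → ∑ᵖ λ s → when (pres? C s) (when (≈-dec g (s ∘ₚ π)) (F g))))
      ≈⟨ ∑ᵖ-cong (λ π → when-cong (inc? C π) λ _ → ≋-trans ∑ᵖ-swap (∑ᵖ-cong λ s →
           ≋-trans (≋-sym (when-∑ᵖ (pres? C s))) (when-cong (pres? C s) λ _ → ∑ᵖ-point F-resp (s ∘ₚ π)))) ⟩
    ∑ᵖ (λ π → when (inc? C π) (∑ᵖ λ s → when (pres? C s) (F (s ∘ₚ π)))) ∎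
    where
    expand : ∀ g → ∑ᵖ (λ π → when (inc? C π) (∑ᵖ λ s → when (pres? C s) (when (≈-dec g (s ∘ₚ π)) (F g)))) ≋ F g
    expand g with decompose C g
    ... | χ , s₀ , inc , pres , g≈ = ∑ᵖ-unique χ
      (λ π ne → when-0 (inc? C π) λ i → ∑ᵖ-0 λ s → when-0 (pres? C s) λ p → when-0 (≈-dec g (s ∘ₚ π)) λ e →
         ⊥-elim (ne (proj₁ (uniq π s i p e))))
      (λ π π≈ → ≋-trans (≋-reflexive (when-yes (inc? C π) (Inc-resp C {χ} {π} (λ i → sym (π≈ i)) inc)))
        (∑ᵖ-unique s₀
          (λ s ne → when-0 (pres? C s) λ p → when-0 (≈-dec g (s ∘ₚ π)) λ e →
             ⊥-elim (ne (proj₂ (uniq π s (Inc-resp C {χ} {π} (λ i → sym (π≈ i)) inc) p e))))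
          (λ s s≈ → ≋-reflexive (trans
             (when-yes (pres? C s) (Pres-resp C {s₀} {s} (λ i → sym (s≈ i)) pres))
             (when-yes (≈-dec g (s ∘ₚ π)) λ i →
               trans (g≈ i) (sym (trans (cong (π ⟨$⟩ʳ_) (s≈ i)) (π≈ _))))))))
      where
      uniq : ∀ π s → Inc C π → Pres C s → g Perm.≈ (s ∘ₚ π) → π Perm.≈ χ × s Perm.≈ s₀
      uniq π s i p e = decompose-unique C {π} {s} {χ} {s₀} i p inc pres (λ j → trans (sym (e j)) (g≈ j))

  ∑ᵖ-Pres-halves : ∀ {m n} {F : Permutation′ (m ℕ.+ n) → 𝓕} → Respects F →
    ∑ᵖ (λ s → when (pres? (halves m n) s) (F s)) ≋ ∑ᵖ (λ σ → ∑ᵖ λ τ → F (σ ×ₚ τ))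
  ∑ᵖ-Pres-halves {m} {n} {F} F-resp = begin
    ∑ᵖ (λ s → when (P? s) (F s))
      ≈⟨ ∑ᵖ-cong (λ s → when-cong (P? s) (expand s)) ⟨
    ∑ᵖ (λ s → when (P? s) (∑ᵖ λ σ → ∑ᵖ λ τ → when (≈-dec s (σ ×ₚ τ)) (F s)))
      ≈⟨ ∑ᵖ-cong (λ s → ≋-trans (when-∑ᵖ (P? s)) (∑ᵖ-cong λ σ → when-∑ᵖ (P? s))) ⟩
    ∑ᵖ (λ s → ∑ᵖ λ σ → ∑ᵖ λ τ → when (P? s) (when (≈-dec s (σ ×ₚ τ)) (F s)))
      ≈⟨ ≋-trans ∑ᵖ-swap (∑ᵖ-cong λ σ → ∑ᵖ-swap) ⟩
    ∑ᵖ (λ σ → ∑ᵖ λ τ → ∑ᵖ λ s → when (P? s) (when (≈-dec s (σ ×ₚ τ)) (F s)))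
      ≈⟨ ∑ᵖ-cong (λ σ → ∑ᵖ-cong λ τ → ≋-trans (∑ᵖ-cong λ s → drop σ τ s) (∑ᵖ-point F-resp (σ ×ₚ τ))) ⟩
    ∑ᵖ (λ σ → ∑ᵖ λ τ → F (σ ×ₚ τ)) ∎
    where
    P? = pres? (halves m n)
    expand : ∀ s → Pres (halves m n) s → ∑ᵖ (λ σ → ∑ᵖ λ τ → when (≈-dec s (σ ×ₚ τ)) (F s)) ≋ F s
    expand s p with Pres-halves⇒×ₚ s p
    ... | σ₀ , τ₀ , e₀ = ∑ᵖ-unique σ₀
      (λ σ ne → ∑ᵖ-0 λ τ → when-0 (≈-dec s (σ ×ₚ τ)) λ e → ⊥-elim (ne (proj₁ (uniq σ τ e))))
      (λ σ σ≈ → ∑ᵖ-unique τ₀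
        (λ τ ne → when-0 (≈-dec s (σ ×ₚ τ)) λ e → ⊥-elim (ne (proj₂ (uniq σ τ e))))
        (λ τ τ≈ → ≋-reflexive (when-yes (≈-dec s (σ ×ₚ τ)) λ i →
           trans (e₀ i) (sym (×ₚ-cong {σ = σ} {σ₀} {τ} {τ₀} σ≈ τ≈ i)))))
      where
      uniq : ∀ σ τ → s Perm.≈ (σ ×ₚ τ) → σ Perm.≈ σ₀ × τ Perm.≈ τ₀
      uniq σ τ e = ×ₚ-injective {σ = σ} {σ₀} {τ} {τ₀} λ i → trans (sym (e i)) (e₀ i)
    drop : ∀ σ τ s → when (P? s) (when (≈-dec s (σ ×ₚ τ)) (F s)) ≋ when (≈-dec s (σ ×ₚ τ)) (F s)
    drop σ τ s = ≋-trans (≋-reflexive (when-swap (P? s) (≈-dec s (σ ×ₚ τ)))) (when-cong (≈-dec s (σ ×ₚ τ)) λ e →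
      ≋-reflexive (when-yes (P? s) (Pres-resp (halves m n) {σ ×ₚ τ} {s} (λ i → sym (e i)) (×ₚ-Pres-halves m n σ τ))))

  -- The decomposition along `halves` writes `ρ` as a shuffle `ψ` after an element of the Young
  -- subgroup of (m, n), which is a juxtaposition; `Inc-×ₚ` and its converse split the guard on `ρ`
  -- into one for each factor.
  ∑ᵖ-Inc-⊕ : ∀ {m n} (C : Colouring m) (D : Colouring n) {F : Permutation′ (m ℕ.+ n) → 𝓕} → Respects F →
    ∑ᵖ (λ ρ → when (inc? (C ⊕ D) ρ) (F ρ)) ≋
    ∑ᵖ (λ ψ → when (inc? (halves m n) ψ)
      (∑ᵖ λ σ → when (inc? C σ) (∑ᵖ λ τ → when (inc? D τ) (F ((σ ×ₚ τ) ∘ₚ ψ)))))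
  ∑ᵖ-Inc-⊕ {m} {n} C D {F} F-resp = begin
    ∑ᵖ G
      ≈⟨ ∑ᵖ-decompose (halves m n) G-resp ⟩
    ∑ᵖ (λ ψ → when (inc? (halves m n) ψ) (∑ᵖ λ s → when (pres? (halves m n) s) (G (s ∘ₚ ψ))))
      ≈⟨ ∑ᵖ-cong (λ ψ → when-cong (inc? (halves m n) ψ) λ inc →
           ≋-trans (∑ᵖ-Pres-halves {m} {n} {F = λ s → G (s ∘ₚ ψ)} λ p q e → G-resp (p ∘ₚ ψ) (q ∘ₚ ψ) (∘ₚ-congˡ {σ = p} {q} ψ e))
           (∑ᵖ-cong λ σ → ≋-trans (∑ᵖ-cong λ τ → split ψ inc σ τ) (≋-sym (when-∑ᵖ (inc? C σ))))) ⟩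
    _ ∎
    where
    G : Permutation′ (m ℕ.+ n) → 𝓕
    G ρ = when (inc? (C ⊕ D) ρ) (F ρ)
    G-resp : Respects G
    G-resp p q e = when-⇔ (inc? (C ⊕ D) p) (inc? (C ⊕ D) q)
      (Inc-resp (C ⊕ D) {p} {q} e) (Inc-resp (C ⊕ D) {q} {p} (λ i → sym (e i))) λ _ → F-resp p q e
    split : ∀ ψ → Inc (halves m n) ψ → ∀ σ τ →
            G ((σ ×ₚ τ) ∘ₚ ψ) ≋ when (inc? C σ) (when (inc? D τ) (F ((σ ×ₚ τ) ∘ₚ ψ)))
    split ψ inc σ τ with inc? C σ | inc? D τ
    ... | yes p | yes q = ≋-reflexive (when-yes (inc? (C ⊕ D) ((σ ×ₚ τ) ∘ₚ ψ)) (Inc-×ₚ C D {σ} {τ} {ψ} inc p q))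
    ... | yes p | no ¬q = when-0 (inc? (C ⊕ D) ((σ ×ₚ τ) ∘ₚ ψ)) λ i → ⊥-elim (¬q (proj₂ (Inc-×ₚ⁻ C D {σ} {τ} {ψ} inc i)))
    ... | no ¬p | _ = when-0 (inc? (C ⊕ D) ((σ ×ₚ τ) ∘ₚ ψ)) λ i → ⊥-elim (¬p (proj₁ (Inc-×ₚ⁻ C D {σ} {τ} {ψ} inc i)))

  -- Words and multilinear maps on symbols.

  module K = CommutativeRing K
  module A where
    open KAlgebra A public
    open AS.IsRing isRing public using (refl; sym; trans; reflexive)
      renaming (*-cong to ·-cong; distribˡ to ·-distribˡ; distribʳ to ·-distribʳ)
  open A using () renaming
    (Carrierᴹ to 𝔸; _≈ᴹ_ to _≈ᴬ_; _+ᴹ_ to _+ᴬ_; _*ₗ_ to _•ᴬ_; _·ᴬ_ to _·ᴬ_)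
  open K using () renaming
      (Carrier to 𝕂; _≈_ to _≈ᴷ_; _+_ to _+ᴷ_; _*_ to _*ᴷ_; 0# to 0ᴷ; 1# to 1ᴷ)

  Word : ℕ → Set a
  Word n = Fin n → 𝔸

  infix 4 _≈ʷ_
  _≈ʷ_ : ∀ {n} → Word n → Word n → Set ℓa
  w ≈ʷ w' = ∀ i → w i ≈ᴬ w' i

  infixr 8 _▷_
  _▷_ : ∀ {n} → Permutation′ n → Word n → Word n
  (π ▷ w) i = w (π ⟨$⟩ˡ i)

  ≈-cong : ∀ {n} (w : Word n) {i j} → i ≡ j → w i ≈ᴬ w j
  ≈-cong w refl = A.refl

  ▷-cong : ∀ {n} {π ρ : Permutation′ n} → π Perm.≈ ρ → ∀ w → π ▷ w ≈ʷ ρ ▷ w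
  ▷-cong {π = π} {ρ} e w i = ≈-cong w (≈-flip {σ = π} {ρ} e i)

  -- The relation underlying `≋-slot+`, stated without updates. In this form it is carried along,
  -- entry by entry, when words are permuted, concatenated or multiplied.
  SumAt : ∀ {n} → Fin n → (u v w : Word n) → Set ℓa
  SumAt i u v w = u i ≈ᴬ (v i +ᴬ w i) × (∀ j → j ≢ i → u j ≈ᴬ v j × u j ≈ᴬ w j)

  ScaleAt : ∀ {n} → Fin n → 𝕂 → (u v : Word n) → Set ℓa
  ScaleAt i s u v = u i ≈ᴬ (s •ᴬ v i) × (∀ j → j ≢ i → u j ≈ᴬ v j)

  ≔-updates : ∀ {n} (w : Word n) i x → (w [ i ]≔ x) i ≡ x
  ≔-updates w i x = updateAt-updates i w

  ≔-minimal : ∀ {n} (w : Word n) i x j → j ≢ i → (w [ i ]≔ x) j ≡ w j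
  ≔-minimal w i x j ne = updateAt-minimal j i w ne

  ≔-intro : ∀ {n} (u v : Word n) i x → u i ≈ᴬ x → (∀ j → j ≢ i → u j ≈ᴬ v j) → u ≈ʷ v [ i ]≔ x
  ≔-intro u v i x e e' j with j Fin.≟ i
  ... | yes refl = A.trans e (A.reflexive (sym (≔-updates v i x)))
  ... | no ne = A.trans (e' j ne) (A.reflexive (sym (≔-minimal v i x j ne)))

  SumAt-≔ : ∀ {n} (w : Word n) i x y → SumAt i (w [ i ]≔ (x +ᴬ y)) (w [ i ]≔ x) (w [ i ]≔ y)
  SumAt-≔ w i x y =
    A.reflexive (trans (≔-updates w i _) (sym (cong₂ _+ᴬ_ (≔-updates w i x) (≔-updates w i y)))) ,
    λ j ne → A.reflexive (trans (≔-minimal w i _ j ne) (sym (≔-minimal w i _ j ne))) ,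
             A.reflexive (trans (≔-minimal w i _ j ne) (sym (≔-minimal w i _ j ne)))

  ScaleAt-≔ : ∀ {n} (w : Word n) i s x → ScaleAt i s (w [ i ]≔ (s •ᴬ x)) (w [ i ]≔ x)
  ScaleAt-≔ w i s x =
    A.reflexive (trans (≔-updates w i _) (sym (cong (s •ᴬ_) (≔-updates w i x)))) ,
    λ j ne → A.reflexive (trans (≔-minimal w i _ j ne) (sym (≔-minimal w i _ j ne)))

  ≋-sumAt : ∀ {n} {u v w : Word n} i → SumAt i u v w → ∀ r σ →
            [ term n r u σ ] ≋ term n r v σ ∷ term n r w σ ∷ []
  ≋-sumAt {n} {u} {v} {w} i (e , e') r σ = begin
    [ term n r u σ ]
      ≈⟨ ≋-term K.refl (≔-intro u u i _ e λ _ _ → A.refl) (λ _ → refl) ⟩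
    [ term n r (u [ i ]≔ (v i +ᴬ w i)) σ ]
      ≈⟨ ≋-slot+ r u σ i (v i) (w i) ⟩
    [ term n r (u [ i ]≔ v i) σ ] ++ [ term n r (u [ i ]≔ w i) σ ]
      ≈⟨ ≋-++ (≋-term K.refl (λ j → A.sym (≔-intro v u i _ A.refl (λ j ne → A.sym (proj₁ (e' j ne))) j)) (λ _ → refl))
              (≋-term K.refl (λ j → A.sym (≔-intro w u i _ A.refl (λ j ne → A.sym (proj₂ (e' j ne))) j)) (λ _ → refl)) ⟩
    term n r v σ ∷ term n r w σ ∷ [] ∎

  ≋-scaleAt : ∀ {n} {u v : Word n} i s → ScaleAt i s u v → ∀ r σ →
              [ term n r u σ ] ≋ [ term n (r *ᴷ s) v σ ]
  ≋-scaleAt {n} {u} {v} i s (e , e') r σ = begin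
    [ term n r u σ ]
      ≈⟨ ≋-term K.refl (≔-intro u u i _ e λ _ _ → A.refl) (λ _ → refl) ⟩
    [ term n r (u [ i ]≔ (s •ᴬ v i)) σ ]
      ≈⟨ ≋-slot• r u σ i s (v i) ⟩
    [ term n (r *ᴷ s) (u [ i ]≔ v i) σ ]
      ≈⟨ ≋-term K.refl (λ j → A.sym (≔-intro v u i _ A.refl (λ j ne → A.sym (e' j ne)) j)) (λ _ → refl) ⟩
    [ term n (r *ᴷ s) v σ ] ∎

  -- One law for each defining relation of `≋` on symbols; a map on terms with these laws descends
  -- to `𝓕`, which is `∑-resp`.
  record IsLin {n} (φ : 𝕂 → Word n → Permutation′ n → 𝓕) : Set (c ⊔ ℓ ⊔ a ⊔ ℓa) where
    field
      φ-cong  : ∀ {r r' w w' σ σ'} → r ≈ᴷ r' → w ≈ʷ w' → σ Perm.≈ σ' → φ r w σ ≋ φ r' w' σ'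
      φ-coef+ : ∀ r s w σ → φ r w σ ++ φ s w σ ≋ φ (r +ᴷ s) w σ
      φ-coef0 : ∀ w σ → φ 0ᴷ w σ ≋ []
      φ-sum   : ∀ {u v w} i → SumAt i u v w → ∀ r σ → φ r u σ ≋ φ r v σ ++ φ r w σ
      φ-scale : ∀ {u v} i s → ScaleAt i s u v → ∀ r σ → φ r u σ ≋ φ (r *ᴷ s) v σ
  open IsLin

  LinearMap : (Term → 𝓕) → Set _
  LinearMap f = ∀ n → IsLin {n} (λ r w σ → f (term n r w σ))

  ∑-resp : ∀ {f} → LinearMap f → ∀ {x y} → x ≋ y → ∑ x f ≋ ∑ y f
  ∑-resp lin ≋-refl = ≋-refl
  ∑-resp lin (≋-sym e) = ≋-sym (∑-resp lin e)
  ∑-resp lin (≋-trans e e') = ≋-trans (∑-resp lin e) (∑-resp lin e')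
  ∑-resp {f} lin (≋-++ {x} {x'} {y} {y'} e e') = begin
    ∑ (x ++ y) f      ≡⟨ List.concatMap-++ f x y ⟩
    ∑ x f ++ ∑ y f    ≈⟨ ≋-++ (∑-resp lin e) (∑-resp lin e') ⟩
    ∑ x' f ++ ∑ y' f  ≡⟨ List.concatMap-++ f x' y' ⟨
    ∑ (x' ++ y') f    ∎
  ∑-resp {f} lin (≋-comm x y) = begin
    ∑ (x ++ y) f    ≡⟨ List.concatMap-++ f x y ⟩
    ∑ x f ++ ∑ y f  ≈⟨ ≋-comm (∑ x f) (∑ y f) ⟩
    ∑ y f ++ ∑ x f  ≡⟨ List.concatMap-++ f y x ⟨
    ∑ (y ++ x) f    ∎
  ∑-resp {f} lin (≋-term {n} e e' e'') = ≋-++ (φ-cong (lin n) e e' e'') ≋-refl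
  ∑-resp {f} lin (≋-coef+ {n} r s w σ) = begin
    f (term n r w σ) ++ (f (term n s w σ) ++ [])  ≈⟨ ≋-++ (≋-refl {f (term n r w σ)}) ++-[] ⟩
    f (term n r w σ) ++ f (term n s w σ)          ≈⟨ φ-coef+ (lin n) r s w σ ⟩
    f (term n (r +ᴷ s) w σ)                       ≈⟨ ++-[] ⟨
    f (term n (r +ᴷ s) w σ) ++ []                 ∎
  ∑-resp {f} lin (≋-coef0 {n} w σ) = ≋-trans ++-[] (φ-coef0 (lin n) w σ)
  ∑-resp {f} lin (≋-slot+ {n} r w σ i x y) = begin
    f (term n r (w [ i ]≔ (x +ᴬ y)) σ) ++ []
      ≈⟨ ++-[] ⟩
    f (term n r (w [ i ]≔ (x +ᴬ y)) σ)
      ≈⟨ φ-sum (lin n) i (SumAt-≔ w i x y) r σ ⟩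
    f (term n r (w [ i ]≔ x) σ) ++ f (term n r (w [ i ]≔ y) σ)
      ≈⟨ ≋-++ (≋-refl {f (term n r (w [ i ]≔ x) σ)}) ++-[] ⟨
    f (term n r (w [ i ]≔ x) σ) ++ (f (term n r (w [ i ]≔ y) σ) ++ []) ∎
  ∑-resp {f} lin (≋-slot• {n} r w σ i s x) =
    ≋-++ (φ-scale (lin n) i s (ScaleAt-≔ w i s x) r σ) ≋-refl

  module _ {n : ℕ} where

    IsLin-≋ : ∀ {φ ψ : 𝕂 → Word n → Permutation′ n → 𝓕} → (∀ r w σ → φ r w σ ≋ ψ r w σ) → IsLin ψ → IsLin φ
    IsLin-≋ e lin = record
      { φ-cong = λ p q s → ≋-trans (e _ _ _) (≋-trans (φ-cong lin p q s) (≋-sym (e _ _ _)))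
      ; φ-coef+ = λ r s w σ → ≋-trans (≋-++ (e _ _ _) (e _ _ _)) (≋-trans (φ-coef+ lin r s w σ) (≋-sym (e _ _ _)))
      ; φ-coef0 = λ w σ → ≋-trans (e _ _ _) (φ-coef0 lin w σ)
      ; φ-sum = λ i s r σ → ≋-trans (e _ _ _) (≋-trans (φ-sum lin i s r σ) (≋-sym (≋-++ (e _ _ _) (e _ _ _))))
      ; φ-scale = λ i s p r σ → ≋-trans (e _ _ _) (≋-trans (φ-scale lin i s p r σ) (≋-sym (e _ _ _))) }

    IsLin-[] : IsLin {n} (λ _ _ _ → [])
    IsLin-[] = record { φ-cong = λ _ _ _ → ≋-refl ; φ-coef+ = λ _ _ _ _ → ≋-refl ; φ-coef0 = λ _ _ → ≋-refl
                      ; φ-sum = λ _ _ _ _ → ≋-refl ; φ-scale = λ _ _ _ _ _ → ≋-refl }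

    IsLin-∑ : ∀ {x} {X : Set x} (xs : List X) {φ : X → 𝕂 → Word n → Permutation′ n → 𝓕} →
              (∀ x → IsLin (φ x)) → IsLin (λ r w σ → ∑ xs λ x → φ x r w σ)
    IsLin-∑ xs lin = record
      { φ-cong = λ p q s → ∑-cong xs λ x → φ-cong (lin x) p q s
      ; φ-coef+ = λ r s w σ → ≋-trans (≋-sym (∑-++ xs)) (∑-cong xs λ x → φ-coef+ (lin x) r s w σ)
      ; φ-coef0 = λ w σ → ∑-0 xs λ x → φ-coef0 (lin x) w σ
      ; φ-sum = λ i s r σ → ≋-trans (∑-cong xs λ x → φ-sum (lin x) i s r σ) (∑-++ xs)
      ; φ-scale = λ i s p r σ → ∑-cong xs λ x → φ-scale (lin x) i s p r σ }

    IsLin-∑ᵖ : ∀ {m} {φ : Permutation′ m → 𝕂 → Word n → Permutation′ n → 𝓕} →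
               (∀ p → IsLin (φ p)) → IsLin (λ r w σ → ∑ᵖ λ p → φ p r w σ)
    IsLin-∑ᵖ {m} lin = IsLin-≋ (λ r w σ → ≋-reflexive ∑ᵖ-def) (IsLin-∑ (allPerms m) lin)

    IsLin-when : ∀ {p} {P : Permutation′ n → Set p} (P? : Decidable P) → (∀ {σ τ} → σ Perm.≈ τ → P σ → P τ) →
                 ∀ {φ} → IsLin φ → IsLin (λ r w σ → when (P? σ) (φ r w σ))
    IsLin-when P? P-resp lin = record
      { φ-cong = λ {σ = σ} {σ'} p q s → when-⇔ (P? σ) (P? σ') (P-resp {σ} {σ'} s) (P-resp {σ'} {σ} λ i → sym (s i))
                                          λ _ → φ-cong lin p q s
      ; φ-coef+ = λ r s w σ → ≋-trans (≋-sym (when-++ (P? σ))) (when-cong (P? σ) λ _ → φ-coef+ lin r s w σ)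
      ; φ-coef0 = λ w σ → when-0 (P? σ) λ _ → φ-coef0 lin w σ
      ; φ-sum = λ i s r σ → ≋-trans (when-cong (P? σ) λ _ → φ-sum lin i s r σ) (when-++ (P? σ))
      ; φ-scale = λ i s p r σ → when-cong (P? σ) λ _ → φ-scale lin i s p r σ }
      where
      when-++ : ∀ {p} {P : Set p} (d : Dec P) {x y} → when d (x ++ y) ≋ when d x ++ when d y
      when-++ (yes _) = ≋-refl
      when-++ (no _) = ≋-refl

  record IsScaling (α : 𝕂 → 𝕂) : Set (c ⊔ ℓ) where
    field
      α-cong : ∀ {r s} → r ≈ᴷ s → α r ≈ᴷ α s
      α-+    : ∀ r s → (α r +ᴷ α s) ≈ᴷ α (r +ᴷ s)
      α-0    : α 0ᴷ ≈ᴷ 0ᴷ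
      α-*    : ∀ r s → (α r *ᴷ s) ≈ᴷ α (r *ᴷ s)
  open IsScaling

  *-scalingˡ : ∀ k → IsScaling (k *ᴷ_)
  *-scalingˡ k = record { α-cong = K.*-congˡ ; α-+ = λ r s → K.sym (K.distribˡ k r s) ; α-0 = K.zeroʳ k
                        ; α-* = λ r s → K.*-assoc k r s }

  *-scalingʳ : ∀ k → IsScaling (_*ᴷ k)
  *-scalingʳ k = record { α-cong = K.*-congʳ ; α-+ = λ r s → K.sym (K.distribʳ k r s) ; α-0 = K.zeroˡ k
                        ; α-* = λ r s → K.trans (K.*-assoc r k s) (K.trans (K.*-congˡ (K.*-comm k s)) (K.sym (K.*-assoc r s k))) }

  -- What permuting a word, concatenating it with a fixed word and multiplying it entrywise by a
  -- fixed word have in common: each letter enters one slot of the result, linearly.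
  record IsMulti {m n} (W : Word m → Word n) : Set (c ⊔ a ⊔ ℓa) where
    field
      slot    : Fin m → Fin n
      W-cong  : ∀ {u v} → u ≈ʷ v → W u ≈ʷ W v
      W-sum   : ∀ {u v w} i → SumAt i u v w → SumAt (slot i) (W u) (W v) (W w)
      W-scale : ∀ {u v} i s → ScaleAt i s u v → ScaleAt (slot i) s (W u) (W v)
  open IsMulti

  IsLin-term : ∀ {m n α W} {ρ : Permutation′ m → Permutation′ n} → IsScaling α → IsMulti W →
               (∀ {σ τ} → σ Perm.≈ τ → ρ σ Perm.≈ ρ τ) →
               IsLin (λ r w σ → [ term n (α r) (W w) (ρ σ) ])
  IsLin-term {ρ = ρ} sc mu ρ-cong = record
    { φ-cong = λ {_} {_} {_} {_} {σ} {σ'} p q s → ≋-term (α-cong sc p) (W-cong mu q) (ρ-cong {σ} {σ'} s)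
    ; φ-coef+ = λ r s w σ → ≋-trans (≋-coef+ _ _ _ _) (≋-term (α-+ sc r s) (λ _ → A.refl) (λ _ → refl))
    ; φ-coef0 = λ w σ → ≋-trans (≋-term (α-0 sc) (λ _ → A.refl) (λ _ → refl)) (≋-coef0 _ (ρ σ))
    ; φ-sum = λ i s r σ → ≋-sumAt (slot mu i) (W-sum mu i s) _ _
    ; φ-scale = λ i s p r σ → ≋-trans (≋-scaleAt (slot mu i) s (W-scale mu i s p) _ (ρ σ))
                                      (≋-term (α-* sc r s) (λ _ → A.refl) (λ _ → refl)) }

  multi-id : ∀ {n} → IsMulti {n} (λ w → w)
  multi-id = record { slot = λ i → i ; W-cong = λ e → e ; W-sum = λ _ e → e ; W-scale = λ _ _ e → e }

  multi-∘ : ∀ {l m n} {V : Word m → Word n} {W : Word l → Word m} → IsMulti V → IsMulti W → IsMulti (V ∘ W)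
  multi-∘ v w = record
    { slot = slot v ∘ slot w
    ; W-cong = λ e → W-cong v (W-cong w e)
    ; W-sum = λ i e → W-sum v (slot w i) (W-sum w i e)
    ; W-scale = λ i s e → W-scale v (slot w i) s (W-scale w i s e) }

  multi-▷ : ∀ {n} (π : Permutation′ n) → IsMulti (π ▷_)
  multi-▷ π = record
    { slot = π ⟨$⟩ʳ_
    ; W-cong = λ e i → e (π ⟨$⟩ˡ i)
    ; W-sum = λ {u} {v} {w} i (e , e') →
        subst (λ x → u x ≈ᴬ (v x +ᴬ w x)) (sym (inverseˡ π)) e , λ j ne → e' _ (moved i j ne)
    ; W-scale = λ {u} {v} i s (e , e') →
        subst (λ x → u x ≈ᴬ (s •ᴬ v x)) (sym (inverseˡ π)) e , λ j ne → e' _ (moved i j ne) }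
    where
    moved : ∀ i j → j ≢ π ⟨$⟩ʳ i → π ⟨$⟩ˡ j ≢ i
    moved i j ne e = ne (trans (sym (inverseʳ π)) (cong (π ⟨$⟩ʳ_) e))

  ++ʷ-ˡ : ∀ {m n} (u : Word m) (v : Word n) i → (u ++ʷ v) (i ↑ˡ n) ≡ u i
  ++ʷ-ˡ {m} {n} u v i rewrite Fin.splitAt-↑ˡ m i n = refl

  ++ʷ-ʳ : ∀ {m n} (u : Word m) (v : Word n) j → (u ++ʷ v) (m ↑ʳ j) ≡ v j
  ++ʷ-ʳ {m} {n} u v j rewrite Fin.splitAt-↑ʳ m n j = refl

  module _ {m n : ℕ} where

    ++ʷ-cong : ∀ {u u' : Word m} {v v' : Word n} → u ≈ʷ u' → v ≈ʷ v' → u ++ʷ v ≈ʷ u' ++ʷ v'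
    ++ʷ-cong {u} {u'} {v} {v'} e e' i with side m i
    ... | left a = subst₂ _≈ᴬ_ (sym (++ʷ-ˡ u v a)) (sym (++ʷ-ˡ u' v' a)) (e a)
    ... | right b = subst₂ _≈ᴬ_ (sym (++ʷ-ʳ u v b)) (sym (++ʷ-ʳ u' v' b)) (e' b)

    multi-++ˡ : (v : Word n) → IsMulti {m} (_++ʷ v)
    multi-++ˡ x = record
      { slot = _↑ˡ n
      ; W-cong = λ e → ++ʷ-cong e λ _ → A.refl
      ; W-sum = λ {u} {v} {w} i (e , e') →
          subst₂ _≈ᴬ_ (sym (++ʷ-ˡ u x i)) (sym (cong₂ _+ᴬ_ (++ʷ-ˡ v x i) (++ʷ-ˡ w x i))) e ,
          λ j ne → other u v i (λ j ne → proj₁ (e' j ne)) j ne , other u w i (λ j ne → proj₂ (e' j ne)) j ne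
      ; W-scale = λ {u} {v} i s (e , e') →
          subst₂ _≈ᴬ_ (sym (++ʷ-ˡ u x i)) (sym (cong (s •ᴬ_) (++ʷ-ˡ v x i))) e , other u v i e' }
      where
      other : ∀ u v i → (∀ j → j ≢ i → u j ≈ᴬ v j) → ∀ j → j ≢ i ↑ˡ n → (u ++ʷ x) j ≈ᴬ (v ++ʷ x) j
      other u v i e j ne with side m j
      ... | left k = subst₂ _≈ᴬ_ (sym (++ʷ-ˡ u x k)) (sym (++ʷ-ˡ v x k)) (e k (ne ∘ cong (_↑ˡ n)))
      ... | right k = A.reflexive (trans (++ʷ-ʳ u x k) (sym (++ʷ-ʳ v x k)))

    multi-++ʳ : (u : Word m) → IsMulti {n} (u ++ʷ_)
    multi-++ʳ x = record
      { slot = m ↑ʳ_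
      ; W-cong = λ e → ++ʷ-cong (λ _ → A.refl) e
      ; W-sum = λ {u} {v} {w} i (e , e') →
          subst₂ _≈ᴬ_ (sym (++ʷ-ʳ x u i)) (sym (cong₂ _+ᴬ_ (++ʷ-ʳ x v i) (++ʷ-ʳ x w i))) e ,
          λ j ne → other u v i (λ j ne → proj₁ (e' j ne)) j ne , other u w i (λ j ne → proj₂ (e' j ne)) j ne
      ; W-scale = λ {u} {v} i s (e , e') →
          subst₂ _≈ᴬ_ (sym (++ʷ-ʳ x u i)) (sym (cong (s •ᴬ_) (++ʷ-ʳ x v i))) e , other u v i e' }
      where
      other : ∀ u v i → (∀ j → j ≢ i → u j ≈ᴬ v j) → ∀ j → j ≢ m ↑ʳ i → (x ++ʷ u) j ≈ᴬ (x ++ʷ v) j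
      other u v i e j ne with side m j
      ... | left k = A.reflexive (trans (++ʷ-ˡ x u k) (sym (++ʷ-ˡ x v k)))
      ... | right k = subst₂ _≈ᴬ_ (sym (++ʷ-ʳ x u k)) (sym (++ʷ-ʳ x v k)) (e k (ne ∘ cong (m ↑ʳ_)))

  _⊙_ : ∀ {n} → Word n → Word n → Word n
  (u ⊙ v) i = u i ·ᴬ v i

  ⊙-cong : ∀ {n} {u u' v v' : Word n} → u ≈ʷ u' → v ≈ʷ v' → u ⊙ v ≈ʷ u' ⊙ v'
  ⊙-cong e e' i = A.·-cong (e i) (e' i)

  multi-⊙ˡ : ∀ {n} (b : Word n) → IsMulti (_⊙ b)
  multi-⊙ˡ b = record
    { slot = λ i → i
    ; W-cong = λ e → ⊙-cong {v = b} e λ _ → A.refl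
    ; W-sum = λ {u} {v} {w} i (e , e') → A.trans (A.·-cong e A.refl) (A.·-distribʳ (b i) (v i) (w i)) ,
        λ j ne → A.·-cong (proj₁ (e' j ne)) A.refl , A.·-cong (proj₂ (e' j ne)) A.refl
    ; W-scale = λ {u} {v} i s (e , e') → A.trans (A.·-cong e A.refl) (A.*ₗ-·ᴬ-assocˡ s (v i) (b i)) ,
        λ j ne → A.·-cong (e' j ne) A.refl }

  multi-⊙ʳ : ∀ {n} (b : Word n) → IsMulti (b ⊙_)
  multi-⊙ʳ b = record
    { slot = λ i → i
    ; W-cong = λ e → ⊙-cong {u = b} (λ _ → A.refl) e
    ; W-sum = λ {u} {v} {w} i (e , e') → A.trans (A.·-cong A.refl e) (A.·-distribˡ (b i) (v i) (w i)) ,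
        λ j ne → A.·-cong A.refl (proj₁ (e' j ne)) , A.·-cong A.refl (proj₂ (e' j ne))
    ; W-scale = λ {u} {v} i s (e , e') → A.trans (A.·-cong A.refl e) (A.*ₗ-·ᴬ-assocʳ s (b i) (v i)) ,
        λ j ne → A.·-cong A.refl (e' j ne) }

  map≡∑ : ∀ {x} {X : Set x} (f : X → Term) xs → map f xs ≡ ∑ xs (λ x → [ f x ])
  map≡∑ f [] = refl
  map≡∑ f (x ∷ xs) = cong (f x ∷_) (map≡∑ f xs)

  ∑-when : ∀ {p} {P : Set p} (d : Dec P) {x} {f : Term → 𝓕} → ∑ (when d x) f ≡ when d (∑ x f)
  ∑-when (yes _) = refl
  ∑-when (no _) = refl

  ∑-bindᵖ : ∀ {n} (g : Permutation′ n → 𝓕) (f : Term → 𝓕) → ∑ (∑ᵖ g) f ≋ ∑ᵖ (λ p → ∑ (g p) f)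
  ∑-bindᵖ {n} g f = ≋-reflexive (trans (cong (λ x → ∑ x f) ∑ᵖ-def)
                      (trans (∑-concatMap f g (allPerms n)) (sym ∑ᵖ-def)))

  -- External product

  shuffle : ∀ {m n} → 𝕂 → Word m → Permutation′ m → 𝕂 → Word n → Permutation′ n →
            Permutation′ (m ℕ.+ n) → 𝓕
  shuffle {m} {n} r w σ r' w' σ' ψ = [ term (m ℕ.+ n) (r *ᴷ r') (ψ ▷ (w ++ʷ w')) ((σ ×ₚ σ') ∘ₚ ψ) ]

  IsLin-shuffleˡ : ∀ {m n} r' w' σ' ψ → IsLin (λ r w σ → shuffle {m} {n} r w σ r' w' σ' ψ)
  IsLin-shuffleˡ r' w' σ' ψ = IsLin-term (*-scalingʳ r') (multi-∘ (multi-▷ ψ) (multi-++ˡ w'))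
    λ {σ} {τ} e → ∘ₚ-congˡ {σ = σ ×ₚ σ'} {τ ×ₚ σ'} ψ (×ₚ-cong {σ = σ} {τ} {σ'} {σ'} e λ _ → refl)

  IsLin-shuffleʳ : ∀ {m n} r w σ ψ → IsLin (λ r' w' σ' → shuffle {m} {n} r w σ r' w' σ' ψ)
  IsLin-shuffleʳ r w σ ψ = IsLin-term (*-scalingˡ r) (multi-∘ (multi-▷ ψ) (multi-++ʳ w))
    λ {σ'} {τ'} e → ∘ₚ-congˡ {σ = σ ×ₚ σ'} {σ ×ₚ τ'} ψ (×ₚ-cong {σ = σ} {σ} {σ'} {τ'} (λ _ → refl) e)

  *ₜ-shuffle : ∀ {m n} r w σ r' w' σ' →
    term m r w σ *ₜ term n r' w' σ' ≋ ∑ᵖ (λ ψ → when (inc? (halves m n) ψ) (shuffle r w σ r' w' σ' ψ))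
  *ₜ-shuffle {m} {n} r w σ r' w' σ' = begin
    term m r w σ *ₜ term n r' w' σ'
      ≡⟨ map≡∑ _ (X₂ m n) ⟩
    ∑ (X₂ m n) (shuffle r w σ r' w' σ')
      ≡⟨ ∑-filter _ (allPerms (m ℕ.+ n)) (shuffle r w σ r' w' σ') ⟩
    ∑ (allPerms (m ℕ.+ n)) _
      -- Both decisions concern the same proposition, the predicate of `X₂` being `Inc (halves m n)`
      -- by definition; only the decision procedures differ.
      ≈⟨ ∑-cong (allPerms (m ℕ.+ n)) (λ ψ → when-⇔ _ (inc? (halves m n) ψ) (λ p → p) (λ p → p) λ _ → ≋-refl) ⟩
    ∑ (allPerms (m ℕ.+ n)) (λ ψ → when (inc? (halves m n) ψ) (shuffle r w σ r' w' σ' ψ))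
      ≡⟨ ∑ᵖ-def ⟨
    ∑ᵖ (λ ψ → when (inc? (halves m n) ψ) (shuffle r w σ r' w' σ' ψ)) ∎

  IsLin-guard : ∀ {p} {P : Set p} (d : Dec P) {n φ} → IsLin {n} φ → IsLin (λ r w σ → when d (φ r w σ))
  IsLin-guard d = IsLin-when (λ _ → d) (λ _ p → p)

  *ₜ-linearˡ : ∀ t' → LinearMap (_*ₜ t')
  *ₜ-linearˡ (term n r' w' σ') m = IsLin-≋ (λ r w σ → *ₜ-shuffle r w σ r' w' σ')
    (IsLin-∑ᵖ λ ψ → IsLin-guard (inc? (halves m n) ψ) (IsLin-shuffleˡ r' w' σ' ψ))

  *ₜ-linearʳ : ∀ t → LinearMap (t *ₜ_)
  *ₜ-linearʳ (term m r w σ) n = IsLin-≋ (λ r' w' σ' → *ₜ-shuffle r w σ r' w' σ')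
    (IsLin-∑ᵖ λ ψ → IsLin-guard (inc? (halves m n) ψ) (IsLin-shuffleʳ r w σ ψ))

  bilinear-cong : ∀ (f : Term → Term → 𝓕) → (∀ t → LinearMap (f t)) → (∀ t' → LinearMap (λ t → f t t')) →
                  ∀ {x x' y y'} → x ≋ x' → y ≋ y' → ∑ x (λ t → ∑ y (f t)) ≋ ∑ x' (λ t → ∑ y' (f t))
  bilinear-cong f lin lin' {x} {x'} {y} {y'} e e' = begin
    ∑ x (λ t → ∑ y (f t))              ≈⟨ ∑-cong x (λ t → ∑-resp (lin t) e') ⟩
    ∑ x (λ t → ∑ y' (f t))             ≈⟨ ∑-swap x y' ⟩
    ∑ y' (λ t' → ∑ x (λ t → f t t'))   ≈⟨ ∑-cong y' (λ t' → ∑-resp (lin' t') e) ⟩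
    ∑ y' (λ t' → ∑ x' (λ t → f t t'))  ≈⟨ ∑-swap x' y' ⟨
    ∑ x' (λ t → ∑ y' (f t))            ∎

  *-cong : ∀ {x x' y y'} → x ≋ x' → y ≋ y' → x * y ≋ x' * y'
  *-cong = bilinear-cong _*ₜ_ *ₜ-linearʳ *ₜ-linearˡ

  -- Internal product

  ·ₜ-same : ∀ {n} r w σ s v τ → term n r w σ ·ₜ term n s v τ ≡ [ term n (r *ᴷ s) (w ⊙ (σ ▷ v)) (τ ∘ₚ σ) ]
  ·ₜ-same {n} r w σ s v τ rewrite ℕ.≟-diag {n} refl = refl

  ·ₜ-other : ∀ {m n} r w σ s v τ → m ≢ n → term m r w σ ·ₜ term n s v τ ≡ []
  ·ₜ-other {m} {n} r w σ s v τ ne with m ℕ.≟ n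
  ... | yes e = ⊥-elim (ne e)
  ... | no _ = refl

  ⊙-▷-cong : ∀ {n} {u u' : Word n} (v : Word n) {σ σ' : Permutation′ n} → u ≈ʷ u' → σ Perm.≈ σ' →
             u ⊙ (σ ▷ v) ≈ʷ u' ⊙ (σ' ▷ v)
  ⊙-▷-cong v {σ} {σ'} e e' i = A.·-cong (e i) (▷-cong {π = σ} {σ'} e' v i)

  ·ₜ-linearˡ : ∀ t' → LinearMap (_·ₜ t')
  ·ₜ-linearˡ (term m s v τ) n with n ℕ.≟ m
  ... | no _ = IsLin-[]
  ... | yes refl = record
    -- `σ` also permutes the word `v`, and only this law lets `σ` vary; in the others it is fixed
    -- and `lin σ` applies.
    { φ-cong = λ {r} {r'} {w} {w'} {σ} {σ'} p q e →
        ≋-term (K.*-congʳ p) (⊙-▷-cong v {σ} {σ'} q e) (λ i → e (τ ⟨$⟩ʳ i))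
    ; φ-coef+ = λ r r' w σ → IsLin.φ-coef+ (lin σ) r r' w σ
    ; φ-coef0 = λ w σ → IsLin.φ-coef0 (lin σ) w σ
    ; φ-sum = λ i e r σ → IsLin.φ-sum (lin σ) i e r σ
    ; φ-scale = λ i k e r σ → IsLin.φ-scale (lin σ) i k e r σ }
    where
    lin : ∀ ρ → IsLin {n} (λ r w σ → [ term n (r *ᴷ s) (w ⊙ (ρ ▷ v)) (τ ∘ₚ ρ) ])
    lin ρ = IsLin-term (*-scalingʳ s) (multi-⊙ˡ (ρ ▷ v)) (λ _ _ → refl)

  ·ₜ-linearʳ : ∀ t → LinearMap (t ·ₜ_)
  ·ₜ-linearʳ (term n r w σ) m with n ℕ.≟ m
  ... | no _ = IsLin-[]
  ... | yes refl = IsLin-term (*-scalingˡ r) (multi-∘ (multi-⊙ʳ w) (multi-▷ σ))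
                     λ {τ} {τ'} e → ∘ₚ-congˡ {σ = τ} {τ'} σ e

  ·-cong : ∀ {x x' y y'} → x ≋ x' → y ≋ y' → x · y ≋ x' · y'
  ·-cong = bilinear-cong _·ₜ_ ·ₜ-linearʳ ·ₜ-linearˡ

  when-guard : ∀ {p q r} {P : Set p} {Q : Set q} {R : Set r} (d : Dec P) (e : Dec Q) (e' : Dec R) {x} →
               (P → Q → R) → (P → R → Q) → when e (when d x) ≋ when d (when e' x)
  when-guard (yes p) e e' f g = when-⇔ e e' (f p) (g p) λ _ → ≋-refl
  when-guard (no _) e e' f g = when-0 e λ _ → ≋-refl

  -- The double coset argument

  module _ {n} (C : Colouring n) where

    -- The test for `χ` being the distinguished representative of the coset g S_C. Exactly one `χ`
    -- passes it, which `∑ᵖ-coset` expresses as an indicator sum.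
    coset? : ∀ (g χ : Permutation′ n) → Dec (Inc C χ × Pres C (χ ∘ₚ Perm.flip g))
    coset? g χ = inc? C χ ×-dec pres? C (χ ∘ₚ Perm.flip g)

    ∑ᵖ-coset : ∀ g {x} → ∑ᵖ (λ χ → when (coset? g χ) x) ≋ x
    ∑ᵖ-coset g {x} with decompose C g
    ... | χ₀ , s₀ , inc₀ , pres₀ , e₀ = ∑ᵖ-unique χ₀
      (λ χ ne → when-0 (coset? g χ) λ (inc , pres) → ⊥-elim (ne (proj₁
         (decompose-unique C {χ} {Perm.flip (χ ∘ₚ Perm.flip g)} {χ₀} {s₀} inc
            (Pres-flip C {χ ∘ₚ Perm.flip g} pres) inc₀ pres₀
            (λ i → trans (inverseʳ χ) (e₀ i))))))
      (λ χ e → ≋-reflexive (when-yes (coset? g χ)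
         (Inc-resp C {χ₀} {χ} (λ i → sym (e i)) inc₀ ,
          Pres-resp C {Perm.flip s₀} {χ ∘ₚ Perm.flip g}
            (λ i → sym (trans (cong (g ⟨$⟩ˡ_) (trans (e i)
               (trans (cong (χ₀ ⟨$⟩ʳ_) (sym (inverseʳ s₀))) (sym (e₀ (s₀ ⟨$⟩ˡ i)))))) (inverseˡ g)))
            (Pres-flip C {s₀} pres₀))))

  module _ {n} (C D : Colouring n) (convex : Convex D) where

    -- θ and θ' differ by an element of the Young subgroup of D and both
    -- χ θ = π s and χ' θ' = s are monotone comparisons inside the classes of C.
    transfer : ∀ {π s χ χ'} → Inc C π → Pres C s → Inc D χ → Inc D χ' → Pres D ((χ' ∘ₚ π) ∘ₚ Perm.flip χ) →
               (Inc C (s ∘ₚ Perm.flip χ') → Inc C ((s ∘ₚ π) ∘ₚ Perm.flip χ)) ×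
               (Inc C ((s ∘ₚ π) ∘ₚ Perm.flip χ) → Inc C (s ∘ₚ Perm.flip χ'))
    transfer {π} {s} {χ} {χ'} incπ press incχ incχ' pres = forward , backward
      where
      θ = (s ∘ₚ π) ∘ₚ Perm.flip χ
      θ' = s ∘ₚ Perm.flip χ'
      same-D : ∀ i → colour D (θ ⟨$⟩ʳ i) ≡ colour D (θ' ⟨$⟩ʳ i)
      same-D i = trans (cong (λ x → colour D (χ ⟨$⟩ˡ (π ⟨$⟩ʳ x))) (sym (inverseʳ χ'))) (pres (θ' ⟨$⟩ʳ i))
      same-C : ∀ {i j} → colour C i ≡ colour C j → colour C (s ⟨$⟩ʳ i) ≡ colour C (s ⟨$⟩ʳ j)
      same-C e = trans (press _) (trans e (sym (press _)))
      forward : Inc C θ' → Inc C θ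
      forward incθ' i j (e , lt) with _≟ᶜ_ D (colour D (θ' ⟨$⟩ʳ i)) (colour D (θ' ⟨$⟩ʳ j))
      ... | no ne = convex _ _ _ _ (incθ' i j (e , lt)) ne (same-D i) (same-D j)
      ... | yes d = Inc-reflects D {χ} incχ (trans (same-D i) (trans d (sym (same-D j))))
        (subst₂ Fin._<_ (sym (inverseʳ χ)) (sym (inverseʳ χ))
          (incπ _ _ (same-C e , subst₂ Fin._<_ (inverseʳ χ') (inverseʳ χ')
            (incχ' _ _ (d , incθ' i j (e , lt))))))
      backward : Inc C θ → Inc C θ'
      backward incθ i j (e , lt) with _≟ᶜ_ D (colour D (θ ⟨$⟩ʳ i)) (colour D (θ ⟨$⟩ʳ j))
      ... | no ne = convex _ _ _ _ (incθ i j (e , lt)) ne (sym (same-D i)) (sym (same-D j))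
      ... | yes d = Inc-reflects D {χ'} incχ' (trans (sym (same-D i)) (trans d (same-D j)))
        (subst₂ Fin._<_ (sym (inverseʳ χ')) (sym (inverseʳ χ'))
          (Inc-reflects C {π} incπ (same-C e) (subst₂ Fin._<_ (inverseʳ χ) (inverseʳ χ)
            (incχ _ _ (d , incθ i j (e , lt))))))

    module _ {G : Permutation′ n → Permutation′ n → 𝓕}
             (G-resp : ∀ χ χ' g g' → χ Perm.≈ χ' → g Perm.≈ g' → G χ g ≋ G χ' g')
             (G-inv : ∀ χ h g → Pres D h → G (h ∘ₚ χ) g ≋ G χ g) where

      private
        -- The summands of the two sides at fixed g = πs: `f` has the test χ⁻¹πs ∈ X_C, while `f'`
        -- has πχ in place of χ inside `G` and the test χ⁻¹s ∈ X_C.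
        f : Permutation′ n → Permutation′ n → Permutation′ n → 𝓕
        f π s χ = when (inc? D χ) (when (inc? C ((s ∘ₚ π) ∘ₚ Perm.flip χ)) (G χ (s ∘ₚ π)))

        f' : Permutation′ n → Permutation′ n → Permutation′ n → 𝓕
        f' π s χ = when (inc? D χ) (when (inc? C (s ∘ₚ Perm.flip χ)) (G (χ ∘ₚ π) (s ∘ₚ π)))

        R? : ∀ π (χ χ' : Permutation′ n) → Dec (Inc D χ × Inc D χ' × Pres D ((χ' ∘ₚ π) ∘ₚ Perm.flip χ))
        R? π χ χ' = inc? D χ ×-dec (inc? D χ' ×-dec pres? D ((χ' ∘ₚ π) ∘ₚ Perm.flip χ))

        -- Every coset of the Young subgroup of `D` has one increasing representative, so for given
        -- `π` the relation of `R?`, which says χ S_D = πχ' S_D, pairs the `χ` with the `χ'`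
        -- bijectively. On a pair, `transfer` equates the tests and the invariance of `G` equates
        -- the values.
        exchange : ∀ π s → Inc C π → Pres C s → ∑ᵖ (f π s) ≋ ∑ᵖ (f' π s)
        exchange π s incπ press = subst₂ _≋_ (sym ∑ᵖ-def) (sym ∑ᵖ-def)
          (∑-match (R? π) (allPerms n) (allPerms n) row col related)
          where
          row : ∀ χ → ∑ (allPerms n) (λ χ' → when (R? π χ χ') (f π s χ)) ≋ f π s χ
          row χ = ≋-trans (≋-reflexive (sym ∑ᵖ-def)) (≋-trans
            (∑ᵖ-cong λ χ' → when-guard (inc? D χ) (R? π χ χ') (coset? D (χ ∘ₚ Perm.flip π) χ')
               (λ _ → proj₂) (λ i q → i , q))
            (≋-trans (≋-sym (when-∑ᵖ (inc? D χ))) (when-cong (inc? D χ) λ _ → ∑ᵖ-coset D (χ ∘ₚ Perm.flip π))))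
          col : ∀ χ' → ∑ (allPerms n) (λ χ → when (R? π χ χ') (f' π s χ')) ≋ f' π s χ'
          col χ' = ≋-trans (≋-reflexive (sym ∑ᵖ-def)) (≋-trans
            (∑ᵖ-cong λ χ → when-guard (inc? D χ') (R? π χ χ') (coset? D (χ' ∘ₚ π) χ)
               (λ _ (i , _ , p) → i , Pres-flip D {(χ' ∘ₚ π) ∘ₚ Perm.flip χ} p)
               (λ i' (i , p) → i , i' , Pres-flip D {χ ∘ₚ Perm.flip (χ' ∘ₚ π)} p))
            (≋-trans (≋-sym (when-∑ᵖ (inc? D χ'))) (when-cong (inc? D χ') λ _ → ∑ᵖ-coset D (χ' ∘ₚ π))))
          related : ∀ χ χ' → Inc D χ × Inc D χ' × Pres D ((χ' ∘ₚ π) ∘ₚ Perm.flip χ) → f π s χ ≋ f' π s χ'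
          related χ χ' (i , i' , p) with transfer {π} {s} {χ} {χ'} incπ press i i' p
          ... | to , from = when-⇔ (inc? D χ) (inc? D χ') (λ _ → i') (λ _ → i) λ _ →
            when-⇔ (inc? C ((s ∘ₚ π) ∘ₚ Perm.flip χ)) (inc? C (s ∘ₚ Perm.flip χ')) from to λ _ →
              ≋-trans (≋-sym (G-inv χ ((χ' ∘ₚ π) ∘ₚ Perm.flip χ) (s ∘ₚ π) p))
                (G-resp (((χ' ∘ₚ π) ∘ₚ Perm.flip χ) ∘ₚ χ) (χ' ∘ₚ π) (s ∘ₚ π) (s ∘ₚ π)
                   (λ _ → inverseʳ χ) (λ _ → refl))

        ∑ᵖ³-swap : ∀ {H : Permutation′ n → Permutation′ n → Permutation′ n → 𝓕} →
          ∑ᵖ (λ χ → when (inc? D χ) (∑ᵖ λ π → when (inc? C π) (∑ᵖ λ s → when (pres? C s) (H π s χ)))) ≋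
          ∑ᵖ (λ π → when (inc? C π) (∑ᵖ λ s → when (pres? C s) (∑ᵖ λ χ → when (inc? D χ) (H π s χ))))
        ∑ᵖ³-swap {H} = begin
          ∑ᵖ (λ χ → when (inc? D χ) (∑ᵖ λ π → when (inc? C π) (∑ᵖ λ s → when (pres? C s) (H π s χ))))
            ≈⟨ ∑ᵖ-cong (λ χ → ≋-trans (when-∑ᵖ (inc? D χ)) (∑ᵖ-cong λ π → ≋-trans
                 (≋-reflexive (when-swap (inc? D χ) (inc? C π)))
                 (when-cong (inc? C π) λ _ → ≋-trans (when-∑ᵖ (inc? D χ))
                   (∑ᵖ-cong λ s → ≋-reflexive (when-swap (inc? D χ) (pres? C s)))))) ⟩
          ∑ᵖ (λ χ → ∑ᵖ λ π → when (inc? C π) (∑ᵖ λ s → when (pres? C s) (when (inc? D χ) (H π s χ))))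
            ≈⟨ ∑ᵖ-swap ⟩
          ∑ᵖ (λ π → ∑ᵖ λ χ → when (inc? C π) (∑ᵖ λ s → when (pres? C s) (when (inc? D χ) (H π s χ))))
            ≈⟨ ∑ᵖ-cong (λ π → ≋-trans (≋-sym (when-∑ᵖ (inc? C π))) (when-cong (inc? C π) λ _ →
                 ≋-trans ∑ᵖ-swap (∑ᵖ-cong λ s → ≋-sym (when-∑ᵖ (pres? C s))))) ⟩
          ∑ᵖ (λ π → when (inc? C π) (∑ᵖ λ s → when (pres? C s) (∑ᵖ λ χ → when (inc? D χ) (H π s χ)))) ∎

      -- Substituting g = χπ turns the condition on `π` into χ⁻¹g ∈ X_C with `g` free. Factoring `g`
      -- afresh along `C` as πs gives an outer sum over π and s, inside which `exchange` applies.
      double-coset :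
        ∑ᵖ (λ χ → when (inc? D χ) (∑ᵖ λ π → when (inc? C π) (G χ (π ∘ₚ χ)))) ≋
        ∑ᵖ (λ χ → when (inc? D χ) (∑ᵖ λ s → when (pres? C s) (when (inc? C (s ∘ₚ Perm.flip χ))
          (∑ᵖ λ π → when (inc? C π) (G (χ ∘ₚ π) (s ∘ₚ π))))))
      double-coset = begin
        ∑ᵖ (λ χ → when (inc? D χ) (∑ᵖ λ π → when (inc? C π) (G χ (π ∘ₚ χ))))
          ≈⟨ ∑ᵖ-cong (λ χ → when-cong (inc? D χ) λ _ → ≋-trans (by-product χ) (∑ᵖ-decompose C (F-resp χ))) ⟩
        ∑ᵖ (λ χ → when (inc? D χ) (∑ᵖ λ π → when (inc? C π) (∑ᵖ λ s → when (pres? C s) (F χ (s ∘ₚ π)))))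
          ≈⟨ ∑ᵖ³-swap ⟩
        ∑ᵖ (λ π → when (inc? C π) (∑ᵖ λ s → when (pres? C s) (∑ᵖ (f π s))))
          ≈⟨ ∑ᵖ-cong (λ π → when-cong (inc? C π) λ incπ → ∑ᵖ-cong λ s →
               when-cong (pres? C s) λ press → exchange π s incπ press) ⟩
        ∑ᵖ (λ π → when (inc? C π) (∑ᵖ λ s → when (pres? C s) (∑ᵖ (f' π s))))
          ≈⟨ ∑ᵖ³-swap ⟨
        ∑ᵖ (λ χ → when (inc? D χ) (∑ᵖ λ π → when (inc? C π) (∑ᵖ λ s → when (pres? C s)
          (when (inc? C (s ∘ₚ Perm.flip χ)) (G (χ ∘ₚ π) (s ∘ₚ π))))))
          ≈⟨ ∑ᵖ-cong (λ χ → when-cong (inc? D χ) λ _ → inner χ) ⟩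
        ∑ᵖ (λ χ → when (inc? D χ) (∑ᵖ λ s → when (pres? C s) (when (inc? C (s ∘ₚ Perm.flip χ))
          (∑ᵖ λ π → when (inc? C π) (G (χ ∘ₚ π) (s ∘ₚ π)))))) ∎
        where
        F : Permutation′ n → Permutation′ n → 𝓕
        F χ g = when (inc? C (g ∘ₚ Perm.flip χ)) (G χ g)
        F-resp : ∀ χ → Respects (F χ)
        F-resp χ g g' e = when-⇔ (inc? C (g ∘ₚ Perm.flip χ)) (inc? C (g' ∘ₚ Perm.flip χ))
          (Inc-resp C {g ∘ₚ Perm.flip χ} {g' ∘ₚ Perm.flip χ} λ i → cong (χ ⟨$⟩ˡ_) (e i))
          (Inc-resp C {g' ∘ₚ Perm.flip χ} {g ∘ₚ Perm.flip χ} λ i → cong (χ ⟨$⟩ˡ_) (sym (e i)))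
          λ _ → G-resp χ χ g g' (λ _ → refl) e
        by-product : ∀ χ → ∑ᵖ (λ π → when (inc? C π) (G χ (π ∘ₚ χ))) ≋ ∑ᵖ (F χ)
        by-product χ = ≋-trans (∑ᵖ-cong λ π → when-⇔ (inc? C π) (inc? C ((π ∘ₚ χ) ∘ₚ Perm.flip χ))
            (Inc-resp C {π} {(π ∘ₚ χ) ∘ₚ Perm.flip χ} λ i → sym (inverseˡ χ))
            (Inc-resp C {(π ∘ₚ χ) ∘ₚ Perm.flip χ} {π} λ i → inverseˡ χ) λ _ → ≋-refl)
          (∑ᵖ-∘ₚ (F-resp χ) χ)
        inner : ∀ χ →
          ∑ᵖ (λ π → when (inc? C π) (∑ᵖ λ s → when (pres? C s)
            (when (inc? C (s ∘ₚ Perm.flip χ)) (G (χ ∘ₚ π) (s ∘ₚ π))))) ≋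
          ∑ᵖ (λ s → when (pres? C s) (when (inc? C (s ∘ₚ Perm.flip χ))
            (∑ᵖ λ π → when (inc? C π) (G (χ ∘ₚ π) (s ∘ₚ π)))))
        inner χ = ≋-trans (∑ᵖ-cong λ π → when-∑ᵖ (inc? C π)) (≋-trans ∑ᵖ-swap (∑ᵖ-cong λ s →
          ≋-trans (∑ᵖ-cong λ π → ≋-trans (≋-reflexive (when-swap (inc? C π) (pres? C s)))
                    (when-cong (pres? C s) λ _ → ≋-reflexive (when-swap (inc? C π) (inc? C (s ∘ₚ Perm.flip χ)))))
            (≋-trans (≋-sym (when-∑ᵖ (pres? C s))) (when-cong (pres? C s) λ _ →
              ≋-sym (when-∑ᵖ (inc? C (s ∘ₚ Perm.flip χ)))))))

  -- Guarded sums and orbit sums.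

  ∑ᵍ : ∀ {n p} {P : Permutation′ n → Set p} → Decidable P → (Permutation′ n → 𝓕) → 𝓕
  ∑ᵍ P? f = ∑ᵖ λ p → when (P? p) (f p)

  module _ {n p} {P : Permutation′ n → Set p} (P? : Decidable P) where

    ∑ᵍ-cong : ∀ {f g} → (∀ p → P p → f p ≋ g p) → ∑ᵍ P? f ≋ ∑ᵍ P? g
    ∑ᵍ-cong e = ∑ᵖ-cong λ p → when-cong (P? p) (e p)

    ∑ᵍ-0 : ∀ {f} → (∀ p → f p ≋ []) → ∑ᵍ P? f ≋ []
    ∑ᵍ-0 e = ∑ᵖ-0 λ p → when-0 (P? p) λ _ → e p

    ∑-∑ᵍ : ∀ {x} {X : Set x} (xs : List X) {f : X → Permutation′ n → 𝓕} →
           ∑ xs (λ x → ∑ᵍ P? (f x)) ≋ ∑ᵍ P? (λ p → ∑ xs λ x → f x p)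
    ∑-∑ᵍ xs = ≋-trans (∑-∑ᵖ xs) (∑ᵖ-cong λ p → ≋-sym (when-∑ (P? p) xs))

    ∑ᵍ-bind : ∀ (g : Permutation′ n → 𝓕) f → ∑ (∑ᵍ P? g) f ≋ ∑ᵍ P? (λ p → ∑ (g p) f)
    ∑ᵍ-bind g f = ≋-trans (∑-bindᵖ (λ p → when (P? p) (g p)) f) (∑ᵖ-cong λ p → ≋-reflexive (∑-when (P? p)))

    when-∑ᵍ : ∀ {q} {Q : Set q} (d : Dec Q) {f} → when d (∑ᵍ P? f) ≋ ∑ᵍ P? (λ p → when d (f p))
    when-∑ᵍ d = ≋-trans (when-∑ᵖ d) (∑ᵖ-cong λ p → ≋-reflexive (when-swap d (P? p)))

    IsLin-∑ᵍ : ∀ {m} {φ : Permutation′ n → 𝕂 → Word m → Permutation′ m → 𝓕} →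
               (∀ p → IsLin (φ p)) → IsLin (λ r w σ → ∑ᵍ P? λ p → φ p r w σ)
    IsLin-∑ᵍ lin = IsLin-∑ᵖ λ p → IsLin-guard (P? p) (lin p)

  ∑ᵍ-swap : ∀ {m n p q} {P : Permutation′ m → Set p} {Q : Permutation′ n → Set q}
            (P? : Decidable P) (Q? : Decidable Q) {f : Permutation′ m → Permutation′ n → 𝓕} →
            ∑ᵍ P? (λ p → ∑ᵍ Q? (f p)) ≋ ∑ᵍ Q? (λ q → ∑ᵍ P? (λ p → f p q))
  ∑ᵍ-swap P? Q? = ≋-trans (∑ᵖ-cong λ p → when-∑ᵍ Q? (P? p))
    (≋-trans ∑ᵖ-swap (∑ᵖ-cong λ q → ≋-sym (when-∑ᵖ (Q? q))))

  extend : ∀ {n} → (𝕂 → Word n → Permutation′ n → 𝓕) → Term → 𝓕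
  extend {n} φ (term m r w σ) with m ℕ.≟ n
  ... | yes refl = φ r w σ
  ... | no _ = []

  extend-same : ∀ {n} (φ : 𝕂 → Word n → Permutation′ n → 𝓕) r w σ → extend φ (term n r w σ) ≡ φ r w σ
  extend-same {n} φ r w σ rewrite ℕ.≟-diag {n} refl = refl

  extend-linear : ∀ {n φ} → IsLin {n} φ → LinearMap (extend φ)
  extend-linear {n} lin m with m ℕ.≟ n
  ... | yes refl = lin
  ... | no _ = IsLin-[]

  module _ {n} (φ : 𝕂 → Word n → 𝓕) where

    ∑ᵀ : Tensor n → 𝓕
    ∑ᵀ T = ∑ T λ (r , w) → φ r w

    ∑-#e : ∀ T → ∑ (T #e) (extend λ r w _ → φ r w) ≡ ∑ᵀ T
    ∑-#e [] = refl
    ∑-#e ((r , w) ∷ T) = cong₂ _++_ (extend-same (λ r w _ → φ r w) r w Perm.id) (∑-#e T)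

    -- The map on words is read as a map on symbols that ignores the permutation and is extended by
    -- zero to the other degrees; `∑-resp` then applies to it.
    ∑ᵀ-resp : IsLin (λ r w (_ : Permutation′ n) → φ r w) → ∀ {T T'} → T #e ≋ T' #e → ∑ᵀ T ≋ ∑ᵀ T'
    ∑ᵀ-resp lin {T} {T'} e = subst₂ _≋_ (∑-#e T) (∑-#e T') (∑-resp (extend-linear lin) e)

  ∑ᵀ-act : ∀ {n} (φ : 𝕂 → Word n → 𝓕) h T → ∑ᵀ φ (actᵀ h T) ≡ ∑ᵀ (λ r w → φ r (h ▷ w)) T
  ∑ᵀ-act φ h [] = refl
  ∑ᵀ-act φ h ((r , w) ∷ T) = cong (φ r (h ▷ w) ++_) (∑ᵀ-act φ h T)

  -- Recorded in `𝓕` through `_#e`, so that `∑-resp` serves for tensors as well; `≋ᵀ⇒≋` supplies it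
  -- for the generators.
  Invariant : ∀ {n} → Colouring n → Tensor n → Set _
  Invariant D T = ∀ h → Pres D h → (actᵀ h T) #e ≋ T #e

  -- x_D · (T#τ); for τ = e, T = T₁ ⊗ ⋯ ⊗ T_k and D the colouring by blocks this
  -- is the product of the T_i#e.
  orbit : ∀ {n} → Colouring n → Tensor n → Permutation′ n → 𝓕
  orbit {n} D T τ = ∑ᵍ (inc? D) λ χ → ∑ᵀ (λ r w → [ term n r (χ ▷ w) (τ ∘ₚ χ) ]) T

  orbit-cong : ∀ {n} (D : Colouring n) {r r' w w' τ τ'} → r ≈ᴷ r' → w ≈ʷ w' → τ Perm.≈ τ' →
               orbit D [ r , w ] τ ≋ orbit D [ r' , w' ] τ'
  orbit-cong D e e' e'' = ∑ᵍ-cong (inc? D) λ χ _ →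
    ≋-term e (λ i → e' (χ ⟨$⟩ˡ i)) (λ i → cong (χ ⟨$⟩ʳ_) (e'' i))

  orbit-congʳ : ∀ {n} (D : Colouring n) T {τ τ'} → τ Perm.≈ τ' → orbit D T τ ≋ orbit D T τ'
  orbit-congʳ D T e = ∑ᵍ-cong (inc? D) λ χ _ → ∑-cong T λ _ →
    ≋-term K.refl (λ _ → A.refl) (λ i → cong (χ ⟨$⟩ʳ_) (e i))

  orbit-bind : ∀ {n} (D : Colouring n) T τ f →
    ∑ (orbit D T τ) f ≋ ∑ᵍ (inc? D) λ χ → ∑ᵀ (λ r w → f (term n r (χ ▷ w) (τ ∘ₚ χ))) T
  orbit-bind {n} D T τ f = ≋-trans (∑ᵍ-bind (inc? D) _ f) (∑ᵍ-cong (inc? D) λ χ _ →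
    ≋-trans (≋-reflexive (∑-concatMap f (λ (r , w) → [ term n r (χ ▷ w) (τ ∘ₚ χ) ]) T)) (∑-cong T λ _ → ++-[]))

  -- The additive span of the orbit sums. Closure under scalars and products is proved, by absorbing
  -- scalars into `T` and products into `D ⊕ E` and `T ⊗ U`.
  data OrbitSum : 𝓕 → Set (Level.suc Level.zero ⊔ c ⊔ ℓ ⊔ a ⊔ ℓa) where
    orbit-sum : ∀ {n} (D : Colouring n) (T : Tensor n) → Convex D → Invariant D T → OrbitSum (orbit D T Perm.id)
    empty     : OrbitSum []
    plus      : ∀ {x y} → OrbitSum x → OrbitSum y → OrbitSum (x ++ y)
    up-to     : ∀ {x y} → x ≋ y → OrbitSum x → OrbitSum y

  ≋ᵀ⇒≋ : ∀ {n} {T T' : Tensor n} → T ≋ᵀ T' → T #e ≋ T' #e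
  ≋ᵀ⇒≋ ≋ᵀ-refl = ≋-refl
  ≋ᵀ⇒≋ (≋ᵀ-sym e) = ≋-sym (≋ᵀ⇒≋ e)
  ≋ᵀ⇒≋ (≋ᵀ-trans e e') = ≋-trans (≋ᵀ⇒≋ e) (≋ᵀ⇒≋ e')
  ≋ᵀ⇒≋ (≋ᵀ-++ {x} {x'} {y} {y'} e e') =
    subst₂ _≋_ (sym (List.map-++ _ x y)) (sym (List.map-++ _ x' y')) (≋-++ (≋ᵀ⇒≋ e) (≋ᵀ⇒≋ e'))
  ≋ᵀ⇒≋ (≋ᵀ-comm x y) =
    subst₂ _≋_ (sym (List.map-++ _ x y)) (sym (List.map-++ _ y x)) (≋-comm (x #e) (y #e))
  ≋ᵀ⇒≋ (≋ᵀ-term e e') = ≋-term e e' λ _ → refl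
  ≋ᵀ⇒≋ (≋ᵀ-coef+ r s w) = ≋-coef+ r s w Perm.id
  ≋ᵀ⇒≋ (≋ᵀ-coef0 w) = ≋-coef0 w Perm.id
  ≋ᵀ⇒≋ (≋ᵀ-slot+ r w i x y) = ≋-slot+ r w Perm.id i x y
  ≋ᵀ⇒≋ (≋ᵀ-slot• r w i s x) = ≋-slot• r w Perm.id i s x

  #e≡∑ᵀ : ∀ {n} (T : Tensor n) → T #e ≡ ∑ᵀ (λ r w → [ term n r w Perm.id ]) T
  #e≡∑ᵀ [] = refl
  #e≡∑ᵀ ((r , w) ∷ T) = cong (term _ r w Perm.id ∷_) (#e≡∑ᵀ T)

  -- With a single class, the identity is the only increasing permutation.
  orbit-trivial : ∀ {n} (T : Tensor n) τ → orbit (trivial n) T τ ≋ ∑ᵀ (λ r w → [ term n r w τ ]) T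
  orbit-trivial {n} T τ = ∑ᵖ-unique Perm.id
    (λ χ ne → when-0 (inc? (trivial n) χ) λ inc → ⊥-elim (ne (Pres∧Inc⇒id (trivial n) {χ} (λ _ → refl) inc)))
    (λ χ e → ≋-trans
      (≋-reflexive (when-yes (inc? (trivial n) χ)
         (Inc-resp (trivial n) {Perm.id} {χ} (λ i → sym (e i)) λ i j (_ , lt) → lt)))
      (∑-cong T λ (r , w) → ≋-term K.refl (▷-cong {π = χ} {Perm.id} e w) (λ i → e (τ ⟨$⟩ʳ i))))

  -- Products of orbit sums

  _⊗_ : ∀ {m n} → Tensor m → Tensor n → Tensor (m ℕ.+ n)
  T ⊗ U = concatMap (λ (r , w) → map (λ (r' , w') → r *ᴷ r' , w ++ʷ w') U) T

  ∑ᵀ-⊗ : ∀ {m n} (φ : 𝕂 → Word (m ℕ.+ n) → 𝓕) (T : Tensor m) (U : Tensor n) →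
         ∑ᵀ φ (T ⊗ U) ≡ ∑ᵀ (λ r w → ∑ᵀ (λ r' w' → φ (r *ᴷ r') (w ++ʷ w')) U) T
  ∑ᵀ-⊗ φ T U = trans (∑-concatMap _ _ T) (List.concatMap-cong (λ _ → List.concatMap-map _ _ U) T)

  ▷-++ʷ : ∀ {m n} (σ : Permutation′ m) (τ : Permutation′ n) (u : Word m) (v : Word n) →
          (σ ▷ u) ++ʷ (τ ▷ v) ≈ʷ (σ ×ₚ τ) ▷ (u ++ʷ v)
  ▷-++ʷ {m} σ τ u v i with side m i
  ... | left k = A.reflexive (trans (++ʷ-ˡ (σ ▷ u) (τ ▷ v) k)
                   (sym (trans (cong (u ++ʷ v) (×ₚ-flip-ˡ σ τ k)) (++ʷ-ˡ u v _))))
  ... | right k = A.reflexive (trans (++ʷ-ʳ (σ ▷ u) (τ ▷ v) k)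
                   (sym (trans (cong (u ++ʷ v) (×ₚ-flip-ʳ σ τ k)) (++ʷ-ʳ u v _))))

  shuffle-▷ : ∀ {m n} r (w : Word m) ρ σ r' (w' : Word n) ρ' σ' ψ →
    shuffle r (σ ▷ w) (ρ ∘ₚ σ) r' (σ' ▷ w') (ρ' ∘ₚ σ') ψ ≋
    [ term (m ℕ.+ n) (r *ᴷ r') (((σ ×ₚ σ') ∘ₚ ψ) ▷ (w ++ʷ w')) ((ρ ×ₚ ρ') ∘ₚ ((σ ×ₚ σ') ∘ₚ ψ)) ]
  shuffle-▷ r w ρ σ r' w' ρ' σ' ψ = ≋-term K.refl (λ i → ▷-++ʷ σ σ' w w' (ψ ⟨$⟩ˡ i))
    λ i → cong (ψ ⟨$⟩ʳ_) (sym (×ₚ-∘ ρ σ ρ' σ' i))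

  -- The sums over `σ`, `τ` and the shuffle `ψ` are brought into the order in which `∑ᵖ-Inc-⊕`
  -- merges them: shuffling `σ ▷ w` and `τ ▷ w'` by `ψ` is one action of `(σ ×ₚ τ) ∘ₚ ψ` on the
  -- concatenated word.
  orbit-* : ∀ {m n} (D : Colouring m) (E : Colouring n) T U ρ ρ' →
            orbit D T ρ * orbit E U ρ' ≋ orbit (D ⊕ E) (T ⊗ U) (ρ ×ₚ ρ')
  orbit-* {m} {n} D E T U ρ ρ' = begin
    orbit D T ρ * orbit E U ρ'
      ≈⟨ orbit-bind D T ρ _ ⟩
    ∑ᵍ (inc? D) (λ σ → ∑ T λ (r , w) → ∑ (orbit E U ρ') (term m r (σ ▷ w) (ρ ∘ₚ σ) *ₜ_))
      ≈⟨ ∑ᵍ-cong (inc? D) (λ σ _ → ∑-cong T λ (r , w) → ≋-trans (orbit-bind E U ρ' _)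
           (∑ᵍ-cong (inc? E) λ τ _ → ≋-trans
             (∑-cong U λ (r' , w') → *ₜ-shuffle r (σ ▷ w) (ρ ∘ₚ σ) r' (τ ▷ w') (ρ' ∘ₚ τ)) (∑-∑ᵍ H? U))) ⟩
    ∑ᵍ (inc? D) (λ σ → ∑ T λ (r , w) → ∑ᵍ (inc? E) λ τ → ∑ᵍ H? λ ψ → ∑ U λ (r' , w') →
      shuffle r (σ ▷ w) (ρ ∘ₚ σ) r' (τ ▷ w') (ρ' ∘ₚ τ) ψ)
      ≈⟨ ∑ᵍ-cong (inc? D) (λ σ _ → ≋-trans (∑-cong T λ _ → ∑ᵍ-swap (inc? E) H?) (∑-∑ᵍ H? T)) ⟩
    ∑ᵍ (inc? D) (λ σ → ∑ᵍ H? λ ψ → ∑ T λ (r , w) → ∑ᵍ (inc? E) λ τ → ∑ U λ (r' , w') →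
      shuffle r (σ ▷ w) (ρ ∘ₚ σ) r' (τ ▷ w') (ρ' ∘ₚ τ) ψ)
      ≈⟨ ∑ᵍ-swap (inc? D) H? ⟩
    ∑ᵍ H? (λ ψ → ∑ᵍ (inc? D) λ σ → ∑ T λ (r , w) → ∑ᵍ (inc? E) λ τ → ∑ U λ (r' , w') →
      shuffle r (σ ▷ w) (ρ ∘ₚ σ) r' (τ ▷ w') (ρ' ∘ₚ τ) ψ)
      ≈⟨ ∑ᵍ-cong H? (λ ψ _ → ∑ᵍ-cong (inc? D) λ σ _ → ≋-trans (∑-∑ᵍ (inc? E) T) (∑ᵍ-cong (inc? E) λ τ _ →
           ≋-trans (∑-cong T λ (r , w) → ∑-cong U λ (r' , w') → shuffle-▷ r w ρ σ r' w' ρ' τ ψ)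
             (≋-reflexive (sym (∑ᵀ-⊗ (λ r'' w'' → [ F₀ ((σ ×ₚ τ) ∘ₚ ψ) r'' w'' ]) T U))))) ⟩
    ∑ᵍ H? (λ ψ → ∑ᵍ (inc? D) λ σ → ∑ᵍ (inc? E) λ τ → F ((σ ×ₚ τ) ∘ₚ ψ))
      ≈⟨ ∑ᵖ-Inc-⊕ D E (λ p q e → ∑-cong (T ⊗ U) λ (r , w) →
           ≋-term K.refl (▷-cong {π = p} {q} e w) (λ i → e ((ρ ×ₚ ρ') ⟨$⟩ʳ i))) ⟨
    orbit (D ⊕ E) (T ⊗ U) (ρ ×ₚ ρ') ∎
    where
    H? = inc? (halves m n)
    F₀ : Permutation′ (m ℕ.+ n) → 𝕂 → Word (m ℕ.+ n) → Term
    F₀ χ r w = term (m ℕ.+ n) r (χ ▷ w) ((ρ ×ₚ ρ') ∘ₚ χ)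
    F : Permutation′ (m ℕ.+ n) → 𝓕
    F χ = ∑ᵀ (λ r w → [ F₀ χ r w ]) (T ⊗ U)

  -- An element of the Young subgroup of `D ⊕ E` is a juxtaposition. Its second factor is absorbed
  -- by `U` for each fixed word of `T`; then, with the sums interchanged, the first is absorbed by
  -- `T`.
  ⊗-Invariant : ∀ {m n} {D : Colouring m} {E : Colouring n} {T U} → Invariant D T → Invariant E U →
                Invariant (D ⊕ E) (T ⊗ U)
  ⊗-Invariant {m} {n} {D} {E} {T} {U} invT invU h pres with Pres-halves⇒×ₚ h (Pres-⊕⇒halves D E {h} pres)
  ... | σ , τ , e = begin
    (actᵀ h (T ⊗ U)) #e
      ≡⟨ trans (#e≡∑ᵀ (actᵀ h (T ⊗ U))) (trans (∑ᵀ-act _ h (T ⊗ U)) (∑ᵀ-⊗ _ T U)) ⟩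
    ∑ T (λ (r , w) → ∑ U λ (r' , w') → [ term (m ℕ.+ n) (r *ᴷ r') (h ▷ (w ++ʷ w')) Perm.id ])
      ≈⟨ ∑-cong T (λ (r , w) → ∑-cong U λ (r' , w') → ≋-term K.refl
           (λ i → A.trans (▷-cong {π = h} {σ ×ₚ τ} e (w ++ʷ w') i) (A.sym (▷-++ʷ σ τ w w' i))) λ _ → refl) ⟩
    ∑ T (λ (r , w) → ∑ U λ (r' , w') → [ term (m ℕ.+ n) (r *ᴷ r') ((σ ▷ w) ++ʷ (τ ▷ w')) Perm.id ])
      ≈⟨ ∑-cong T (λ (r , w) → ≋-trans (≋-reflexive (sym (∑ᵀ-act (λ r' w' → [ term (m ℕ.+ n) (r *ᴷ r') ((σ ▷ w) ++ʷ w') Perm.id ]) τ U)))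
           (∑ᵀ-resp _ (IsLin-term (*-scalingˡ r) (multi-++ʳ (σ ▷ w)) λ _ _ → refl) (invU τ (proj₂ both)))) ⟩
    ∑ T (λ (r , w) → ∑ U λ (r' , w') → [ term (m ℕ.+ n) (r *ᴷ r') ((σ ▷ w) ++ʷ w') Perm.id ])
      ≈⟨ ≋-trans (∑-swap T U) (∑-cong U λ (r' , w') → ≋-trans
           (≋-reflexive (sym (∑ᵀ-act (λ r w → [ term (m ℕ.+ n) (r *ᴷ r') (w ++ʷ w') Perm.id ]) σ T)))
           (∑ᵀ-resp _ (IsLin-term (*-scalingʳ r') (multi-++ˡ w') λ _ _ → refl) (invT σ (proj₁ both)))) ⟩
    ∑ U (λ (r' , w') → ∑ T λ (r , w) → [ term (m ℕ.+ n) (r *ᴷ r') (w ++ʷ w') Perm.id ])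
      ≈⟨ ∑-swap T U ⟨
    ∑ T (λ (r , w) → ∑ U λ (r' , w') → [ term (m ℕ.+ n) (r *ᴷ r') (w ++ʷ w') Perm.id ])
      ≡⟨ trans (#e≡∑ᵀ (T ⊗ U)) (∑ᵀ-⊗ _ T U) ⟨
    (T ⊗ U) #e ∎
    where
    both : Pres D σ × Pres E τ
    both = Pres-×ₚ⁻ D E {σ} {τ} (Pres-resp (D ⊕ E) {h} {σ ×ₚ τ} e pres)

  *-OrbitSum : ∀ {x y} → OrbitSum x → OrbitSum y → OrbitSum (x * y)
  *-OrbitSum empty _ = empty
  *-OrbitSum (plus {x} {x'} p p') q =
    up-to (≋-reflexive (sym (List.concatMap-++ _ x x'))) (plus (*-OrbitSum p q) (*-OrbitSum p' q))
  *-OrbitSum {y = y} (up-to e p) q = up-to (*-cong e (≋-refl {y})) (*-OrbitSum p q)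
  *-OrbitSum (orbit-sum D T _ _) empty = up-to (≋-sym (∑-0 (orbit D T Perm.id) λ _ → ≋-refl)) empty
  *-OrbitSum p@(orbit-sum D T _ _) (plus {y} {y'} q q') =
    up-to (≋-trans (≋-sym (∑-++ (orbit D T Perm.id)))
            (∑-cong (orbit D T Perm.id) λ t → ≋-reflexive (sym (List.concatMap-++ (t *ₜ_) y y'))))
      (plus (*-OrbitSum p q) (*-OrbitSum p q'))
  *-OrbitSum p@(orbit-sum D T _ _) (up-to e q) = up-to (*-cong (≋-refl {orbit D T Perm.id}) e) (*-OrbitSum p q)
  *-OrbitSum (orbit-sum {m} D T convex inv) (orbit-sum {n} E U convex' inv') =
    up-to (≋-sym (≋-trans (orbit-* D E T U Perm.id Perm.id)
                   (orbit-congʳ (D ⊕ E) (T ⊗ U) {Perm.id {m} ×ₚ Perm.id {n}} {Perm.id} (×ₚ-id {m} {n}))))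
      (orbit-sum (D ⊕ E) (T ⊗ U) (⊕-Convex {C = D} {E} convex convex') (⊗-Invariant {D = D} {E} {T} {U} inv inv'))

  scaleTerm : 𝕂 → Term → 𝓕
  scaleTerm k (term n r w σ) = [ term n (k *ᴷ r) w σ ]

  •≡∑ : ∀ k x → k • x ≡ ∑ x (scaleTerm k)
  •≡∑ k [] = refl
  •≡∑ k (term n r w σ ∷ x) = cong (term n (k *ᴷ r) w σ ∷_) (•≡∑ k x)

  scaleTerm-linear : ∀ k → LinearMap (scaleTerm k)
  scaleTerm-linear k n = IsLin-term (*-scalingˡ k) multi-id λ e → e

  •-OrbitSum : ∀ k {x} → OrbitSum x → OrbitSum (k • x)
  •-OrbitSum k empty = empty
  •-OrbitSum k (plus {x} {y} p q) =
    up-to (≋-reflexive (sym (List.map-++ _ x y))) (plus (•-OrbitSum k p) (•-OrbitSum k q))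
  •-OrbitSum k (up-to {x} {y} e p) = up-to
    (subst₂ _≋_ (sym (•≡∑ k x)) (sym (•≡∑ k y)) (∑-resp (scaleTerm-linear k) e)) (•-OrbitSum k p)
  •-OrbitSum k (orbit-sum {n} D T convex inv) = up-to (≋-sym same) (orbit-sum D kT convex inv-kT)
    where
    kT : Tensor n
    kT = map (λ (r , w) → k *ᴷ r , w) T
    same : k • orbit D T Perm.id ≋ orbit D kT Perm.id
    same = ≋-trans (≋-reflexive (•≡∑ k (orbit D T Perm.id))) (≋-trans (orbit-bind D T Perm.id (scaleTerm k))
      (∑ᵍ-cong (inc? D) λ χ _ → ≋-reflexive (sym (List.concatMap-map _ _ T))))
    inv-kT : Invariant D kT
    inv-kT h pres = begin
      (actᵀ h kT) #e
        ≡⟨ trans (#e≡∑ᵀ _) (trans (∑ᵀ-act _ h kT) (List.concatMap-map _ _ T)) ⟩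
      ∑ᵀ (λ r w → [ term n (k *ᴷ r) (h ▷ w) Perm.id ]) T
        ≡⟨ ∑ᵀ-act (λ r w → [ term n (k *ᴷ r) w Perm.id ]) h T ⟨
      ∑ᵀ (λ r w → [ term n (k *ᴷ r) w Perm.id ]) (actᵀ h T)
        ≈⟨ ∑ᵀ-resp _ (IsLin-term (*-scalingˡ k) multi-id λ _ _ → refl) (inv h pres) ⟩
      ∑ᵀ (λ r w → [ term n (k *ᴷ r) w Perm.id ]) T
        ≡⟨ trans (#e≡∑ᵀ _) (List.concatMap-map _ _ T) ⟨
      kT #e ∎

  -- A generator is the orbit sum of the one-class colouring, whose Young subgroup is the whole
  -- symmetric group, so the symmetry of its tensor is the required invariance.
  InNT⇒OrbitSum : ∀ {y} → InNT y → OrbitSum y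
  InNT⇒OrbitSum (gen n T symm) = up-to (≋-trans (orbit-trivial T Perm.id) (≋-reflexive (sym (#e≡∑ᵀ T))))
    (orbit-sum (trivial n) T (λ _ _ _ _ _ ne _ _ → ⊥-elim (ne refl)) λ h _ → ≋ᵀ⇒≋ (symm h))
  InNT⇒OrbitSum zero = empty
  InNT⇒OrbitSum (add p q) = plus (InNT⇒OrbitSum p) (InNT⇒OrbitSum q)
  InNT⇒OrbitSum (scale k p) = •-OrbitSum k (InNT⇒OrbitSum p)
  InNT⇒OrbitSum (mul p q) = *-OrbitSum (InNT⇒OrbitSum p) (InNT⇒OrbitSum q)
  InNT⇒OrbitSum (resp e p) = up-to e (InNT⇒OrbitSum p)

  -- Internal product of an orbit sum with a single right factor.

  module _ {n} (C : Colouring n) (k : 𝕂) (b : Word n) (τ : Permutation′ n) where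

    -- By `prod*-single` this is z_1 * ⋯ * z_l for single terms whose juxtaposition has coefficient
    -- `k`, word `b` and permutation `τ`, when `C` is the colouring by their blocks.
    rightFactor : 𝓕
    rightFactor = orbit C [ k , b ] τ

    -- x_C · D_C(w#σ) · (b#τ), where D_C(w#σ) = w#s for the unique s in the
    -- Young subgroup with σ⁻¹ s increasing on the classes of C.
    expansion : 𝕂 → Word n → Permutation′ n → 𝓕
    expansion r w σ = ∑ᵍ (pres? C) λ s → when (inc? C (s ∘ₚ Perm.flip σ)) (∑ᵍ (inc? C) λ π →
      [ term n (r *ᴷ k) ((π ▷ w) ⊙ ((s ∘ₚ π) ▷ b)) (τ ∘ₚ (s ∘ₚ π)) ])

    IsLin-expansion : IsLin expansion
    IsLin-expansion = IsLin-∑ᵍ (pres? C) λ s → IsLin-when (λ σ → inc? C (s ∘ₚ Perm.flip σ))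
      (λ {σ} {σ'} e → Inc-resp C {s ∘ₚ Perm.flip σ} {s ∘ₚ Perm.flip σ'} λ i → ≈-flip {σ = σ} {σ'} e (s ⟨$⟩ʳ i))
      (IsLin-∑ᵍ (inc? C) λ π → IsLin-term (*-scalingʳ k)
        (multi-∘ (multi-⊙ˡ ((s ∘ₚ π) ▷ b)) (multi-▷ π)) λ _ _ → refl)

    private
      collapse : ∀ {t f} → (∀ π → t ·ₜ term n k (π ▷ b) (τ ∘ₚ π) ≋ f π) → ∑ rightFactor (t ·ₜ_) ≋ ∑ᵍ (inc? C) f
      collapse {t} e = ≋-trans (orbit-bind C [ k , b ] τ (t ·ₜ_))
                         (∑ᵍ-cong (inc? C) λ π _ → ≋-trans ++-[] (e π))

    orbit-·-other : ∀ {m} (D : Colouring m) T → m ≢ n → orbit D T Perm.id · rightFactor ≋ ∑ (orbit D T Perm.id) (extend expansion)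
    orbit-·-other {m} D T ne = ≋-trans (≋-trans (orbit-bind D T Perm.id _) (∑ᵍ-0 (inc? D) λ χ → ∑-0 T λ (r , w) →
        ≋-trans (collapse λ π → ≋-reflexive (·ₜ-other r (χ ▷ w) (Perm.id ∘ₚ χ) k (π ▷ b) (τ ∘ₚ π) ne))
          (∑ᵍ-0 (inc? C) λ _ → ≋-refl)))
      (≋-sym (≋-trans (orbit-bind D T Perm.id _) (∑ᵍ-0 (inc? D) λ χ → ∑-0 T λ (r , w) → other r (χ ▷ w) (Perm.id ∘ₚ χ))))
      where
      other : ∀ r w σ → extend expansion (term m r w σ) ≋ []
      other r w σ with m ℕ.≟ n
      ... | yes e = ⊥-elim (ne e)
      ... | no _ = ≋-refl

    orbit-·-same : ∀ (D : Colouring n) T → Convex D → Invariant D T →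
                   orbit D T Perm.id · rightFactor ≋ ∑ (orbit D T Perm.id) (extend expansion)
    orbit-·-same D T convex inv = begin
      orbit D T Perm.id · rightFactor
        ≈⟨ ≋-trans (orbit-bind D T Perm.id _) (∑ᵍ-cong (inc? D) λ χ _ → ≋-trans
             (∑-cong T λ (r , w) → collapse λ π → ≋-reflexive (·ₜ-same r (χ ▷ w) (Perm.id ∘ₚ χ) k (π ▷ b) (τ ∘ₚ π)))
             (∑-∑ᵍ (inc? C) T)) ⟩
      ∑ᵍ (inc? D) (λ χ → ∑ᵍ (inc? C) λ π → G χ (π ∘ₚ χ))
        ≈⟨ double-coset C D convex G-resp G-inv ⟩
      ∑ᵍ (inc? D) (λ χ → ∑ᵍ (pres? C) λ s → when (inc? C (s ∘ₚ Perm.flip χ))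
        (∑ᵍ (inc? C) λ π → G (χ ∘ₚ π) (s ∘ₚ π)))
        ≈⟨ ∑ᵍ-cong (inc? D) (λ χ _ → ≋-trans (∑-cong T λ (r , w) → ≋-reflexive (extend-same expansion r (χ ▷ w) (Perm.id ∘ₚ χ)))
             (≋-trans (∑-∑ᵍ (pres? C) T) (∑ᵍ-cong (pres? C) λ s _ →
               ≋-trans (≋-sym (when-∑ (inc? C (s ∘ₚ Perm.flip χ)) T))
                 (when-cong (inc? C (s ∘ₚ Perm.flip χ)) λ _ → ∑-∑ᵍ (inc? C) T)))) ⟨
      ∑ᵍ (inc? D) (λ χ → ∑ᵀ (λ r w → extend expansion (term n r (χ ▷ w) (Perm.id ∘ₚ χ))) T)
        ≈⟨ orbit-bind D T Perm.id _ ⟨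
      ∑ (orbit D T Perm.id) (extend expansion) ∎
      where
      G : Permutation′ n → Permutation′ n → 𝓕
      G χ g = ∑ᵀ (λ r w → [ term n (r *ᴷ k) ((χ ▷ w) ⊙ (g ▷ b)) (τ ∘ₚ g) ]) T
      G-resp : ∀ χ χ' g g' → χ Perm.≈ χ' → g Perm.≈ g' → G χ g ≋ G χ' g'
      G-resp χ χ' g g' e e' = ∑-cong T λ (r , w) → ≋-term K.refl
        (⊙-cong (▷-cong {π = χ} {χ'} e w) (▷-cong {π = g} {g'} e' b)) λ i → e' (τ ⟨$⟩ʳ i)
      G-inv : ∀ χ h g → Pres D h → G (h ∘ₚ χ) g ≋ G χ g
      -- Acting with `h ∘ₚ χ` on a word is acting with `h` and then with `χ`, so `h` falls on `T`
      -- alone.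
      G-inv χ h g pres = ≋-trans
        (≋-reflexive (sym (∑ᵀ-act (λ r w → [ term n (r *ᴷ k) ((χ ▷ w) ⊙ (g ▷ b)) (τ ∘ₚ g) ]) h T)))
        (∑ᵀ-resp _ (IsLin-term (*-scalingʳ k) (multi-∘ (multi-⊙ˡ (g ▷ b)) (multi-▷ χ)) λ _ _ → refl) (inv h pres))

    -- Both sides are additive in `y` and respect `≋`, the right one because `expansion` is linear
    -- in the symbol even though its `s` depends on `σ`. This reduces the claim to orbit sums.
    OrbitSum-· : ∀ {y} → OrbitSum y → y · rightFactor ≋ ∑ y (extend expansion)
    OrbitSum-· empty = ≋-refl
    OrbitSum-· (plus {x} {y} p q) = begin
      (x ++ y) · rightFactor                            ≡⟨ List.concatMap-++ _ x y ⟩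
      x · rightFactor ++ y · rightFactor                ≈⟨ ≋-++ (OrbitSum-· p) (OrbitSum-· q) ⟩
      ∑ x (extend expansion) ++ ∑ y (extend expansion)  ≡⟨ List.concatMap-++ _ x y ⟨
      ∑ (x ++ y) (extend expansion)                     ∎
    OrbitSum-· (up-to e p) = ≋-trans (·-cong (≋-sym e) (≋-refl {rightFactor}))
      (≋-trans (OrbitSum-· p) (∑-resp (extend-linear IsLin-expansion) e))
    OrbitSum-· (orbit-sum {m} D T convex inv) with m ℕ.≟ n
    ... | yes refl = orbit-·-same D T convex inv
    ... | no ne = orbit-·-other D T ne

  -- Symbols restricted to intervals, and standardization.

  open Term

  infix 4 _~_
  -- Equality of single symbols: `Δ[_]` acts on terms and not on classes in `𝓕`, so the tensor
  -- factors of a coproduct are compared by this relation.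
  data _~_ : Term → Term → Set (c ⊔ ℓ ⊔ a ⊔ ℓa) where
    term~ : ∀ {n r r' w w' σ σ'} → r ≈ᴷ r' → w ≈ʷ w' → σ Perm.≈ σ' → term n r w σ ~ term n r' w' σ'

  ~⇒≋ : ∀ {t t'} → t ~ t' → [ t ] ≋ [ t' ]
  ~⇒≋ (term~ e e' e'') = ≋-term e e' e''

  ~-trans : ∀ {t t' t''} → t ~ t' → t' ~ t'' → t ~ t''
  ~-trans (term~ p q s) (term~ p' q' s') =
    term~ (K.trans p p') (λ i → A.trans (q i) (q' i)) (λ i → trans (s i) (s' i))

  Inj : ∀ {m n} → (Fin m → Fin n) → Set
  Inj ι = ∀ {i j} → ι i ≡ ι j → i ≡ j

  -- Inclusions of intervals starting at `o`. Recording values only makes inclusions that differ by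
  -- a `cast` or by the bracketing of a sum interchangeable.
  Shift : ∀ {m n} → ℕ → (Fin m → Fin n) → Set
  Shift o ι = ∀ i → toℕ (ι i) ≡ o ℕ.+ toℕ i

  Shift⇒Inj : ∀ {m n o} {ι : Fin m → Fin n} → Shift o ι → Inj ι
  Shift⇒Inj {o = o} sh {i} {j} e =
    Fin.toℕ-injective (ℕ.+-cancelˡ-≡ o _ _ (trans (sym (sh i)) (trans (cong toℕ e) (sh j))))

  std-unique : ∀ {k n} (v : Fin k → Fin n) → Inj v → ∀ {τ} → OrdIso v τ → std v Perm.≈ τ
  std-unique v inj {τ} iso = ordIso-unique v {std v} {τ} (std-ordIso v inj) iso

  std-cong : ∀ {k n} (v v' : Fin k → Fin n) → Inj v' → (∀ i → v i ≡ v' i) → std v Perm.≈ std v'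
  std-cong v v' inj e = std-unique v (λ {i} {j} q → inj (trans (sym (e i)) (trans q (e j)))) {std v'}
    λ i j → subst₂ (λ x y → (x Fin.< y → std v' ⟨$⟩ʳ i Fin.< std v' ⟨$⟩ʳ j) ×
                            (std v' ⟨$⟩ʳ i Fin.< std v' ⟨$⟩ʳ j → x Fin.< y))
              (sym (e i)) (sym (e j)) (std-ordIso v' inj i j)

  -- The shape of every tensor factor of an iterated coproduct of a symbol, for `ι` the inclusion of
  -- an interval; the coefficient stays with the first factor and the others carry 1.
  restrict : ∀ {n p} → 𝕂 → Word n → Permutation′ n → (Fin p → Fin n) → Term
  restrict {p = p} r w σ ι = term p r (w ∘ ι) (Perm.flip (std (λ i → σ ⟨$⟩ˡ ι i)))

  restrict-~ : ∀ {n p p'} o {r r' w w'} {σ σ' : Permutation′ n} → r ≈ᴷ r' → w ≈ʷ w' → σ Perm.≈ σ' →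
               (ι : Fin p → Fin n) (ι' : Fin p' → Fin n) → p ≡ p' → Shift o ι → Shift o ι' →
               restrict r w σ ι ~ restrict r' w' σ' ι'
  restrict-~ o {w = w} {w'} {σ} {σ'} e e' e'' ι ι' refl sh sh' =
    term~ e (λ i → A.trans (≈-cong w (same i)) (e' (ι' i)))
      (≈-flip {σ = std v} {std v'} (std-cong v v' (Shift⇒Inj sh' ∘ ⟨$⟩ˡ-injective σ') λ i →
        trans (cong (σ ⟨$⟩ˡ_) (same i)) (≈-flip {σ = σ} {σ'} e'' (ι' i))))
    where
    v = λ i → σ ⟨$⟩ˡ ι i
    v' = λ i → σ' ⟨$⟩ˡ ι' i
    same : ∀ i → ι i ≡ ι' i
    same i = Fin.toℕ-injective (trans (sh i) (sym (sh' i)))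

  -- `std` keeps all comparisons of letters, so a subword of a standardized word has the same
  -- standardization as the subword itself. This collapses repeated cutting to a single restriction.
  restrict-restrict : ∀ {n p q r} {w : Word n} {σ : Permutation′ n} {ι : Fin q → Fin n} {κ : Fin p → Fin q} →
    Inj ι → Inj κ → restrict r (w ∘ ι) (Perm.flip (std (λ i → σ ⟨$⟩ˡ ι i))) κ ~ restrict r w σ (ι ∘ κ)
  restrict-restrict {σ = σ} {ι} {κ} inj inj' = term~ K.refl (λ _ → A.refl)
    (≈-flip {σ = std (λ i → std v ⟨$⟩ʳ κ i)} {std (v ∘ κ)}
      (λ i → sym (std-unique (v ∘ κ) (inj' ∘ v-inj) {std (λ i → std v ⟨$⟩ʳ κ i)}
        (λ i j → let (to , from) = std-ordIso (λ i → std v ⟨$⟩ʳ κ i) (inj' ∘ ⟨$⟩ʳ-injective (std v)) i j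
                     (to' , from') = std-ordIso v v-inj (κ i) (κ j)
                 in to ∘ to' , from' ∘ from) i)))
    where
    v = λ i → σ ⟨$⟩ˡ ι i
    v-inj : Inj v
    v-inj = inj ∘ ⟨$⟩ˡ-injective σ

  restrict-all : ∀ {n} r w σ {ι : Fin n → Fin n} → Shift 0 ι → term n r w σ ~ restrict r w σ ι
  restrict-all r w σ {ι} sh = term~ K.refl (λ i → ≈-cong w (sym (fix i)))
    (λ i → sym (≈-flip {σ = std (λ i → σ ⟨$⟩ˡ ι i)} {Perm.flip σ}
       (std-unique (λ i → σ ⟨$⟩ˡ ι i) (Shift⇒Inj sh ∘ ⟨$⟩ˡ-injective σ) {Perm.flip σ} iso) i))
    where
    fix : ∀ i → ι i ≡ i
    fix i = Fin.toℕ-injective (sh i)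
    iso : OrdIso (λ i → σ ⟨$⟩ˡ ι i) (Perm.flip σ)
    iso i j rewrite fix i | fix j = (λ lt → lt) , (λ lt → lt)

  -- Localisation of iterated coproducts at fixed degrees

  takeι : ∀ {n} (p : Fin (suc n)) → Fin (toℕ p) → Fin n
  takeι p i = inject≤ i (Fin.toℕ≤pred[n] p)

  dropι : ∀ {n} (p : Fin (suc n)) → Fin (n ℕ.∸ toℕ p) → Fin n
  dropι p i = cast (ℕ.m+[n∸m]≡n (Fin.toℕ≤pred[n] p)) (toℕ p ↑ʳ i)

  takeι-Shift : ∀ {n} (p : Fin (suc n)) → Shift 0 (takeι p)
  takeι-Shift p i = Fin.toℕ-inject≤ i (Fin.toℕ≤pred[n] p)

  dropι-Shift : ∀ {n} (p : Fin (suc n)) → Shift (toℕ p) (dropι p)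
  dropι-Shift p i = trans (Fin.toℕ-cast _ (toℕ p ↑ʳ i)) (Fin.toℕ-↑ʳ (toℕ p) i)

  ∑-Δₜ : ∀ {n} r w σ (h : Term × Term → 𝓕) → ∑ (Δₜ (term n r w σ)) h ≡
         ∑ (allFin (suc n)) (λ p → h (restrict r w σ (takeι p) , restrict 1ᴷ w σ (dropι p)))
  ∑-Δₜ {n} r w σ h = List.concatMap-map h _ (allFin (suc n))

  module _ {m n N : ℕ} {h : Term × Term → 𝓕} {r : 𝕂} {w : Word N} {σ : Permutation′ N}
           (h-resp : ∀ {t t' u u'} → t ~ t' → u ~ u' → h (t , u) ≋ h (t' , u'))
           (h-vanish : ∀ t u → deg t ≢ m → h (t , u) ≋ []) where

    -- By `h-vanish` only the cut at `m` survives; there both factors are restrictions of a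
    -- restriction. The inclusions are prescribed by their shifts alone, which absorbs the casts in
    -- `Δₜ`.
    ∑-Δₜ-restrict : ∀ {ι : Fin (m ℕ.+ n) → Fin N} {ι₁ : Fin m → Fin N} {ι₂ : Fin n → Fin N} →
      Shift 0 ι → Shift 0 ι₁ → Shift m ι₂ →
      ∑ (Δₜ (restrict r w σ ι)) h ≋ h (restrict r w σ ι₁ , restrict 1ᴷ w σ ι₂)
    ∑-Δₜ-restrict {ι} {ι₁} {ι₂} sh sh₁ sh₂ = begin
      ∑ (Δₜ (restrict r w σ ι)) h
        ≡⟨ ∑-Δₜ r w' σ' h ⟩
      ∑ (allFin (suc (m ℕ.+ n))) (λ p → h (restrict r w' σ' (takeι p) , restrict 1ᴷ w' σ' (dropι p)))
        ≈⟨ ∑-tabulate-unique (λ p → p) p (λ j ne → h-vanish _ _ λ e →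
             ne (Fin.toℕ-injective (trans e (sym p≡)))) ⟩
      h (restrict r w' σ' (takeι p) , restrict 1ᴷ w' σ' (dropι p))
        ≈⟨ h-resp
             (~-trans (restrict-restrict {w = w} {σ} {ι} (Shift⇒Inj sh) (Shift⇒Inj (takeι-Shift p)))
               (restrict-~ 0 {w = w} {w} {σ} {σ} K.refl (λ _ → A.refl) (λ _ → refl) (ι ∘ takeι p) ι₁ p≡
                 (λ i → trans (sh _) (takeι-Shift p i)) sh₁))
             (~-trans (restrict-restrict {w = w} {σ} {ι} (Shift⇒Inj sh) (Shift⇒Inj (dropι-Shift p)))
               (restrict-~ m {w = w} {w} {σ} {σ} K.refl (λ _ → A.refl) (λ _ → refl) (ι ∘ dropι p) ι₂
                 (trans (cong (m ℕ.+ n ℕ.∸_) p≡) (ℕ.m+n∸m≡n m n))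
                 (λ i → trans (sh _) (trans (dropι-Shift p i) (cong (ℕ._+ toℕ i) p≡))) sh₂)) ⟩
      h (restrict r w σ ι₁ , restrict 1ᴷ w σ ι₂) ∎
      where
      w' = w ∘ ι
      σ' = Perm.flip (std (λ i → σ ⟨$⟩ˡ ι i))
      p : Fin (suc (m ℕ.+ n))
      p = fromℕ< (s≤s (ℕ.m≤m+n m n))
      p≡ : toℕ p ≡ m
      p≡ = Fin.toℕ-fromℕ< (s≤s (ℕ.m≤m+n m n))

  _⊠_ : Term → Term → Term
  t ⊠ u = term (deg t ℕ.+ deg u) (coef t *ᴷ coef u) (word t ++ʷ word u) (perm t ×ₚ perm u)

  jux : ∀ {k} → Term → Vec Term k → Term
  jux t [] = t
  jux t (u ∷ us) = t ⊠ jux u us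

  blocks : ∀ {k} t (ts : Vec Term k) → Colouring (deg (jux t ts))
  blocks t [] = trivial (deg t)
  blocks t (u ∷ us) = trivial (deg t) ⊕ blocks u us

  deg-jux-⊠ : ∀ {k} t u (us : Vec Term k) → deg (jux (t ⊠ u) us) ≡ deg (jux t (u ∷ us))
  deg-jux-⊠ t u [] = refl
  deg-jux-⊠ t u (v ∷ vs) = ℕ.+-assoc (deg t) (deg u) (deg (jux v vs))

  degs : ∀ {k} → Vec Term k → Vec ℕ k
  degs = Vec.map deg

  -- Only the degrees of the terms t ∷ ts matter for parts and localise.
  parts : ∀ {k n} → 𝕂 → Word n → Permutation′ n → (t : Term) (ts : Vec Term k) →
          (Fin (deg (jux t ts)) → Fin n) → Vec Term (suc k)
  parts r w σ t [] ι = restrict r w σ ι ∷ []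
  parts r w σ t (u ∷ us) ι =
    restrict r w σ (ι ∘ (_↑ˡ deg (jux u us))) ∷ parts 1ᴷ w σ u us (ι ∘ (deg t ↑ʳ_))

  ↑ˡ-Shift : ∀ {l m n o} {ι : Fin (m ℕ.+ n) → Fin l} → Shift o ι → Shift o (ι ∘ (_↑ˡ n))
  ↑ˡ-Shift {n = n} {o} sh i = trans (sh _) (cong (o ℕ.+_) (Fin.toℕ-↑ˡ i n))

  ↑ʳ-Shift : ∀ {l m n o} {ι : Fin (m ℕ.+ n) → Fin l} → Shift o ι → Shift (o ℕ.+ m) (ι ∘ (m ↑ʳ_))
  ↑ʳ-Shift {m = m} {o = o} sh i =
    trans (sh _) (trans (cong (o ℕ.+_) (Fin.toℕ-↑ʳ m i)) (sym (ℕ.+-assoc o m (toℕ i))))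

  parts-~ : ∀ {k n} o r w (σ : Permutation′ n) t (ts : Vec Term k) {ι ι'} → Shift o ι → Shift o ι' →
            Pointwise _~_ (parts r w σ t ts ι) (parts r w σ t ts ι')
  parts-~ o r w σ t [] sh sh' =
    restrict-~ o {w = w} {w} {σ} {σ} K.refl (λ _ → A.refl) (λ _ → refl) _ _ refl sh sh' ∷ []
  parts-~ o r w σ t (u ∷ us) {ι} {ι'} sh sh' =
    restrict-~ o {w = w} {w} {σ} {σ} K.refl (λ _ → A.refl) (λ _ → refl) _ _ refl (↑ˡ-Shift {ι = ι} sh) (↑ˡ-Shift {ι = ι'} sh')
    ∷ parts-~ (o ℕ.+ deg t) 1ᴷ w σ u us (↑ʳ-Shift {ι = ι} sh) (↑ʳ-Shift {ι = ι'} sh')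

  ~-refl : ∀ {t} → t ~ t
  ~-refl = term~ K.refl (λ _ → A.refl) (λ _ → refl)

  Pointwise~-refl : ∀ {k} {ts : Vec Term k} → Pointwise _~_ ts ts
  Pointwise~-refl = PW.refl ~-refl

  -- Induction on the number of tensor factors. `Δ[_]` always splits the first factor, so summing
  -- `f` over these splittings gives a function of one factor fewer, supported where the first two
  -- prescribed degrees are added; `∑-Δₜ-restrict` then evaluates it at the surviving cut.
  localise : ∀ {k} t (ts : Vec Term k) (f : Vec Term (suc k) → 𝓕) →
    (∀ {us us'} → Pointwise _~_ us us' → f us ≋ f us') →
    (∀ us → degs us ≢ degs (t ∷ ts) → f us ≋ []) →
    ∀ {n} r w σ →
    (n ≢ deg (jux t ts) → ∑ (Δ[ k ] (term n r w σ)) f ≋ []) ×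
    (∀ ι → n ≡ deg (jux t ts) → Shift 0 ι → ∑ (Δ[ k ] (term n r w σ)) f ≋ f (parts r w σ t ts ι))
  localise t [] f f-resp f-vanish {n} r w σ =
    (λ ne → ≋-trans ++-[] (f-vanish _ λ e → ne (Vec.∷-injectiveˡ e))) ,
    λ { ι refl sh → ≋-trans ++-[] (f-resp (restrict-all r w σ sh ∷ [])) }
  localise {suc k} t (t' ∷ ts) f f-resp f-vanish {n} r w σ =
    (λ ne → ≋-trans unfold (proj₁ IH λ e → ne (trans e (deg-jux-⊠ t t' ts)))) ,
    λ ι e sh → ≋-trans unfold (≋-trans
      -- The degrees of `jux (t ⊠ t') ts` and `jux t (t' ∷ ts)` agree only up to associativity of
      -- addition; the cast leaves the shift at 0.
      (proj₂ IH (ι ∘ cast (deg-jux-⊠ t t' ts)) (trans e (sym (deg-jux-⊠ t t' ts))) (cast-Shift ι sh))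
      (regroup ts ι f-resp f-vanish sh))
    where
    g : ∀ {k} → (Vec Term (suc (suc k)) → 𝓕) → Vec Term (suc k) → 𝓕
    g f (u ∷ us) = ∑ (Δₜ u) λ (u₁ , u₂) → f (u₁ ∷ u₂ ∷ us)
    unfold : ∑ (Δ[ suc k ] (term n r w σ)) f ≋ ∑ (Δ[ k ] (term n r w σ)) (g f)
    unfold = ≋-trans (≋-reflexive (∑-concatMap f _ (Δ[ k ] (term n r w σ))))
      (∑-cong (Δ[ k ] (term n r w σ)) λ { (u ∷ us) → ≋-reflexive (List.concatMap-map f _ (Δₜ u)) })
    g-resp : ∀ {us us'} → Pointwise _~_ us us' → g f us ≋ g f us'
    g-resp {term m s v τ ∷ us} {term .m s' v' τ' ∷ us'} (term~ e e' e'' ∷ es) = begin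
      ∑ (Δₜ (term m s v τ)) (λ (u₁ , u₂) → f (u₁ ∷ u₂ ∷ us))
        ≡⟨ ∑-Δₜ s v τ _ ⟩
      ∑ (allFin (suc m)) (λ p → f (restrict s v τ (takeι p) ∷ restrict 1ᴷ v τ (dropι p) ∷ us))
        ≈⟨ ∑-cong (allFin (suc m)) (λ p → f-resp
             (restrict-~ 0 {σ = τ} {τ'} e e' e'' _ _ refl (takeι-Shift p) (takeι-Shift p) ∷
              restrict-~ (toℕ p) {σ = τ} {τ'} K.refl e' e'' _ _ refl (dropι-Shift p) (dropι-Shift p) ∷ es)) ⟩
      ∑ (allFin (suc m)) (λ p → f (restrict s' v' τ' (takeι p) ∷ restrict 1ᴷ v' τ' (dropι p) ∷ us'))
        ≡⟨ ∑-Δₜ s' v' τ' _ ⟨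
      ∑ (Δₜ (term m s' v' τ')) (λ (u₁ , u₂) → f (u₁ ∷ u₂ ∷ us')) ∎
    g-vanish : ∀ us → degs us ≢ degs ((t ⊠ t') ∷ ts) → g f us ≋ []
    g-vanish (term m s v τ ∷ us) ne = ≋-trans (≋-reflexive (∑-Δₜ s v τ _)) (∑-0 (allFin (suc m)) λ p →
      f-vanish _ λ e → ne (cong₂ _∷_
        (trans (sym (ℕ.m+[n∸m]≡n (Fin.toℕ≤pred[n] p)))
          (cong₂ ℕ._+_ (Vec.∷-injectiveˡ e) (Vec.∷-injectiveˡ (Vec.∷-injectiveʳ e))))
        (Vec.∷-injectiveʳ (Vec.∷-injectiveʳ e))))
    IH = localise (t ⊠ t') ts (g f) g-resp g-vanish {n} r w σ
    cast-Shift : ∀ ι → Shift 0 ι → Shift 0 (ι ∘ cast (deg-jux-⊠ t t' ts))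
    cast-Shift ι sh i = trans (sh _) (Fin.toℕ-cast (deg-jux-⊠ t t' ts) i)
    regroup : ∀ {k} (ts : Vec Term k) ι {f : Vec Term (suc (suc k)) → 𝓕} →
              (∀ {us us'} → Pointwise _~_ us us' → f us ≋ f us') →
              (∀ us → degs us ≢ degs (t ∷ t' ∷ ts) → f us ≋ []) → Shift 0 ι →
              g f (parts r w σ (t ⊠ t') ts (ι ∘ cast (deg-jux-⊠ t t' ts))) ≋ f (parts r w σ t (t' ∷ ts) ι)
    regroup [] ι f-resp f-vanish sh = ∑-Δₜ-restrict {r = r} {w} {σ}
      (λ e e' → f-resp (e ∷ e' ∷ [])) (λ u₁ u₂ ne → f-vanish _ (ne ∘ Vec.∷-injectiveˡ))
      (λ i → trans (sh _) (Fin.toℕ-cast _ i)) (↑ˡ-Shift {ι = ι} sh) (↑ʳ-Shift {ι = ι} sh)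
    regroup (t'' ∷ ts) ι {f} f-resp f-vanish sh = ≋-trans
      (∑-Δₜ-restrict {r = r} {w} {σ}
        (λ e e' → f-resp (e ∷ e' ∷ Pointwise~-refl)) (λ u₁ u₂ ne → f-vanish _ (ne ∘ Vec.∷-injectiveˡ))
        (↑ˡ-Shift {ι = ι ∘ cast assoc} sh') (↑ˡ-Shift {ι = ι} sh)
        (↑ˡ-Shift {ι = ι ∘ (deg t ↑ʳ_)} (↑ʳ-Shift {ι = ι} sh)))
      (f-resp (~-refl ∷ ~-refl ∷ parts-~ (deg t ℕ.+ deg t') 1ᴷ w σ t'' ts
        (↑ʳ-Shift {ι = ι ∘ cast assoc} sh') (↑ʳ-Shift {ι = ι ∘ (deg t ↑ʳ_)} (↑ʳ-Shift {ι = ι} sh))))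
      where
      assoc = deg-jux-⊠ t t' (t'' ∷ ts)
      sh' : Shift 0 (ι ∘ cast assoc)
      sh' i = trans (sh _) (Fin.toℕ-cast assoc i)

  prod*-∷ : ∀ {k} x (xs : Vec 𝓕 (suc k)) → prod* (x ∷ xs) ≡ x * prod* xs
  prod*-∷ x (_ ∷ _) = refl

  *-∑ʳ : ∀ {x} {X : Set x} y (xs : List X) (f : X → 𝓕) → y * ∑ xs f ≋ ∑ xs (λ x → y * f x)
  *-∑ʳ y xs f = ≋-trans (∑-cong y λ t → ≋-reflexive (∑-concatMap (t *ₜ_) f xs)) (∑-swap y xs)

  ·-∑ʳ : ∀ {x} {X : Set x} y (xs : List X) (f : X → 𝓕) → y · ∑ xs f ≋ ∑ xs (λ x → y · f x)
  ·-∑ʳ y xs f = ≋-trans (∑-cong y λ t → ≋-reflexive (∑-concatMap (t ·ₜ_) f xs)) (∑-swap y xs)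

  -- Multilinear expansion of a vector of linear combinations

  choices : ∀ {k} → Vec 𝓕 k → List (Vec Term k)
  choices [] = [ [] ]
  choices (z ∷ zs) = concatMap (λ t → map (t ∷_) (choices zs)) z

  module _ {u} {U : Set u} (f : U → 𝓕 → 𝓕) (f-∑ : ∀ u z → f u z ≋ ∑ z (λ t → f u [ t ])) where

    -- The parameter `U` lets one expansion serve twice: with `⊤` for the plain product of the `zs`,
    -- and with `Term` for the factors `[ u ] · z` of the Sweedler sum.
    prod*-choices : ∀ {k} (us : Vec U (suc k)) (zs : Vec 𝓕 (suc k)) →
      prod* (Vec.zipWith f us zs) ≋ ∑ (choices zs) (λ ts → prod* (Vec.zipWith f us (Vec.map [_] ts)))
    prod*-choices (u ∷ []) (z ∷ []) = begin
      f u z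
        ≈⟨ f-∑ u z ⟩
      ∑ z (λ t → f u [ t ])
        ≈⟨ ∑-cong z (λ t → ++-[]) ⟨
      ∑ z (λ t → ∑ [ t ∷ [] ] (λ ts → prod* (Vec.zipWith f (u ∷ []) (Vec.map [_] ts))))
        ≡⟨ ∑-concatMap _ _ z ⟨
      ∑ (choices (z ∷ [])) (λ ts → prod* (Vec.zipWith f (u ∷ []) (Vec.map [_] ts))) ∎
    prod*-choices (u ∷ us@(_ ∷ _)) (z ∷ zs@(_ ∷ _)) = begin
      f u z * prod* (Vec.zipWith f us zs)
        ≈⟨ *-cong (f-∑ u z) (prod*-choices us zs) ⟩
      ∑ z (λ t → f u [ t ]) * ∑ (choices zs) G
        ≡⟨ ∑-concatMap _ _ z ⟩
      ∑ z (λ t → f u [ t ] * ∑ (choices zs) G)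
        ≈⟨ ∑-cong z (λ t → *-∑ʳ (f u [ t ]) (choices zs) G) ⟩
      ∑ z (λ t → ∑ (choices zs) λ ts → f u [ t ] * G ts)
        ≈⟨ ∑-cong z (λ t → ∑-cong (choices zs) λ ts →
             ≋-reflexive (prod*-∷ (f u [ t ]) (Vec.zipWith f us (Vec.map [_] ts)))) ⟨
      ∑ z (λ t → ∑ (choices zs) λ ts → prod* (Vec.zipWith f (u ∷ us) (Vec.map [_] (t ∷ ts))))
        ≡⟨ trans (∑-concatMap _ _ z) (List.concatMap-cong (λ t → List.concatMap-map _ (t ∷_) (choices zs)) z) ⟨
      ∑ (choices (z ∷ zs)) (λ ts → prod* (Vec.zipWith f (u ∷ us) (Vec.map [_] ts))) ∎
      where
      G = λ ts → prod* (Vec.zipWith f us (Vec.map [_] ts))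

  zipWith-ignore : ∀ {k} (zs : Vec 𝓕 k) → Vec.zipWith (λ (_ : ⊤) z → z) (Vec.replicate k tt) zs ≡ zs
  zipWith-ignore {k} zs = trans (Vec.zipWith-replicate₁ (λ _ z → z) tt zs) (Vec.map-id zs)

  prod*-expand : ∀ {k} (zs : Vec 𝓕 (suc k)) → prod* zs ≋ ∑ (choices zs) (λ ts → prod* (Vec.map [_] ts))
  prod*-expand {k} zs = begin
    prod* zs
      ≡⟨ cong prod* (zipWith-ignore zs) ⟨
    prod* (Vec.zipWith (λ _ z → z) (Vec.replicate (suc k) tt) zs)
      ≈⟨ prod*-choices (λ _ z → z) (λ _ z → ≋-reflexive (sym (List.concatMap-pure z))) (Vec.replicate (suc k) tt) zs ⟩
    ∑ (choices zs) (λ ts → prod* (Vec.zipWith (λ _ z → z) (Vec.replicate (suc k) tt) (Vec.map [_] ts)))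
      ≡⟨ List.concatMap-cong (λ ts → cong prod* (zipWith-ignore (Vec.map [_] ts))) (choices zs) ⟩
    ∑ (choices zs) (λ ts → prod* (Vec.map [_] ts)) ∎

  juxFactor : ∀ {k} → Term → Vec Term k → 𝓕
  juxFactor t ts = let J = jux t ts in rightFactor (blocks t ts) (coef J) (word J) (perm J)

  prod*-single : ∀ {k} t (ts : Vec Term k) → prod* (Vec.map [_] (t ∷ ts)) ≋ juxFactor t ts
  prod*-single t [] = ≋-sym (orbit-trivial [ coef t , word t ] (perm t))
  prod*-single t (u ∷ us) = begin
    [ t ] * prod* (Vec.map [_] (u ∷ us))
      ≈⟨ *-cong (≋-sym (orbit-trivial [ coef t , word t ] (perm t))) (prod*-single u us) ⟩
    orbit (trivial (deg t)) [ coef t , word t ] (perm t) * juxFactor u us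
      ≈⟨ orbit-* (trivial (deg t)) (blocks u us)
           [ coef t , word t ] [ coef (jux u us) , word (jux u us) ] (perm t) (perm (jux u us)) ⟩
    juxFactor t (u ∷ us) ∎

  -- The coproduct side for single terms

  -- The permutation carried by the juxtaposed `parts`. For `ι` the identity, `localPerm-Pres` and
  -- `localPerm-Inc` show it to be the `s` of the Young subgroup with σ⁻¹s increasing on the blocks.
  localPerm : ∀ {k n} → Permutation′ n → (t : Term) (ts : Vec Term k) →
              (Fin (deg (jux t ts)) → Fin n) → Permutation′ (deg (jux t ts))
  localPerm σ t [] ι = Perm.flip (std (λ i → σ ⟨$⟩ˡ ι i))
  localPerm σ t (u ∷ us) ι =
    Perm.flip (std (λ i → σ ⟨$⟩ˡ ι (i ↑ˡ deg (jux u us)))) ×ₚ localPerm σ u us (ι ∘ (deg t ↑ʳ_))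

  localPerm-Pres : ∀ {k n} (σ : Permutation′ n) t (ts : Vec Term k) ι → Pres (blocks t ts) (localPerm σ t ts ι)
  localPerm-Pres σ t [] ι i = refl
  localPerm-Pres σ t (u ∷ us) ι = Pres-×ₚ (trivial (deg t)) (blocks u us)
    {Perm.flip (std (λ i → σ ⟨$⟩ˡ ι (i ↑ˡ deg (jux u us))))} {localPerm σ u us (ι ∘ (deg t ↑ʳ_))}
    (λ _ → refl) (localPerm-Pres σ u us (ι ∘ (deg t ↑ʳ_)))

  flip-std-mono : ∀ {k n} (v : Fin k → Fin n) → Inj v → ∀ {i j} → i Fin.< j →
                  v (std v ⟨$⟩ˡ i) Fin.< v (std v ⟨$⟩ˡ j)
  flip-std-mono v inj lt = proj₂ (std-ordIso v inj _ _)
    (subst₂ Fin._<_ (sym (inverseʳ (std v))) (sym (inverseʳ (std v))) lt)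

  -- Within a block, the inverse of a standardization lists the positions by increasing letter, and
  -- the letters are values of σ⁻¹.
  localPerm-Inc : ∀ {k n} (σ : Permutation′ n) t (ts : Vec Term k) ι → Inj ι → ∀ i j →
    colour (blocks t ts) i ≡ colour (blocks t ts) j × i Fin.< j →
    σ ⟨$⟩ˡ ι (localPerm σ t ts ι ⟨$⟩ʳ i) Fin.< σ ⟨$⟩ˡ ι (localPerm σ t ts ι ⟨$⟩ʳ j)
  localPerm-Inc σ t [] ι inj i j (_ , lt) = flip-std-mono (λ i → σ ⟨$⟩ˡ ι i) (inj ∘ ⟨$⟩ˡ-injective σ) lt
  localPerm-Inc σ t (u ∷ us) ι inj i j (e , lt) with side (deg t) i | side (deg t) j
  ... | left a | left b = subst₂ (λ x y → σ ⟨$⟩ˡ ι x Fin.< σ ⟨$⟩ˡ ι y) (sym (×ₚ-ˡ ρ ρ' a)) (sym (×ₚ-ˡ ρ ρ' b))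
    (flip-std-mono v (Fin.↑ˡ-injective _ _ _ ∘ inj ∘ ⟨$⟩ˡ-injective σ) (↑ˡ-cancel lt))
    where
    v = λ i → σ ⟨$⟩ˡ ι (i ↑ˡ deg (jux u us))
    ρ = Perm.flip (std v)
    ρ' = localPerm σ u us (ι ∘ (deg t ↑ʳ_))
  ... | right a | right b = subst₂ (λ x y → σ ⟨$⟩ˡ ι x Fin.< σ ⟨$⟩ˡ ι y) (sym (×ₚ-ʳ ρ ρ' a)) (sym (×ₚ-ʳ ρ ρ' b))
    (localPerm-Inc σ u us (ι ∘ (deg t ↑ʳ_)) (Fin.↑ʳ-injective (deg t) _ _ ∘ inj) a b
      (⊕-ʳ-cancel (trivial (deg t)) (blocks u us) e , ↑ʳ-cancel {deg t} lt))
    where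
    ρ = Perm.flip (std (λ i → σ ⟨$⟩ˡ ι (i ↑ˡ deg (jux u us))))
    ρ' = localPerm σ u us (ι ∘ (deg t ↑ʳ_))
  ... | left _ | right _ = ⊥-elim (⊕-ˡ≢ʳ (trivial (deg t)) (blocks u us) e)
  ... | right _ | left _ = ⊥-elim (⊕-ˡ≢ʳ (trivial (deg t)) (blocks u us) (sym e))

  -- Since σ⁻¹ = (σ⁻¹s)s⁻¹ is the factorisation of σ⁻¹ along `C`, `decompose-unique` leaves a single
  -- `s` in the sum.
  expansion-point : ∀ {n} (C : Colouring n) k b τ r w σ s → Pres C s → Inc C (s ∘ₚ Perm.flip σ) →
    expansion C k b τ r w σ ≋ orbit C [ r *ᴷ k , w ⊙ (s ▷ b) ] (τ ∘ₚ s)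
  expansion-point C k b τ r w σ s pres inc = ∑ᵖ-unique s
    (λ q ne → when-0 (pres? C q) λ p → when-0 (inc? C (q ∘ₚ Perm.flip σ)) λ i → ⊥-elim (ne (unique q p i)))
    (λ q e → ≋-trans
      (≋-reflexive (trans (when-yes (pres? C q) (Pres-resp C {s} {q} (λ i → sym (e i)) pres))
        (when-yes (inc? C (q ∘ₚ Perm.flip σ))
          (Inc-resp C {s ∘ₚ Perm.flip σ} {q ∘ₚ Perm.flip σ} (λ i → cong (σ ⟨$⟩ˡ_) (sym (e i))) inc))))
      (∑ᵍ-cong (inc? C) λ π _ → ≋-term K.refl
        (λ i → A.·-cong A.refl (≈-cong b (≈-flip {σ = q} {s} e (π ⟨$⟩ˡ i))))
        (λ i → cong (π ⟨$⟩ʳ_) (e (τ ⟨$⟩ʳ i)))))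
    where
    unique : ∀ q → Pres C q → Inc C (q ∘ₚ Perm.flip σ) → q Perm.≈ s
    unique q p i = ≈-flip {σ = Perm.flip q} {Perm.flip s} (proj₂ (decompose-unique C
      {q ∘ₚ Perm.flip σ} {Perm.flip q} {s ∘ₚ Perm.flip σ} {Perm.flip s}
      i (Pres-flip C {q} p) inc (Pres-flip C {s} pres)
      (λ j → cong (σ ⟨$⟩ˡ_) (trans (inverseʳ q) (sym (inverseʳ s))))))

  pairing : ∀ {k} → Vec Term (suc k) → Vec Term (suc k) → 𝓕
  pairing ts us = prod* (Vec.zipWith (λ u z → [ u ] · z) us (Vec.map [_] ts))

  pairing-∷ : ∀ {k} t (ts : Vec Term (suc k)) u us →
              pairing (t ∷ ts) (u ∷ us) ≡ ([ u ] · [ t ]) * pairing ts us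
  pairing-∷ t ts u us = prod*-∷ ([ u ] · [ t ]) (Vec.zipWith (λ u z → [ u ] · z) us (Vec.map [_] ts))

  pairing-resp : ∀ {k} (ts : Vec Term (suc k)) {us us'} → Pointwise _~_ us us' → pairing ts us ≋ pairing ts us'
  pairing-resp (t ∷ []) (e ∷ []) = ·-cong (~⇒≋ e) (≋-refl {[ t ]})
  pairing-resp (t ∷ ts@(_ ∷ _)) {u ∷ us} {u' ∷ us'} (e ∷ es) = subst₂ _≋_
    (sym (pairing-∷ t ts u us)) (sym (pairing-∷ t ts u' us'))
    (*-cong (·-cong (~⇒≋ e) (≋-refl {[ t ]})) (pairing-resp ts es))

  ·-other : ∀ t u → deg u ≢ deg t → [ u ] · [ t ] ≋ []
  ·-other t u ne = ≋-trans ++-[] (≋-trans ++-[]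
    (≋-reflexive (·ₜ-other (coef u) (word u) (perm u) (coef t) (word t) (perm t) ne)))

  ·-same : ∀ n r w σ s v τ → [ term n r w σ ] · [ term n s v τ ] ≋ [ term n (r *ᴷ s) (w ⊙ (σ ▷ v)) (τ ∘ₚ σ) ]
  ·-same n r w σ s v τ = ≋-trans ++-[] (≋-trans ++-[] (≋-reflexive (·ₜ-same r w σ s v τ)))

  pairing-vanish : ∀ {k} (ts us : Vec Term (suc k)) → degs us ≢ degs ts → pairing ts us ≋ []
  pairing-vanish (t ∷ []) (u ∷ []) ne = ·-other t u (ne ∘ cong (_∷ []))
  pairing-vanish (t ∷ ts@(_ ∷ _)) (u ∷ us) ne =
    ≋-trans (≋-reflexive (pairing-∷ t ts u us)) (go (deg u ℕ.≟ deg t))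
    where
    go : Dec (deg u ≡ deg t) → ([ u ] · [ t ]) * pairing ts us ≋ []
    go (no ne') = *-cong (·-other t u ne') (≋-refl {pairing ts us})
    go (yes e) = ≋-trans
      (*-cong (≋-refl {[ u ] · [ t ]}) (pairing-vanish ts us λ e' → ne (cong₂ _∷_ e e')))
      (∑-0 ([ u ] · [ t ]) λ _ → ≋-refl)

  -- The factors of the internal products occupy disjoint blocks, so these products juxtapose to one
  -- internal product on the concatenated word, and `orbit-*` collects the shuffles block by block.
  pairing-parts : ∀ {k n} r (w : Word n) σ t (ts : Vec Term k) ι →
    pairing (t ∷ ts) (parts r w σ t ts ι) ≋
    orbit (blocks t ts) [ r *ᴷ coef (jux t ts) , (w ∘ ι) ⊙ (localPerm σ t ts ι ▷ word (jux t ts)) ]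
          (perm (jux t ts) ∘ₚ localPerm σ t ts ι)
  pairing-parts r w σ t [] ι = ≋-trans (·-same _ r (w ∘ ι) (localPerm σ t [] ι) (coef t) (word t) (perm t))
    (≋-sym (orbit-trivial [ r *ᴷ coef t , (w ∘ ι) ⊙ (localPerm σ t [] ι ▷ word t) ] (perm t ∘ₚ localPerm σ t [] ι)))
  pairing-parts r w σ t (u ∷ us) ι = begin
    pairing (t ∷ u ∷ us) (parts r w σ t (u ∷ us) ι)
      ≡⟨ pairing-∷ t (u ∷ us) (restrict r w σ ι₁) (parts 1ᴷ w σ u us ι₂) ⟩
    ([ restrict r w σ ι₁ ] · [ t ]) * pairing (u ∷ us) (parts 1ᴷ w σ u us ι₂)
      ≈⟨ *-cong (≋-trans (·-same _ r (w ∘ ι₁) ρ (coef t) (word t) (perm t))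
                         (≋-sym (orbit-trivial [ r *ᴷ coef t , (w ∘ ι₁) ⊙ (ρ ▷ word t) ] (perm t ∘ₚ ρ))))
                (pairing-parts 1ᴷ w σ u us ι₂) ⟩
    orbit (trivial (deg t)) [ r *ᴷ coef t , (w ∘ ι₁) ⊙ (ρ ▷ word t) ] (perm t ∘ₚ ρ) *
    orbit (blocks u us) [ 1ᴷ *ᴷ coef J , (w ∘ ι₂) ⊙ (ρ' ▷ word J) ] (perm J ∘ₚ ρ')
      ≈⟨ orbit-* (trivial (deg t)) (blocks u us)
           [ r *ᴷ coef t , (w ∘ ι₁) ⊙ (ρ ▷ word t) ] [ 1ᴷ *ᴷ coef J , (w ∘ ι₂) ⊙ (ρ' ▷ word J) ]
           (perm t ∘ₚ ρ) (perm J ∘ₚ ρ') ⟩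
    orbit (blocks t (u ∷ us))
      [ (r *ᴷ coef t) *ᴷ (1ᴷ *ᴷ coef J) , ((w ∘ ι₁) ⊙ (ρ ▷ word t)) ++ʷ ((w ∘ ι₂) ⊙ (ρ' ▷ word J)) ]
      ((perm t ∘ₚ ρ) ×ₚ (perm J ∘ₚ ρ'))
      ≈⟨ orbit-cong (blocks t (u ∷ us))
           {w = ((w ∘ ι₁) ⊙ (ρ ▷ word t)) ++ʷ ((w ∘ ι₂) ⊙ (ρ' ▷ word J))}
           {(w ∘ ι) ⊙ ((ρ ×ₚ ρ') ▷ (word t ++ʷ word J))}
           {(perm t ∘ₚ ρ) ×ₚ (perm J ∘ₚ ρ')} {(perm t ×ₚ perm J) ∘ₚ (ρ ×ₚ ρ')}
           -- Only the first part carries `r`; the 1 is the coefficient that the coproduct gives to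
           -- the remaining parts.
           (K.trans (K.*-congˡ (K.*-identityˡ (coef J))) (K.*-assoc r (coef t) (coef J)))
           words (λ i → sym (×ₚ-∘ (perm t) ρ (perm J) ρ' i)) ⟩
    orbit (blocks t (u ∷ us)) [ r *ᴷ (coef t *ᴷ coef J) , (w ∘ ι) ⊙ ((ρ ×ₚ ρ') ▷ (word t ++ʷ word J)) ]
      ((perm t ×ₚ perm J) ∘ₚ (ρ ×ₚ ρ')) ∎
    where
    J = jux u us
    ι₁ = ι ∘ (_↑ˡ deg J)
    ι₂ = ι ∘ (deg t ↑ʳ_)
    ρ = Perm.flip (std (λ i → σ ⟨$⟩ˡ ι₁ i))
    ρ' = localPerm σ u us ι₂
    words : ((w ∘ ι₁) ⊙ (ρ ▷ word t)) ++ʷ ((w ∘ ι₂) ⊙ (ρ' ▷ word J)) ≈ʷ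
            (w ∘ ι) ⊙ ((ρ ×ₚ ρ') ▷ (word t ++ʷ word J))
    words i with side (deg t) i
    ... | left a = A.reflexive (trans (++ʷ-ˡ ((w ∘ ι₁) ⊙ (ρ ▷ word t)) ((w ∘ ι₂) ⊙ (ρ' ▷ word J)) a)
      (cong (w (ι₁ a) ·ᴬ_) (sym (trans (cong (word t ++ʷ word J) (×ₚ-flip-ˡ ρ ρ' a)) (++ʷ-ˡ (word t) (word J) _)))))
    ... | right b = A.reflexive (trans (++ʷ-ʳ ((w ∘ ι₁) ⊙ (ρ ▷ word t)) ((w ∘ ι₂) ⊙ (ρ' ▷ word J)) b)
      (cong (w (ι₂ b) ·ᴬ_) (sym (trans (cong (word t ++ʷ word J) (×ₚ-flip-ʳ ρ ρ' b)) (++ʷ-ʳ (word t) (word J) _)))))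

  juxExpansion : ∀ {k} t (ts : Vec Term k) → Term → 𝓕
  juxExpansion t ts = let J = jux t ts in extend (expansion (blocks t ts) (coef J) (word J) (perm J))

  -- Turns the coproduct side, symbol by symbol, into the expression that `OrbitSum-·` obtains from
  -- the other side; symbols of the wrong degree contribute nothing to either. This holds for every
  -- symbol, and membership of `y` in NT(A) enters through `OrbitSum-·`.
  ∑-Δ-pairing : ∀ {k} t (ts : Vec Term k) x → ∑ (Δ[ k ] x) (pairing (t ∷ ts)) ≋ juxExpansion t ts x
  ∑-Δ-pairing t ts (term n r w σ) with n ℕ.≟ deg (jux t ts)
  ... | no ne = proj₁ (localise t ts (pairing (t ∷ ts)) (pairing-resp (t ∷ ts)) (pairing-vanish (t ∷ ts)) r w σ) ne
  ... | yes refl = begin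
    ∑ (Δ[ _ ] (term _ r w σ)) (pairing (t ∷ ts))
      ≈⟨ proj₂ (localise t ts (pairing (t ∷ ts)) (pairing-resp (t ∷ ts)) (pairing-vanish (t ∷ ts)) r w σ)
           (λ i → i) refl (λ _ → refl) ⟩
    pairing (t ∷ ts) (parts r w σ t ts (λ i → i))
      ≈⟨ pairing-parts r w σ t ts (λ i → i) ⟩
    orbit (blocks t ts) [ r *ᴷ coef J , w ⊙ (s ▷ word J) ] (perm J ∘ₚ s)
      ≈⟨ expansion-point (blocks t ts) (coef J) (word J) (perm J) r w σ s
           (localPerm-Pres σ t ts (λ i → i)) (localPerm-Inc σ t ts (λ i → i) (λ e → e)) ⟨
    expansion (blocks t ts) (coef J) (word J) (perm J) r w σ ∎
    where
    J = jux t ts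
    s = localPerm σ t ts (λ i → i)

  sweedlerSum-expand : ∀ {k} y (zs : Vec 𝓕 (suc k)) →
    sweedlerSum y zs ≋ ∑ (choices zs) (λ ts → ∑ y λ x → ∑ (Δ[ k ] x) (pairing ts))
  sweedlerSum-expand {k} y zs = begin
    ∑ y (λ x → ∑ (Δ[ k ] x) λ us → prod* (Vec.zipWith (λ u z → [ u ] · z) us zs))
      ≈⟨ ∑-cong y (λ x → ∑-cong (Δ[ k ] x) λ us → prod*-choices (λ u z → [ u ] · z) ·-linear us zs) ⟩
    ∑ y (λ x → ∑ (Δ[ k ] x) λ us → ∑ (choices zs) λ ts → pairing ts us)
      ≈⟨ ∑-cong y (λ x → ∑-swap (Δ[ k ] x) (choices zs)) ⟩
    ∑ y (λ x → ∑ (choices zs) λ ts → ∑ (Δ[ k ] x) (pairing ts))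
      ≈⟨ ∑-swap y (choices zs) ⟩
    ∑ (choices zs) (λ ts → ∑ y λ x → ∑ (Δ[ k ] x) (pairing ts)) ∎
    where
    ·-linear : ∀ u z → [ u ] · z ≋ ∑ z (λ t → [ u ] · [ t ])
    ·-linear u z = ≋-trans ++-[] (∑-cong z λ t → ≋-sym (≋-trans ++-[] ++-[]))

  internal-product-formula : ∀ {y} → InNT y → ∀ {k} (zs : Vec 𝓕 (suc k)) → y · prod* zs ≋ sweedlerSum y zs
  internal-product-formula {y} y∈NT {k} zs = begin
    y · prod* zs
      ≈⟨ ·-cong (≋-refl {y}) (prod*-expand zs) ⟩
    y · ∑ (choices zs) (λ ts → prod* (Vec.map [_] ts))
      ≈⟨ ·-∑ʳ y (choices zs) _ ⟩
    ∑ (choices zs) (λ ts → y · prod* (Vec.map [_] ts))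
      ≈⟨ ∑-cong (choices zs) single ⟩
    ∑ (choices zs) (λ ts → ∑ y λ x → ∑ (Δ[ k ] x) (pairing ts))
      ≈⟨ sweedlerSum-expand y zs ⟨
    sweedlerSum y zs ∎
    where
    single : ∀ ts → y · prod* (Vec.map [_] ts) ≋ ∑ y (λ x → ∑ (Δ[ k ] x) (pairing ts))
    single (t ∷ ts) = begin
      y · prod* (Vec.map [_] (t ∷ ts))  ≈⟨ ·-cong (≋-refl {y}) (prod*-single t ts) ⟩
      y · juxFactor t ts
        ≈⟨ OrbitSum-· (blocks t ts) (coef (jux t ts)) (word (jux t ts)) (perm (jux t ts)) (InNT⇒OrbitSum y∈NT) ⟩
      ∑ y (juxExpansion t ts)           ≈⟨ ∑-cong y (∑-Δ-pairing t ts) ⟨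
      ∑ y (λ x → ∑ (Δ[ k ] x) (pairing (t ∷ ts))) ∎

theorem3p4 : ∀ {c ℓ a ℓa} (K : CommutativeRing c ℓ) (A : KAlgebra K a ℓa) →
    (∀ {m ℓm : Level} → IsProjective K (KAlgebra.leftModule A) m ℓm) →
    (y : FA.𝓕 K A) → FA.InNT K A y →
    (k : ℕ) (z : Vec (FA.𝓕 K A) (suc k)) →
    FA._≋_ K A (FA._·_ K A y (FA.prod* K A z)) (FA.sweedlerSum K A y z)
theorem3p4 K A _ y y∈NT k z = internal-product-formula K A y∈NT z
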